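{- Let $Q$ be a symmetric function and let $\mu$ be a strict partition. For $n\ge 0$ put $$P(n)=\sum_{|\lambda/\mu|=n}\frac{2^{|\lambda|-|\mu|-\ell(\lambda)+\ell(\mu)}f_{\lambda/\mu}}{H_{\lambda}}\,Q\Bigl(\tbinom{c_{\square}}{2}:\square\in\lambda\Bigr),$$ where the sum ranges over all strict partitions $\lambda\supseteq\mu$ with $|\lambda|-|\mu|=n$. Then $P(n)$ is a polynomial in $n$.
   Context: A strict partition is a finite strictly decreasing sequence of positive integers $\lambda=(\lambda_1>\lambda_2>\cdots>\lambda_\ell)$ (the empty sequence $\emptyset$ is allowed); $|\lambda|=\sum_i\lambda_i$ is its size, $\ell(\lambda)=\ell$ its length, and $\lambda_i=0$ for $i>\ell(\lambda)$. The (shifted Young) diagram of $\lambda$ is the set of boxes $(i,j)$ with $1\le i\le \ell(\lambda)$ and $i+1\le j\le i+\lambda_i$ (row $i$, column $j$); $\lambda$ is identified with its diagram. The content of a box $\square=(i,j)$ is $c_\square=j-i$. The hook length $h_\square$ of $\square=(i,j)\in\lambda$ is the number of boxes of $\lambda$ in row $i$ strictly to the right of $\square$, plus the number of boxes $(i',j)\in\lambda$ with $i'>i$, plus $1$, plus $\lambda_j$. $H_\lambda=\prod_{\square\in\lambda}h_\square$ ($H_\emptyset=1$). For strict partitions write $\lambda\supseteq\mu$ if $\lambda_i\ge\mu_i$ for all $i$; then $\lambda/\mu$ denotes the set of boxes of $\lambda$ not in $\mu$, and $|\lambda/\mu|=|\lambda|-|\mu|$. $f_{\lambda/\mu}$ is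 the number of standard shifted Young tableaux of shape $\lambda/\mu$, i.e. bijective fillings of the boxes of $\lambda/\mu$ with $1,\dots,|\lambda/\mu|$ increasing from left to right along rows and from top to bottom along columns ($f_{\mu/\mu}=1$). For a symmetric function $Q$ (in infinitely many variables), $Q(\binom{c_\square}{2}:\square\in\lambda)$ means that $|\lambda|$ of the variables are specialized to the values $\binom{c_\square}{2}$, $\square\in\lambda$, and all other variables to $0$. -}

module Defs where

open import Data.Empty using (⊥-elim)
open import Data.Integer.Base using (+_)
open import Data.List.Base
  using (List; []; _∷_; _++_; [_]; map; concatMap; filter; foldr; length; upTo; zip; zipWith)
open import Data.List.Membership.Propositional using (_∈_; _∉_; lose; find)
open import Data.List.Membership.Propositional.Properties
  using (∈-map⁺; ∈-map⁻; ∈-++⁺ˡ; ∈-++⁺ʳ; ∈-++⁻; ∈-∃++; ∈-concatMap⁺; ∈-concatMap⁻;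
         ∈-filter⁺; ∈-filter⁻)
import Data.List.Membership.DecPropositional as DecMembership
open import Data.List.Properties using (∷-injective; ∷-injectiveʳ)
open import Data.List.Relation.Binary.Disjoint.Propositional using (Disjoint)
open import Data.List.Relation.Binary.Permutation.Propositional
  using (_↭_; prep; ↭-refl; ↭-sym; ↭-trans; ↭-swap)
open import Data.List.Relation.Binary.Permutation.Propositional.Properties
  using (∈-resp-↭; drop-mid; ↭-empty-inv)
open import Data.List.Relation.Unary.All as All using (All; []; _∷_)
import Data.List.Relation.Unary.All.Properties as Allₚ
open import Data.List.Relation.Unary.AllPairs as AllPairs using (AllPairs; []; _∷_)
import Data.List.Relation.Unary.AllPairs.Properties as AllPairsₚ
open import Data.List.Relation.Unary.Any using (here; there)
open import Data.List.Relation.Unary.Linked using (Linked; []; [-]; _∷_)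
open import Data.List.Relation.Unary.Unique.Propositional using (Unique)
import Data.List.Relation.Unary.Unique.Propositional.Properties as Uniqueₚ
open import Data.Nat.Base
  using (ℕ; zero; suc; _+_; _*_; _∸_; _^_; _≤_; _<_; _>_; z≤n; s≤s; z<s; NonZero)
open import Data.Nat.Combinatorics using (_C_)
open import Data.Nat.ListAction using (sum; product)
open import Data.Nat.ListAction.Properties using (product≢0)
import Data.Nat.Properties as ℕₚ
open import Data.Product.Base using (_×_; _,_; proj₁; proj₂)
open import Data.Product.Properties using (≡-dec)
open import Data.Rational.Base as ℚ using (ℚ; 0ℚ; 1ℚ; _/_)
open import Algebra.Definitions.RawSemiring ℚ.+-*-rawSemiring
  using () renaming (_^_ to _^ℚ_)
open import Data.Sum.Base using (inj₁; inj₂)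
open import Function.Base using (_∘_)
open import Function.Bundles using (_⇔_; mk⇔; Equivalence)
open import Relation.Binary.PropositionalEquality
  using (_≡_; refl; cong; subst)
open import Relation.Nullary.Decidable using (Dec; yes; no; _×-dec_; _→-dec_; ¬?)
open import Relation.Unary using (Decidable)

fromℕ : ℕ → ℚ
fromℕ n = + n / 1

sumℚ : List ℚ → ℚ
sumℚ = foldr ℚ._+_ 0ℚ

productℚ : List ℚ → ℚ
productℚ = foldr ℚ._*_ 1ℚ

-- Polynomials are given by their coefficients, constant term first.
evalPoly : List ℚ → ℚ → ℚ
evalPoly cs x = foldr (λ c r → c ℚ.+ x ℚ.* r) 0ℚ cs

range : ℕ → List ℕ
range n = map suc (upTo n)

-- A formal power series of bounded degree, invariant under permutations of
-- the variables. A list α₁ ∷ … ∷ αₘ ∷ [] stands for the monomial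
-- x₁^α₁ ⋯ xₘ^αₘ; trailing zeros do not change the monomial.
record SymmetricFunction : Set where
  field
    coeff     : List ℕ → ℚ
    padded    : ∀ α → coeff (α ++ [ 0 ]) ≡ coeff α
    symmetric : ∀ {α β} → α ↭ β → coeff α ≡ coeff β
    degree    : ℕ
    bounded   : ∀ α → degree < sum α → coeff α ≡ 0ℚ

-- The exponent vectors in m variables of total degree at most d.
exponents : ℕ → ℕ → List (List ℕ)
exponents zero    d = [ [] ]
exponents (suc m) d = concatMap (λ k → map (k ∷_) (exponents m (d ∸ k))) (upTo (suc d))

monomial : List ℕ → List ℚ → ℚ
monomial α xs = productℚ (zipWith _^ℚ_ xs α)

-- Q(x₁, …, xₘ, 0, 0, …). Monomials involving later variables vanish, and
-- those of degree above the bound have coefficient 0.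
evaluate : SymmetricFunction → List ℚ → ℚ
evaluate Q xs =
  sumℚ (map (λ α → coeff α ℚ.* monomial α xs) (exponents (length xs) degree))
  where open SymmetricFunction Q

IsStrict : List ℕ → Set
IsStrict lam = Linked _>_ lam × All (0 <_) lam

-- part lam i is λᵢ, with rows numbered from 1 (the value at 0 is irrelevant).
part : List ℕ → ℕ → ℕ
part []        _             = 0
part (x ∷ lam) 0             = 0
part (x ∷ lam) 1             = x
part (x ∷ lam) (suc (suc i)) = part lam (suc i)

infix 4 _⊇_ _⊇?_

_⊇_ : List ℕ → List ℕ → Set
lam ⊇ mu = ∀ i → part mu i ≤ part lam i

Box : Set
Box = ℕ × ℕ

row col : Box → ℕ
row = proj₁
col = proj₂

open DecMembership (≡-dec ℕₚ._≟_ ℕₚ._≟_) using (_∈?_)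

diagram : List ℕ → List Box
diagram lam =
  concatMap (λ i → map (λ c → (i , i + c)) (range (part lam i))) (range (length lam))

skewDiagram : List ℕ → List ℕ → List Box
skewDiagram lam mu = filter (λ b → ¬? (b ∈? diagram mu)) (diagram lam)

-- Boxes of a shifted diagram satisfy row < col, so ∸ does not truncate.
content : Box → ℕ
content b = col b ∸ row b

hook : List ℕ → Box → ℕ
hook lam b = suc (arm + leg + part lam (col b))
  where
  arm = length (filter (λ b′ → (row b′ ℕₚ.≟ row b) ×-dec (col b ℕₚ.<? col b′)) (diagram lam))
  leg = length (filter (λ b′ → (col b′ ℕₚ.≟ col b) ×-dec (row b ℕₚ.<? row b′)) (diagram lam))

H : List ℕ → ℕ
H lam = product (map (hook lam) (diagram lam))

H-nonZero : ∀ lam → NonZero (H lam)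
H-nonZero lam = product≢0 (Allₚ.map⁺ (All.universal (λ _ → _) (diagram lam)))

insertions : ∀ {A : Set} → A → List A → List (List A)
insertions x []       = [ [ x ] ]
insertions x (y ∷ ys) = (x ∷ y ∷ ys) ∷ map (y ∷_) (insertions x ys)

-- For a list without repetitions, each rearrangement exactly once: see
-- ∈-permutations⇔ and permutations-unique.
permutations : ∀ {A : Set} → List A → List (List A)
permutations []       = [ [] ]
permutations (x ∷ xs) = concatMap (insertions x) (permutations xs)

-- A filling is recorded by its graph.
Filling : Set
Filling = List (Box × ℕ)

bijectiveFillings : List Box → List Filling
bijectiveFillings bs = map (zip bs) (permutations (range (length bs)))

Increasing : (Box × ℕ) → (Box × ℕ) → Set
Increasing (b , k) (b′ , k′) =
  (row b ≡ row b′ × col b < col b′ → k < k′) ×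
  (col b ≡ col b′ × row b < row b′ → k < k′)

increasing? : ∀ p q → Dec (Increasing p q)
increasing? (b , k) (b′ , k′) =
  (((row b ℕₚ.≟ row b′) ×-dec (col b ℕₚ.<? col b′)) →-dec (k ℕₚ.<? k′)) ×-dec
  (((col b ℕₚ.≟ col b′) ×-dec (row b ℕₚ.<? row b′)) →-dec (k ℕₚ.<? k′))

IsStandard : Filling → Set
IsStandard T = All (λ p → All (Increasing p) T) T

isStandard? : Decidable IsStandard
isStandard? T = All.all? (λ p → All.all? (increasing? p) T) T

f : List ℕ → List ℕ → ℕ
f lam mu = length (filter isStandard? (bijectiveFillings (skewDiagram lam mu)))

_⊇?_ : ∀ lam mu → Dec (lam ⊇ mu)
lam      ⊇? []       = yes λ _ → z≤n
[]       ⊇? (y ∷ mu) with y ℕₚ.≤? 0 | [] ⊇? mu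
... | yes p | yes q = yes λ { 0 → z≤n ; 1 → p ; (suc (suc i)) → q (suc i) }
... | no ¬p | _     = no λ r → ¬p (r 1)
... | _     | no ¬q = no λ r → ¬q λ { 0 → ℕₚ.≤-reflexive (part-0 mu) ; (suc i) → r (suc (suc i)) }
  where
  part-0 : ∀ lam → part lam 0 ≡ 0
  part-0 []      = refl
  part-0 (_ ∷ _) = refl
(x ∷ lam) ⊇? (y ∷ mu) with y ℕₚ.≤? x | lam ⊇? mu
... | yes p | yes q = yes λ { 0 → z≤n ; 1 → p ; (suc (suc i)) → q (suc i) }
... | no ¬p | _     = no λ r → ¬p (r 1)
... | _     | no ¬q = no λ r → ¬q λ { 0 → part-0 mu ; (suc i) → r (suc (suc i)) }
  where
  part-0 : ∀ mu → part mu 0 ≤ part lam 0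
  part-0 []      = z≤n
  part-0 (_ ∷ _) = z≤n

strictUpTo : ℕ → List (List ℕ)
strictUpTo zero    = [ [] ]
strictUpTo (suc m) = map (suc m ∷_) (strictUpTo m) ++ strictUpTo m

-- Each strict λ ⊇ μ with |λ| - |μ| = n, exactly once: see ∈-extensions⇔ and
-- extensions-unique.
extensions : List ℕ → ℕ → List (List ℕ)
extensions mu n =
  filter (λ lam → (sum lam ℕₚ.≟ sum mu + n) ×-dec (lam ⊇? mu)) (strictUpTo (sum mu + n))

-- The exponent is |λ| - |μ| - ℓ(λ) + ℓ(μ), which is nonnegative for strict
-- λ ⊇ μ, because |λ| - ℓ(λ) = Σᵢ (λᵢ - 1) over the nonzero parts.
weight : List ℕ → List ℕ → ℚ
weight lam mu =
  (+ (2 ^ ((sum lam + length mu) ∸ (sum mu + length lam)) * f lam mu) / H lam)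
  ⦃ H-nonZero lam ⦄

P : SymmetricFunction → List ℕ → ℕ → ℚ
P Q mu n =
  sumℚ (map (λ lam → weight lam mu ℚ.*
                     evaluate Q (map (λ b → fromℕ (content b C 2)) (diagram lam)))
            (extensions mu n))

∈-insertions⁻ : ∀ {A : Set} {x : A} {zs} ys → zs ∈ insertions x ys → zs ↭ x ∷ ys
∈-insertions⁻ []       (here refl) = ↭-refl
∈-insertions⁻ (y ∷ ys) (here refl) = ↭-refl
∈-insertions⁻ (y ∷ ys) (there p) with ∈-map⁻ (y ∷_) p
... | zs , q , refl = ↭-trans (prep y (∈-insertions⁻ ys q)) (↭-swap y _ ↭-refl)

∈-insertions⁺ : ∀ {A : Set} {x : A} as bs → as ++ x ∷ bs ∈ insertions x (as ++ bs)
∈-insertions⁺ []       []       = here refl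
∈-insertions⁺ []       (b ∷ bs) = here refl
∈-insertions⁺ (a ∷ as) bs       = there (∈-map⁺ (a ∷_) (∈-insertions⁺ as bs))

∈-permutations⇔ : ∀ {A : Set} {ys : List A} xs → ys ∈ permutations xs ⇔ (ys ↭ xs)
∈-permutations⇔ xs = mk⇔ (to xs) (from xs)
  where
  to : ∀ {ys} xs → ys ∈ permutations xs → ys ↭ xs
  to []       (here refl) = ↭-refl
  to (x ∷ xs) p with find (∈-concatMap⁻ (insertions x) {xs = permutations xs} p)
  ... | zs , q , r = ↭-trans (∈-insertions⁻ zs r) (prep x (to xs q))

  from : ∀ {ys} xs → ys ↭ xs → ys ∈ permutations xs
  from []       p with refl ← ↭-empty-inv p = here refl
  from (x ∷ xs) p with ∈-∃++ (∈-resp-↭ (↭-sym p) (here refl))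
  ... | as , bs , refl =
    ∈-concatMap⁺ (insertions x) (lose (from xs (drop-mid as [] p)) (∈-insertions⁺ as bs))

permutations-unique : ∀ {A : Set} {xs : List A} → Unique xs → Unique (permutations xs)
permutations-unique []                = [] ∷ []
permutations-unique {A} {x ∷ xs} (x∉ ∷ u) =
  Uniqueₚ.concat⁺
    (Allₚ.map⁺ (All.tabulate λ {ys} p → insertions-unique ys (fresh p)))
    (AllPairsₚ.map⁺ (disjoint (permutations-unique u) λ p → p))
  where
  fresh : ∀ {ys} → ys ∈ permutations xs → x ∉ ys
  fresh p q = All.lookup x∉ (∈-resp-↭ (Equivalence.to (∈-permutations⇔ xs) p) q) refl

  insertions-unique : ∀ ys → x ∉ ys → Unique (insertions x ys)
  insertions-unique []       _ = [] ∷ []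
  insertions-unique (y ∷ ys) x∉ =
    Allₚ.map⁺ (All.universal (λ _ eq → x∉ (here (proj₁ (∷-injective eq)))) _) ∷
    Uniqueₚ.map⁺ ∷-injectiveʳ (insertions-unique ys (x∉ ∘ there))

  cancel : ∀ {zs} as bs → x ∉ as → x ∉ bs →
           zs ∈ insertions x as → zs ∈ insertions x bs → as ≡ bs
  cancel []       []       _ _ _ _ = refl
  cancel []       (b ∷ bs) _ x∉ (here refl) (there q) with ∈-map⁻ (b ∷_) q
  ... | _ , _ , refl = ⊥-elim (x∉ (here refl))
  cancel (a ∷ as) []       x∉ _ (there p) (here refl) with ∈-map⁻ (a ∷_) p
  ... | _ , _ , refl = ⊥-elim (x∉ (here refl))
  cancel (a ∷ as) (b ∷ bs) _ _ (here refl) (here refl) = refl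
  cancel (a ∷ as) (b ∷ bs) _ x∉ (here refl) (there q) with ∈-map⁻ (b ∷_) q
  ... | _ , _ , refl = ⊥-elim (x∉ (here refl))
  cancel (a ∷ as) (b ∷ bs) x∉ _ (there p) (here refl) with ∈-map⁻ (a ∷_) p
  ... | _ , _ , refl = ⊥-elim (x∉ (here refl))
  cancel (a ∷ as) (b ∷ bs) x∉a x∉b (there p) (there q)
    with ∈-map⁻ (a ∷_) p | ∈-map⁻ (b ∷_) q
  ... | _ , p′ , refl | _ , q′ , refl =
    cong (a ∷_) (cancel as bs (x∉a ∘ there) (x∉b ∘ there) p′ q′)

  disjoint : ∀ {yss} → Unique yss → (∀ {ys} → ys ∈ yss → ys ∈ permutations xs) →
             AllPairs (λ as bs → Disjoint (insertions x as) (insertions x bs)) yss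
  disjoint []       _   = []
  disjoint (n ∷ us) sub =
    All.tabulate (λ {bs} q (r , s) →
      All.lookup n q (cancel _ bs (fresh (sub (here refl))) (fresh (sub (there q))) r s)) ∷
    disjoint us (sub ∘ there)

∈-strictUpTo⁻ : ∀ m {lam} → lam ∈ strictUpTo m → IsStrict lam × All (_≤ m) lam
∈-strictUpTo⁻ zero (here refl) = ([] , []) , []
∈-strictUpTo⁻ (suc m) p with ∈-++⁻ (map (suc m ∷_) (strictUpTo m)) p
... | inj₂ q = let s , b = ∈-strictUpTo⁻ m q in s , All.map ℕₚ.m≤n⇒m≤1+n b
... | inj₁ q with ∈-map⁻ (suc m ∷_) q
...   | _ , r , refl =
  let (l , z) , b = ∈-strictUpTo⁻ m r in
  (link b l , z<s ∷ z) , ℕₚ.≤-refl ∷ All.map ℕₚ.m≤n⇒m≤1+n b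
  where
  link : ∀ {lam} → All (_≤ m) lam → Linked _>_ lam → Linked _>_ (suc m ∷ lam)
  link []      _ = [-]
  link (b ∷ _) l = s≤s b ∷ l

∈-strictUpTo⁺ : ∀ m {lam} → IsStrict lam → All (_≤ m) lam → lam ∈ strictUpTo m
∈-strictUpTo⁺ zero {[]} _ _ = here refl
∈-strictUpTo⁺ zero {_ ∷ _} (_ , z ∷ _) (b ∷ _) = ⊥-elim (ℕₚ.<⇒≱ z b)
∈-strictUpTo⁺ (suc m) {[]} s _ = ∈-++⁺ʳ _ (∈-strictUpTo⁺ m s [])
∈-strictUpTo⁺ (suc m) {x ∷ lam} (l , z) (b ∷ _) with x ℕₚ.≟ suc m
... | yes refl = ∈-++⁺ˡ (∈-map⁺ (suc m ∷_) (∈-strictUpTo⁺ m (tail l , All.tail z) (below l)))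
  where
  tail : ∀ {y lam} → Linked _>_ (y ∷ lam) → Linked _>_ lam
  tail [-]     = []
  tail (_ ∷ l) = l

  below : ∀ {y lam} → Linked _>_ (suc y ∷ lam) → All (_≤ y) lam
  below [-]            = []
  below {lam = suc w ∷ _} (s≤s h ∷ l) = h ∷ All.map (λ q → ℕₚ.≤-trans q (ℕₚ.≤-trans (ℕₚ.n≤1+n w) h)) (below l)
  below {lam = zero ∷ []} (_ ∷ [-]) = z≤n ∷ []
  below {lam = zero ∷ _ ∷ _} (_ ∷ () ∷ _)
... | no ≢m = ∈-++⁺ʳ _ (∈-strictUpTo⁺ m (l , z) (x≤m ∷ below x≤m l))
  where
  x≤m = ℕₚ.≤-pred (ℕₚ.≤∧≢⇒< b ≢m)

  below : ∀ {y lam} → y ≤ m → Linked _>_ (y ∷ lam) → All (_≤ m) lam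
  below _   [-]     = []
  below y≤m (h ∷ l) = let w≤m = ℕₚ.≤-trans (ℕₚ.<⇒≤ h) y≤m in w≤m ∷ below w≤m l

∈-extensions⇔ : ∀ mu n {lam} →
  lam ∈ extensions mu n ⇔ (IsStrict lam × sum lam ≡ sum mu + n × lam ⊇ mu)
∈-extensions⇔ mu n = mk⇔ to from
  where
  chosen? = λ lam → (sum lam ℕₚ.≟ sum mu + n) ×-dec (lam ⊇? mu)

  parts≤sum : ∀ lam → All (_≤ sum lam) lam
  parts≤sum []        = []
  parts≤sum (x ∷ lam) =
    ℕₚ.m≤m+n x _ ∷ All.map (λ p → ℕₚ.≤-trans p (ℕₚ.m≤n+m _ x)) (parts≤sum lam)

  to : ∀ {lam} → lam ∈ extensions mu n → IsStrict lam × sum lam ≡ sum mu + n × lam ⊇ mu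
  to p with ∈-filter⁻ chosen? {xs = strictUpTo (sum mu + n)} p
  ... | q , r = proj₁ (∈-strictUpTo⁻ (sum mu + n) q) , r

  from : ∀ {lam} → IsStrict lam × sum lam ≡ sum mu + n × lam ⊇ mu → lam ∈ extensions mu n
  from {lam} (s , r) =
    ∈-filter⁺ chosen?
      (∈-strictUpTo⁺ _ s (subst (λ N → All (_≤ N) lam) (proj₁ r) (parts≤sum lam))) r

extensions-unique : ∀ mu n → Unique (extensions mu n)
extensions-unique mu n = Uniqueₚ.filter⁺ _ (unique (sum mu + n))
  where
  unique : ∀ m → Unique (strictUpTo m)
  unique zero    = [] ∷ []
  unique (suc m) = Uniqueₚ.++⁺ (Uniqueₚ.map⁺ ∷-injectiveʳ (unique m)) (unique m) disjoint
    where
    disjoint : Disjoint (map (suc m ∷_) (strictUpTo m)) (strictUpTo m)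
    disjoint (p , q) with ∈-map⁻ (suc m ∷_) p
    ... | _ , _ , refl = ℕₚ.1+n≰n (All.head (proj₂ (∈-strictUpTo⁻ m q)))

module Submission where

-- For a strict partition μ put zᵢ = C(μᵢ+1, 2) and yᵢ = C(μᵢ, 2). A box added to row i
-- has C(c, 2) = zᵢ, and by the product form of the hook lengths the weight ratio
-- 2^[i ≤ ℓ(μ)] H(μ) / H(μ + box) is the residue at zᵢ of ∏ (z - yⱼ) / (z ∏ (z - zⱼ)), the
-- new row being the pole at 0. Rows to which no box can be added have residue zero.
-- Hence the averaging operator U g (μ) = ∑ᵢ residueᵢ g(μ + boxᵢ) fixes constants, and
-- the residue sums of zᵢ^r are the coefficients of ∏ (1 - yⱼ t) / (1 - zⱼ t). These
-- moments and the values of symmetric functions change by polynomials in zᵢ when a box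
-- is added, of an order that makes U - 1 strictly lower a filtration. Since removing
-- the smallest entry of a tableau gives P(n) = Uⁿ Q (μ) / H(μ), some difference of P
-- vanishes identically.
open import Defs

-- The functions studied must form a class closed under U, and averaging a power of the added value
-- zᵢ produces a moment. So moments join the symmetric functions of the contents in one algebra, and
-- moment r is given order r: trading z^r for it then costs nothing, and a drop in order achieved
-- before averaging survives it. The link between hooks and residues is 2 (C(m+1, 2) - C(n, 2)) = (m
-- + n)(m + 1 - n): sums and differences of parts in the hook product pair up into differences of
-- binomials. Strictness of μ makes the zᵢ of distinct rows distinct, so the poles are simple; 0 is
-- the value of the empty row. Residues, moments and hook products are all handled by recursion on
-- the first row. Each identity then reduces to putting one row on top of the others, followed by a
-- polynomial identity with denominators cleared. Powers of 2 are split as 2^(|λ| - ℓ(λ)) over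
-- 2^(|μ| - ℓ(μ)), which writes the weight as a factor of λ times the number of tableaux, up to a
-- constant depending on μ.

module Rationals where

  import Data.Integer.Base as ℤ
  import Data.Integer.Properties as ℤₚ
  open import Data.List.Base using (List; []; _∷_; _++_; map; concatMap; filter; upTo)
  open import Data.List.Membership.Propositional using (_∈_)
  open import Data.List.Properties using (map-upTo)
  open import Data.List.Relation.Binary.Permutation.Propositional as ↭ using (_↭_)
  open import Data.List.Relation.Unary.Any using (here; there)
  open import Data.Maybe.Base using (Maybe; just; nothing)
  open import Data.Nat.Base as ℕ using (ℕ; suc)
  import Data.Nat.Properties as ℕₚ
  open import Data.Rational.Base hiding (NonZero)
  open import Data.Rational.Properties
  open import Data.Rational.Unnormalised.Base as ℚᵘ using (ℚᵘ; mkℚᵘ; *≡*)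
  import Data.Rational.Unnormalised.Properties as ℚᵘₚ
  open import Function.Base using (_∘_)
  open import Level using (0ℓ)
  open import Relation.Binary.PropositionalEquality
  open import Relation.Nullary.Decidable using (Dec; yes; no)
  open import Relation.Nullary.Negation using (¬_; contradiction)
  open import Relation.Unary using (Decidable)
  open import Tactic.RingSolver using (solve-∀)
  open import Tactic.RingSolver.Core.AlmostCommutativeRing
    using (AlmostCommutativeRing; fromCommutativeRing)

  -- Rational arithmetic: the embedding of ℕ and a total reciprocal.

  isZero : ∀ x → Maybe (0ℚ ≡ x)
  isZero x with 0ℚ ≟ x
  ... | yes p = just p
  ... | no _  = nothing

  ring : AlmostCommutativeRing 0ℓ 0ℓ
  ring = fromCommutativeRing +-*-commutativeRing isZero

  fromℚᵘ-homo-+ : ∀ p q → fromℚᵘ (p ℚᵘ.+ q) ≡ fromℚᵘ p + fromℚᵘ q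
  fromℚᵘ-homo-+ p q = toℚᵘ-injective (ℚᵘₚ.≃-trans (toℚᵘ-fromℚᵘ (p ℚᵘ.+ q)) (ℚᵘₚ.≃-sym
    (ℚᵘₚ.≃-trans (toℚᵘ-homo-+ (fromℚᵘ p) (fromℚᵘ q))
                 (ℚᵘₚ.+-cong (toℚᵘ-fromℚᵘ p) (toℚᵘ-fromℚᵘ q)))))

  fromℚᵘ-homo-* : ∀ p q → fromℚᵘ (p ℚᵘ.* q) ≡ fromℚᵘ p * fromℚᵘ q
  fromℚᵘ-homo-* p q = toℚᵘ-injective (ℚᵘₚ.≃-trans (toℚᵘ-fromℚᵘ (p ℚᵘ.* q)) (ℚᵘₚ.≃-sym
    (ℚᵘₚ.≃-trans (toℚᵘ-homo-* (fromℚᵘ p) (fromℚᵘ q))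
                 (ℚᵘₚ.*-cong (toℚᵘ-fromℚᵘ p) (toℚᵘ-fromℚᵘ q)))))

  fromℕ-+ : ∀ m n → fromℕ (m ℕ.+ n) ≡ fromℕ m + fromℕ n
  fromℕ-+ m n = trans (fromℚᵘ-cong {mkℚᵘ (ℤ.+ (m ℕ.+ n)) 0} {mkℚᵘ (ℤ.+ m) 0 ℚᵘ.+ mkℚᵘ (ℤ.+ n) 0}
      (*≡* (cong (ℤ._* ℤ.+ 1) (cong₂ ℤ._+_ (sym (ℤₚ.*-identityʳ (ℤ.+ m))) (sym (ℤₚ.*-identityʳ (ℤ.+ n)))))))
    (fromℚᵘ-homo-+ (mkℚᵘ (ℤ.+ m) 0) (mkℚᵘ (ℤ.+ n) 0))

  fromℕ-* : ∀ m n → fromℕ (m ℕ.* n) ≡ fromℕ m * fromℕ n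
  fromℕ-* m n = trans (fromℚᵘ-cong {mkℚᵘ (ℤ.+ (m ℕ.* n)) 0} {mkℚᵘ (ℤ.+ m) 0 ℚᵘ.* mkℚᵘ (ℤ.+ n) 0}
      (*≡* (cong (ℤ._* ℤ.+ 1) (ℤₚ.pos-* m n))))
    (fromℚᵘ-homo-* (mkℚᵘ (ℤ.+ m) 0) (mkℚᵘ (ℤ.+ n) 0))

  fromℕ-suc : ∀ n → fromℕ (suc n) ≡ fromℕ n + 1ℚ
  fromℕ-suc n = trans (cong fromℕ (ℕₚ.+-comm 1 n)) (fromℕ-+ n 1)

  fromℕ-injective : ∀ {m n} → fromℕ m ≡ fromℕ n → m ≡ n
  fromℕ-injective {m} {n} eq with fromℚᵘ-injective {mkℚᵘ (ℤ.+ m) 0} {mkℚᵘ (ℤ.+ n) 0} eq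
  ... | *≡* p = ℤₚ.+-injective (ℤₚ.*-cancelʳ-≡ (ℤ.+ m) (ℤ.+ n) (ℤ.+ 1) p)

  -- Total reciprocal: inv 0ℚ = 0ℚ.
  inv : ℚ → ℚ
  inv q with q ≟ 0ℚ
  ... | yes _   = 0ℚ
  ... | no  q≢0 = 1/_ q ⦃ ≢-nonZero {q} q≢0 ⦄

  *-inv : ∀ {q} → q ≢ 0ℚ → q * inv q ≡ 1ℚ
  *-inv {q} q≢0 with q ≟ 0ℚ
  ... | yes q≡0 = contradiction q≡0 q≢0
  ... | no  p   = *-inverseʳ q ⦃ ≢-nonZero {q} p ⦄

  *-cancelˡ : ∀ {a b c} → a ≢ 0ℚ → a * b ≡ a * c → b ≡ c
  *-cancelˡ {a} {b} {c} a≢0 eq = trans (expand b) (trans (cong (inv a *_) eq) (sym (expand c)))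
    where
    assoc : ∀ a i x → i * (a * x) ≡ (a * i) * x
    assoc = solve-∀ ring
    expand : ∀ x → x ≡ inv a * (a * x)
    expand x = sym (trans (assoc a (inv a) x) (trans (cong (_* x) (*-inv a≢0)) (*-identityˡ x)))

  *-≢0 : ∀ {a b} → a ≢ 0ℚ → b ≢ 0ℚ → a * b ≢ 0ℚ
  *-≢0 {a} a≢0 b≢0 ab≡0 = b≢0 (*-cancelˡ a≢0 (trans ab≡0 (sym (*-zeroʳ a))))

  inv-unique : ∀ {a b} → a * b ≡ 1ℚ → inv a ≡ b
  inv-unique {a} {b} ab≡1 = *-cancelˡ a≢0 (trans (*-inv a≢0) (sym ab≡1))
    where
    a≢0 : a ≢ 0ℚ
    a≢0 refl with trans (sym ab≡1) (*-zeroˡ b)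
    ... | ()

  fromℕ-≢0 : ∀ {n} → n ≢ 0 → fromℕ n ≢ 0ℚ
  fromℕ-≢0 n≢0 eq = n≢0 (fromℕ-injective eq)

  /-fromℕ : ∀ n d .⦃ _ : ℕ.NonZero d ⦄ → ℤ.+ n / d ≡ fromℕ n * inv (fromℕ d)
  /-fromℕ n d@(suc d-1) = *-cancelˡ (fromℕ-≢0 {d} λ ()) (begin
    fromℕ d * (ℤ.+ n / d)
      ≡⟨ fromℚᵘ-homo-* (mkℚᵘ (ℤ.+ d) 0) (mkℚᵘ (ℤ.+ n) d-1) ⟨
    fromℚᵘ (mkℚᵘ (ℤ.+ d) 0 ℚᵘ.* mkℚᵘ (ℤ.+ n) d-1)
      ≡⟨ fromℚᵘ-cong {mkℚᵘ (ℤ.+ d) 0 ℚᵘ.* mkℚᵘ (ℤ.+ n) d-1} {mkℚᵘ (ℤ.+ n) 0} (*≡* rearrange) ⟩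
    fromℕ n
      ≡⟨ *-identityʳ (fromℕ n) ⟨
    fromℕ n * 1ℚ
      ≡⟨ cong (fromℕ n *_) (*-inv (fromℕ-≢0 {d} λ ())) ⟨
    fromℕ n * (fromℕ d * inv (fromℕ d))
      ≡⟨ swap-* (fromℕ n) (fromℕ d) (inv (fromℕ d)) ⟩
    fromℕ d * (fromℕ n * inv (fromℕ d)) ∎)
    where
    open ≡-Reasoning
    swap-* : ∀ a b c → a * (b * c) ≡ b * (a * c)
    swap-* = solve-∀ ring
    rearrange : ℤ.+ d ℤ.* ℤ.+ n ℤ.* ℤ.+ 1 ≡ ℤ.+ n ℤ.* ℤ.+ suc (d-1 ℕ.+ 0)
    rearrange = trans (ℤₚ.*-identityʳ (ℤ.+ d ℤ.* ℤ.+ n)) (trans (ℤₚ.*-comm (ℤ.+ d) (ℤ.+ n))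
      (cong (λ e → ℤ.+ n ℤ.* ℤ.+ suc e) (sym (ℕₚ.+-identityʳ d-1))))

  x-y≢0 : ∀ {x y} → x ≢ y → x - y ≢ 0ℚ
  x-y≢0 {x} {y} x≢y eq = x≢y (trans (split x y) (trans (cong (_+ y) eq) (+-identityˡ y)))
    where
    split : ∀ x y → x ≡ (x - y) + y
    split = solve-∀ ring

  -- Finite sums of rationals.

  ∑ : ∀ {A : Set} → List A → (A → ℚ) → ℚ
  ∑ xs φ = sumℚ (map φ xs)

  module _ {A : Set} where

    ∑-cong-∈ : ∀ (xs : List A) {φ ψ : A → ℚ} → (∀ {x} → x ∈ xs → φ x ≡ ψ x) → ∑ xs φ ≡ ∑ xs ψ
    ∑-cong-∈ []       eq = refl
    ∑-cong-∈ (x ∷ xs) eq = cong₂ _+_ (eq (here refl)) (∑-cong-∈ xs (eq ∘ there))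

    ∑-cong : ∀ (xs : List A) {φ ψ : A → ℚ} → (∀ x → φ x ≡ ψ x) → ∑ xs φ ≡ ∑ xs ψ
    ∑-cong xs eq = ∑-cong-∈ xs λ {x} _ → eq x

    ∑-zero : ∀ (xs : List A) {φ : A → ℚ} → (∀ {x} → x ∈ xs → φ x ≡ 0ℚ) → ∑ xs φ ≡ 0ℚ
    ∑-zero []       eq = refl
    ∑-zero (x ∷ xs) eq = cong₂ _+_ (eq (here refl)) (∑-zero xs (eq ∘ there))

    ∑-+ : ∀ (xs : List A) (φ ψ : A → ℚ) → ∑ xs (λ x → φ x + ψ x) ≡ ∑ xs φ + ∑ xs ψ
    ∑-+ []       φ ψ = refl
    ∑-+ (x ∷ xs) φ ψ = trans (cong ((φ x + ψ x) +_) (∑-+ xs φ ψ)) (exchange (φ x) (ψ x) _ _)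
      where
      exchange : ∀ a b c d → (a + b) + (c + d) ≡ (a + c) + (b + d)
      exchange = solve-∀ ring

    ∑-*ˡ : ∀ (xs : List A) c (φ : A → ℚ) → ∑ xs (λ x → c * φ x) ≡ c * ∑ xs φ
    ∑-*ˡ []       c φ = sym (*-zeroʳ c)
    ∑-*ˡ (x ∷ xs) c φ = trans (cong (c * φ x +_) (∑-*ˡ xs c φ)) (sym (*-distribˡ-+ c _ _))

    ∑-linear : ∀ (xs : List A) c (φ : A → ℚ) d (ψ : A → ℚ) →
               ∑ xs (λ x → c * φ x + d * ψ x) ≡ c * ∑ xs φ + d * ∑ xs ψ
    ∑-linear xs c φ d ψ =
      trans (∑-+ xs (λ x → c * φ x) (λ x → d * ψ x)) (cong₂ _+_ (∑-*ˡ xs c φ) (∑-*ˡ xs d ψ))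

    ∑-++ : ∀ (xs ys : List A) (φ : A → ℚ) → ∑ (xs ++ ys) φ ≡ ∑ xs φ + ∑ ys φ
    ∑-++ []       ys φ = sym (+-identityˡ _)
    ∑-++ (x ∷ xs) ys φ = trans (cong (φ x +_) (∑-++ xs ys φ)) (sym (+-assoc (φ x) (∑ xs φ) (∑ ys φ)))

    ∑-↭ : ∀ {xs ys : List A} (φ : A → ℚ) → xs ↭ ys → ∑ xs φ ≡ ∑ ys φ
    ∑-↭ φ ↭.refl         = refl
    ∑-↭ φ (↭.prep x p)   = cong (φ x +_) (∑-↭ φ p)
    ∑-↭ φ (↭.swap x y p) = trans (exchange (φ x) (φ y) _) (cong (λ s → φ y + (φ x + s)) (∑-↭ φ p))
      where
      exchange : ∀ a b c → a + (b + c) ≡ b + (a + c)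
      exchange = solve-∀ ring
    ∑-↭ φ (↭.trans p q)  = trans (∑-↭ φ p) (∑-↭ φ q)

  ∑-map : ∀ {A B : Set} (g : A → B) (xs : List A) (φ : B → ℚ) → ∑ (map g xs) φ ≡ ∑ xs (φ ∘ g)
  ∑-map g []       φ = refl
  ∑-map g (x ∷ xs) φ = cong (φ (g x) +_) (∑-map g xs φ)

  ∑-swap : ∀ {A B : Set} (xs : List A) (ys : List B) (φ : A → B → ℚ) →
           ∑ xs (λ x → ∑ ys (φ x)) ≡ ∑ ys (λ y → ∑ xs (λ x → φ x y))
  ∑-swap []       ys φ = sym (∑-zero ys λ _ → refl)
  ∑-swap (x ∷ xs) ys φ =
    trans (cong (∑ ys (φ x) +_) (∑-swap xs ys φ)) (sym (∑-+ ys (φ x) _))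

  ∑-concatMap : ∀ {A B : Set} (g : A → List B) (xs : List A) (φ : B → ℚ) →
                ∑ (concatMap g xs) φ ≡ ∑ xs (λ x → ∑ (g x) φ)
  ∑-concatMap g []       φ = refl
  ∑-concatMap g (x ∷ xs) φ = trans (∑-++ (g x) _ φ) (cong (∑ (g x) φ +_) (∑-concatMap g xs φ))

  ∑-upTo-suc : ∀ n (φ : ℕ → ℚ) → ∑ (upTo (suc n)) φ ≡ φ 0 + ∑ (upTo n) (φ ∘ suc)
  ∑-upTo-suc n φ = cong (φ 0 +_)
    (trans (cong (λ is → ∑ is φ) (sym (map-upTo suc n))) (∑-map suc (upTo n) φ))

  -- The Iverson bracket. It moves a side condition from the index list into the summand, so that
  -- sums can be exchanged.
  ⟦_⟧ : ∀ {P : Set} → Dec P → ℚ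
  ⟦ yes _ ⟧ = 1ℚ
  ⟦ no _ ⟧  = 0ℚ

  ⟦yes⟧ : ∀ {P : Set} (d : Dec P) → P → ⟦ d ⟧ ≡ 1ℚ
  ⟦yes⟧ (yes _) _ = refl
  ⟦yes⟧ (no ¬p) p = contradiction p ¬p

  ⟦no⟧ : ∀ {P : Set} (d : Dec P) → ¬ P → ⟦ d ⟧ ≡ 0ℚ
  ⟦no⟧ (yes p) ¬p = contradiction p ¬p
  ⟦no⟧ (no _)  _  = refl

  ∑-filter : ∀ {A : Set} {P : A → Set} (P? : Decidable P) (xs : List A) (φ : A → ℚ) →
             ∑ (filter P? xs) φ ≡ ∑ xs (λ x → ⟦ P? x ⟧ * φ x)
  ∑-filter P? []       φ = refl
  ∑-filter P? (x ∷ xs) φ with P? x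
  ... | yes _ = cong₂ _+_ (sym (*-identityˡ (φ x))) (∑-filter P? xs φ)
  ... | no _  = trans (∑-filter P? xs φ) (trans (sym (+-identityˡ _)) (cong (_+ _) (sym (*-zeroˡ (φ x)))))

-- The rational function of a strict partition, its residues and their moments.

module Residues where

  open Rationals
  open import Data.List.Base using (List; []; _∷_; length; upTo)
  open import Data.List.Relation.Unary.All using ([]; _∷_)
  open import Data.List.Relation.Unary.Linked using ([]; [-]; _∷_)
  open import Data.Nat.Base as ℕ using (ℕ; zero; suc)
  open import Data.Nat.Combinatorics using (_C_; nC1≡n; nCk+nC[k+1]≡[n+1]C[k+1])
  import Data.Nat.Properties as ℕₚ
  open import Relation.Nullary.Decidable using (Dec; yes; no)
  open import Data.Product.Base using (_×_; _,_; proj₂)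
  open import Data.Rational.Base hiding (NonZero)
  open import Data.Rational.Properties
  open import Algebra.Definitions.RawSemiring +-*-rawSemiring using (_^_)
  open import Data.Unit.Base using (⊤; tt)
  open import Function.Base using (_∘_)
  open import Relation.Binary.PropositionalEquality
  open import Relation.Nullary.Negation using (¬_; contradiction)
  open import Tactic.RingSolver using (solve-∀)

  part-0 : ∀ mu → part mu 0 ≡ 0
  part-0 []      = refl
  part-0 (_ ∷ _) = refl

  ⊇-tail : ∀ {x lam y mu} → (x ∷ lam) ⊇ (y ∷ mu) → lam ⊇ mu
  ⊇-tail {lam = lam} {mu = mu} sub zero    = ℕₚ.≤-reflexive (trans (part-0 mu) (sym (part-0 lam)))
  ⊇-tail                       sub (suc j) = sub (suc (suc j))

  []⊇-tail : ∀ {y mu} → [] ⊇ (y ∷ mu) → [] ⊇ mu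
  []⊇-tail {mu = mu} sub zero    = ℕₚ.≤-reflexive (part-0 mu)
  []⊇-tail           sub (suc j) = sub (suc (suc j))

  -- As `part [] 1` is 0, the same inequality also makes the last part positive. This is `IsStrict`
  -- in a form that passes to the tail by projection.
  Decreasing : List ℕ → Set
  Decreasing []       = ⊤
  Decreasing (x ∷ mu) = part mu 1 ℕ.< x × Decreasing mu

  strict⇒decreasing : ∀ {mu} → IsStrict mu → Decreasing mu
  strict⇒decreasing {[]}         _                     = tt
  strict⇒decreasing {x ∷ []}     (_ , 0<x ∷ _)         = 0<x , tt
  strict⇒decreasing {x ∷ y ∷ mu} (x>y ∷ l , _ ∷ 0<)    = x>y , strict⇒decreasing (l , 0<)

  decreasing⇒strict : ∀ {mu} → Decreasing mu → IsStrict mu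
  decreasing⇒strict {[]}         _           = [] , []
  decreasing⇒strict {x ∷ []}     (0<x , _)   = [-] , 0<x ∷ []
  decreasing⇒strict {x ∷ y ∷ mu} (y<x , d)   with decreasing⇒strict {y ∷ mu} d
  ... | l , 0<y ∷ 0< = y<x ∷ l , ℕₚ.<-trans 0<y y<x ∷ 0<y ∷ 0<

  part<head : ∀ {x mu} → Decreasing (x ∷ mu) → ∀ i → part mu (suc i) ℕ.< x
  part<head                 (p , _)     zero    = p
  part<head {mu = []}       (p , _)     (suc i) = p
  part<head {mu = y ∷ mu}   (y<x , d)   (suc i) = ℕₚ.<-trans (part<head d i) y<x

  -- Row i + 1 grows by one box; i = length mu creates a new row.
  addBox : List ℕ → ℕ → List ℕ
  addBox []       _       = 1 ∷ []
  addBox (x ∷ mu) zero    = suc x ∷ mu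
  addBox (x ∷ mu) (suc i) = x ∷ addBox mu i

  c₂ : ℕ → ℚ
  c₂ m = fromℕ (m C 2)

  c₂-suc : ∀ m → c₂ (suc m) ≡ c₂ m + fromℕ m
  c₂-suc m = begin
    fromℕ (suc m C 2)           ≡⟨ cong fromℕ (nCk+nC[k+1]≡[n+1]C[k+1] m 1) ⟨
    fromℕ (m C 1 ℕ.+ m C 2)     ≡⟨ cong (λ k → fromℕ (k ℕ.+ m C 2)) (nC1≡n m) ⟩
    fromℕ (m ℕ.+ m C 2)         ≡⟨ fromℕ-+ m (m C 2) ⟩
    fromℕ m + c₂ m              ≡⟨ +-comm (fromℕ m) (c₂ m) ⟩
    c₂ m + fromℕ m              ∎
    where open ≡-Reasoning

  c₂-double : ∀ m → c₂ m + c₂ m ≡ fromℕ m * (fromℕ m - 1ℚ)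
  c₂-double zero    = refl
  c₂-double (suc m) = begin
    c₂ (suc m) + c₂ (suc m)                   ≡⟨ cong (λ c → c + c) (c₂-suc m) ⟩
    (c₂ m + x) + (c₂ m + x)                   ≡⟨ regroup (c₂ m) x ⟩
    (c₂ m + c₂ m) + (x + x)                   ≡⟨ cong (_+ (x + x)) (c₂-double m) ⟩
    x * (x - 1ℚ) + (x + x)                    ≡⟨ expand x ⟩
    (x + 1ℚ) * ((x + 1ℚ) - 1ℚ)                ≡⟨ cong (λ s → s * (s - 1ℚ)) (fromℕ-suc m) ⟨
    fromℕ (suc m) * (fromℕ (suc m) - 1ℚ)      ∎
    where
    open ≡-Reasoning
    x = fromℕ m
    regroup : ∀ c x → (c + x) + (c + x) ≡ (c + c) + (x + x)
    regroup = solve-∀ ring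
    expand : ∀ x → x * (x - 1ℚ) + (x + x) ≡ (x + 1ℚ) * ((x + 1ℚ) - 1ℚ)
    expand = solve-∀ ring

  2ℚ : ℚ
  2ℚ = 1ℚ + 1ℚ

  -- This factorisation and the next one translate between the linear factors of the hook lengths
  -- and the factors of the resolvent.
  2*[c₂-c₂] : ∀ m n → 2ℚ * (c₂ (suc m) - c₂ n) ≡ (fromℕ m + fromℕ n) * (fromℕ m + 1ℚ - fromℕ n)
  2*[c₂-c₂] m n = begin
    2ℚ * (c₂ (suc m) - c₂ n)                                   ≡⟨ split (c₂ (suc m)) (c₂ n) ⟩
    (c₂ (suc m) + c₂ (suc m)) - (c₂ n + c₂ n)                  ≡⟨ cong₂ _-_ (c₂-double (suc m)) (c₂-double n) ⟩
    fromℕ (suc m) * (fromℕ (suc m) - 1ℚ) - y * (y - 1ℚ)        ≡⟨ cong (λ s → s * (s - 1ℚ) - y * (y - 1ℚ)) (fromℕ-suc m) ⟩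
    (x + 1ℚ) * ((x + 1ℚ) - 1ℚ) - y * (y - 1ℚ)                  ≡⟨ factor x y ⟩
    (x + y) * (x + 1ℚ - y)                                     ∎
    where
    open ≡-Reasoning
    x = fromℕ m
    y = fromℕ n
    split : ∀ a b → 2ℚ * (a - b) ≡ (a + a) - (b + b)
    split = solve-∀ ring
    factor : ∀ x y → (x + 1ℚ) * ((x + 1ℚ) - 1ℚ) - y * (y - 1ℚ) ≡ (x + y) * (x + 1ℚ - y)
    factor = solve-∀ ring

  2*[c₂-c₂]′ : ∀ m n → 2ℚ * (c₂ (suc m) - c₂ (suc n)) ≡ (fromℕ m - fromℕ n) * (fromℕ m + 1ℚ + fromℕ n)
  2*[c₂-c₂]′ m n = trans (2*[c₂-c₂] m (suc n))
    (trans (cong (λ s → (fromℕ m + s) * (fromℕ m + 1ℚ - s)) (fromℕ-suc n)) (factor (fromℕ m) (fromℕ n)))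
    where
    factor : ∀ x y → (x + (y + 1ℚ)) * (x + 1ℚ - (y + 1ℚ)) ≡ (x - y) * (x + 1ℚ + y)
    factor = solve-∀ ring

  fromℕ-difference-≢0 : ∀ {m n} → m ≢ n → fromℕ m - fromℕ n ≢ 0ℚ
  fromℕ-difference-≢0 m≢n = x-y≢0 (m≢n ∘ fromℕ-injective)

  fromℕ-m+1+n-≢0 : ∀ m n → fromℕ m + 1ℚ + fromℕ n ≢ 0ℚ
  fromℕ-m+1+n-≢0 m n eq = fromℕ-≢0 {suc m ℕ.+ n} (λ ())
    (trans (trans (fromℕ-+ (suc m) n) (cong (_+ fromℕ n) (fromℕ-suc m))) eq)

  -- The successors matter, since `c₂ 0` and `c₂ 1` agree. With them the factor m + 1 + n cannot
  -- vanish, so only m - n can.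
  c₂-injective : ∀ {m n} → c₂ (suc m) ≡ c₂ (suc n) → ¬ m ≢ n
  c₂-injective {m} {n} eq m≢n =
    *-≢0 {fromℕ m - fromℕ n} {fromℕ m + 1ℚ + fromℕ n} (fromℕ-difference-≢0 m≢n) (fromℕ-m+1+n-≢0 m n)
      (trans (sym (2*[c₂-c₂]′ m n)) (trans (cong (λ c → 2ℚ * (c - c₂ (suc n))) eq) (cancel (c₂ (suc n)))))
    where
    cancel : ∀ c → 2ℚ * (c - c) ≡ 0ℚ
    cancel = solve-∀ ring

  -- The content value of the box that addBox mu i adds.
  newValue : List ℕ → ℕ → ℚ
  newValue mu i = c₂ (suc (part mu (suc i)))

  ratio : ℕ → ℚ → ℚ
  ratio x z = (z - c₂ x) * inv (z - c₂ (suc x))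

  -- With zⱼ = C(μⱼ + 1, 2) and yⱼ = C(μⱼ, 2), resolvent mu is the rational function
  -- ∏ (z - yⱼ) / (z ∏ (z - zⱼ)), and residue mu i is its residue at newValue mu i.
  resolvent : List ℕ → ℚ → ℚ
  resolvent []       z = inv z
  resolvent (x ∷ mu) z = ratio x z * resolvent mu z

  residue : List ℕ → ℕ → ℚ
  residue []       _       = 1ℚ
  residue (x ∷ mu) zero    = (c₂ (suc x) - c₂ x) * resolvent mu (c₂ (suc x))
  residue (x ∷ mu) (suc i) = ratio x (newValue mu i) * residue mu i

  -- The last index is the new row, whose value `c₂ 1` is 0.
  rows : List ℕ → List ℕ
  rows mu = upTo (suc (length mu))

  newValue-distinct : ∀ {x mu} → Decreasing (x ∷ mu) → ∀ i → newValue mu i ≢ c₂ (suc x)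
  newValue-distinct d i eq = c₂-injective eq (ℕₚ.<⇒≢ (part<head d i))

  inv-swap : ∀ {a b} → a ≢ b → inv (b - a) ≡ - inv (a - b)
  inv-swap {a} {b} a≢b = inv-unique {b - a} (trans (flip a b (inv (a - b))) (*-inv (x-y≢0 a≢b)))
    where
    flip : ∀ a b i → (b - a) * (- i) ≡ (a - b) * i
    flip = solve-∀ ring

  -- Induction on the rows. For a pole v of the tail, (v - y) / ((v - a)(z - v)) splits into a
  -- multiple of 1 / (a - v) and a multiple of 1 / (z - v), with coefficients free of v. The
  -- hypothesis at z gives the new resolvent, and at a it cancels the residue of the first row;
  -- hence the statement for every z off the poles.
  partialFractions : ∀ {mu} → Decreasing mu → ∀ z → (∀ i → z ≢ newValue mu i) →
    ∑ (rows mu) (λ i → residue mu i * inv (z - newValue mu i)) ≡ resolvent mu z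
  partialFractions {[]} _ z _ =
    trans (+-identityʳ (1ℚ * inv (z - 0ℚ))) (trans (*-identityˡ (inv (z - 0ℚ))) (cong inv (+-identityʳ z)))
  partialFractions {x ∷ mu} d z z≢ = begin
    ∑ (rows (x ∷ mu)) (λ i → residue (x ∷ mu) i * inv (z - newValue (x ∷ mu) i))
      ≡⟨ ∑-upTo-suc (suc (length mu)) (λ i → residue (x ∷ mu) i * inv (z - newValue (x ∷ mu) i)) ⟩
    (a - y) * resolvent mu a * s + ∑ (rows mu) (λ i → ratio x (v i) * residue mu i * inv (z - v i))
      ≡⟨ cong (λ t → (a - y) * resolvent mu a * s + t)
           (trans (∑-cong (rows mu) (λ i → term (inv-swap (a≢v i)) (a≢v i) (z≢ (suc i)) (residue mu i)))
           (trans (∑-linear (rows mu) (- ((a - y) * s)) (λ i → residue mu i * inv (a - v i))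
                                      ((z - y) * s) (λ i → residue mu i * inv (z - v i)))
                  (cong₂ (λ t u → - ((a - y) * s) * t + (z - y) * s * u)
                         (partialFractions (proj₂ d) a a≢v) (partialFractions (proj₂ d) z (z≢ ∘ suc))))) ⟩
    (a - y) * resolvent mu a * s + (- ((a - y) * s) * resolvent mu a + (z - y) * s * resolvent mu z)
      ≡⟨ cancel a y s z (resolvent mu a) (resolvent mu z) ⟩
    (z - y) * s * resolvent mu z ∎
    where
    open ≡-Reasoning
    a = c₂ (suc x)
    y = c₂ x
    s = inv (z - a)
    v = newValue mu
    a≢v : ∀ i → a ≢ v i
    a≢v i = newValue-distinct d i ∘ sym
    s-inverse : (z - a) * s ≡ 1ℚ
    s-inverse = *-inv (x-y≢0 (z≢ 0))
    cancel : ∀ a y s z ra rz →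
      (a - y) * ra * s + (- ((a - y) * s) * ra + (z - y) * s * rz) ≡ (z - y) * s * rz
    cancel = solve-∀ ring
    expand : ∀ a y s z v p q w →
      (v - y) * (- p) * w * q * ((z - a) * s) ≡
      - ((a - y) * s) * (w * p) * ((z - v) * q) + (z - y) * s * (w * q) * ((a - v) * p)
    expand = solve-∀ ring
    term : ∀ {v} → inv (v - a) ≡ - inv (a - v) → a ≢ v → z ≢ v → ∀ w →
      (v - y) * inv (v - a) * w * inv (z - v) ≡
      - ((a - y) * s) * (w * inv (a - v)) + (z - y) * s * (w * inv (z - v))
    term {v} flip a≢v z≢v w = begin
      (v - y) * inv (v - a) * w * q                 ≡⟨ cong (λ i → (v - y) * i * w * q) flip ⟩
      (v - y) * (- p) * w * q                       ≡⟨ *-identityʳ ((v - y) * (- p) * w * q) ⟨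
      (v - y) * (- p) * w * q * 1ℚ                  ≡⟨ cong ((v - y) * (- p) * w * q *_) s-inverse ⟨
      (v - y) * (- p) * w * q * ((z - a) * s)       ≡⟨ expand a y s z v p q w ⟩
      - ((a - y) * s) * (w * p) * ((z - v) * q) + (z - y) * s * (w * q) * ((a - v) * p)
        ≡⟨ cong₂ (λ t u → - ((a - y) * s) * (w * p) * t + (z - y) * s * (w * q) * u) (*-inv (x-y≢0 z≢v)) (*-inv (x-y≢0 a≢v)) ⟩
      - ((a - y) * s) * (w * p) * 1ℚ + (z - y) * s * (w * q) * 1ℚ
        ≡⟨ cong₂ _+_ (*-identityʳ (- ((a - y) * s) * (w * p))) (*-identityʳ ((z - y) * s * (w * q))) ⟩
      - ((a - y) * s) * (w * p) + (z - y) * s * (w * q) ∎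
      where
      p = inv (a - v)
      q = inv (z - v)

  -- The behaviour at infinity, where z times the resolvent tends to 1. Algebraically, (v - y) / (v
  -- - a) = 1 - (a - y) / (a - v), and the second part, summed by partial fractions at a, cancels
  -- the residue of the first row.
  residues-sum : ∀ {mu} → Decreasing mu → ∑ (rows mu) (residue mu) ≡ 1ℚ
  residues-sum {[]}     _ = refl
  residues-sum {x ∷ mu} d = begin
    ∑ (rows (x ∷ mu)) (residue (x ∷ mu))
      ≡⟨ ∑-upTo-suc (suc (length mu)) (residue (x ∷ mu)) ⟩
    (a - y) * resolvent mu a + ∑ (rows mu) (λ i → ratio x (v i) * residue mu i)
      ≡⟨ cong ((a - y) * resolvent mu a +_)
           (trans (∑-cong (rows mu) (λ i → term (inv-swap (a≢v i)) (a≢v i) (residue mu i)))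
           (trans (∑-linear (rows mu) 1ℚ (residue mu) (- (a - y)) (λ i → residue mu i * inv (a - v i)))
                  (cong₂ (λ t u → 1ℚ * t + - (a - y) * u)
                         (residues-sum (proj₂ d)) (partialFractions (proj₂ d) a a≢v)))) ⟩
    (a - y) * resolvent mu a + (1ℚ * 1ℚ + - (a - y) * resolvent mu a)
      ≡⟨ cancel a y (resolvent mu a) ⟩
    1ℚ ∎
    where
    open ≡-Reasoning
    a = c₂ (suc x)
    y = c₂ x
    v = newValue mu
    a≢v : ∀ i → a ≢ v i
    a≢v i = newValue-distinct d i ∘ sym
    cancel : ∀ a y r → (a - y) * r + (1ℚ * 1ℚ + - (a - y) * r) ≡ 1ℚ
    cancel = solve-∀ ring
    expand : ∀ a y v p w → (v - y) * (- p) * w ≡ 1ℚ * w * ((a - v) * p) + - (a - y) * (w * p)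
    expand = solve-∀ ring
    term : ∀ {v} → inv (v - a) ≡ - inv (a - v) → a ≢ v → ∀ w →
      (v - y) * inv (v - a) * w ≡ 1ℚ * w + - (a - y) * (w * inv (a - v))
    term {v} flip a≢v w =
      trans (cong (λ i → (v - y) * i * w) flip)
      (trans (expand a y v (inv (a - v)) w)
             (cong (_+ - (a - y) * (w * inv (a - v))) (trans (cong (1ℚ * w *_) (*-inv (x-y≢0 a≢v))) (*-identityʳ (1ℚ * w)))))

  -- moment mu r is the coefficient of t^r in ∏ (1 - yⱼ t) / (1 - zⱼ t).
  moment : List ℕ → ℕ → ℚ
  moment _        zero    = 1ℚ
  moment []       (suc r) = 0ℚ
  moment (x ∷ mu) (suc r) = c₂ (suc x) * moment (x ∷ mu) r + moment mu (suc r) - c₂ x * moment mu r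

  -- Writing one factor v as a + (v - a) cancels the denominator of `ratio` in the second part. This
  -- reproduces the recursion of `moment`, which says that the series of x ∷ mu times 1 - a t is the
  -- series of mu times 1 - y t.
  moments : ∀ {mu} → Decreasing mu → ∀ r →
    ∑ (rows mu) (λ i → residue mu i * newValue mu i ^ r) ≡ moment mu r
  moments {mu} d zero =
    trans (∑-cong (rows mu) (λ i → *-identityʳ (residue mu i))) (residues-sum d)
  moments {[]}     d (suc r) = trans (+-identityʳ (1ℚ * (0ℚ * 0ℚ ^ r))) (trans (*-identityˡ (0ℚ * 0ℚ ^ r)) (*-zeroˡ (0ℚ ^ r)))
  moments {x ∷ mu} d (suc r) = begin
    ∑ (rows (x ∷ mu)) (λ i → residue (x ∷ mu) i * newValue (x ∷ mu) i ^ suc r)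
      ≡⟨ ∑-upTo-suc (suc (length mu)) (λ i → residue (x ∷ mu) i * newValue (x ∷ mu) i ^ suc r) ⟩
    w₀ * (a * a ^ r) + ∑ (rows mu) (λ i → ratio x (v i) * residue mu i * (v i * v i ^ r))
      ≡⟨ cong (w₀ * (a * a ^ r) +_)
           (trans (∑-cong (rows mu) (λ i → term (newValue-distinct d i) (residue mu i) (v i ^ r)))
           (trans (∑-+ (rows mu) (λ i → a * β i) (λ i → 1ℚ * (residue mu i * v i ^ suc r) + - y * (residue mu i * v i ^ r)))
           (cong₂ (λ t u → t + u) (∑-*ˡ (rows mu) a β)
           (trans (∑-linear (rows mu) 1ℚ (λ i → residue mu i * v i ^ suc r) (- y) (λ i → residue mu i * v i ^ r))
                  (cong₂ (λ t u → 1ℚ * t + - y * u) (moments (proj₂ d) (suc r)) (moments (proj₂ d) r)))))) ⟩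
    w₀ * (a * a ^ r) + (a * rest + (1ℚ * moment mu (suc r) + - y * moment mu r))
      ≡⟨ regroup w₀ a (a ^ r) rest (moment mu (suc r)) y (moment mu r) ⟩
    a * (w₀ * a ^ r + rest) + moment mu (suc r) - y * moment mu r
      ≡⟨ cong (λ m → a * m + moment mu (suc r) - y * moment mu r)
           (trans (sym (∑-upTo-suc (suc (length mu)) (λ i → residue (x ∷ mu) i * newValue (x ∷ mu) i ^ r))) (moments {x ∷ mu} d r)) ⟩
    a * moment (x ∷ mu) r + moment mu (suc r) - y * moment mu r ∎
    where
    open ≡-Reasoning
    a = c₂ (suc x)
    y = c₂ x
    v = newValue mu
    w₀ = residue (x ∷ mu) 0
    β = λ i → ratio x (v i) * residue mu i * v i ^ r
    rest = ∑ (rows mu) β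
    regroup : ∀ w₀ a p s m y m′ → w₀ * (a * p) + (a * s + (1ℚ * m + - y * m′)) ≡ a * (w₀ * p + s) + m - y * m′
    regroup = solve-∀ ring
    expand : ∀ a y v i w p → (v - y) * i * w * (v * p) ≡
      a * ((v - y) * i * w * p) + (1ℚ * (w * (v * p)) + - y * (w * p)) * ((v - a) * i)
    expand = solve-∀ ring
    term : ∀ {v} → v ≢ a → ∀ w p → (v - y) * inv (v - a) * w * (v * p) ≡
      a * ((v - y) * inv (v - a) * w * p) + (1ℚ * (w * (v * p)) + - y * (w * p))
    term {v} v≢a w p =
      trans (expand a y v (inv (v - a)) w p)
            (cong (a * ((v - y) * inv (v - a) * w * p) +_)
                  (trans (cong ((1ℚ * (w * (v * p)) + - y * (w * p)) *_) (*-inv (x-y≢0 v≢a)))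
                         (*-identityʳ (1ℚ * (w * (v * p)) + - y * (w * p)))))

  -- Growing a row breaks strictness only if the row above has length x exactly one more. Then the
  -- value of the box is `c₂ x`, a zero of the numerator contributed by that row.
  residue-nonstrict : ∀ {mu} → Decreasing mu → ∀ i → ¬ Decreasing (addBox mu i) → residue mu i ≡ 0ℚ
  residue-nonstrict {[]}     _       i       ¬d = contradiction (ℕ.z<s , tt) ¬d
  residue-nonstrict {x ∷ mu} (p , d) zero    ¬d = contradiction (ℕₚ.m<n⇒m<1+n p , d) ¬d
  residue-nonstrict {x ∷ mu} (p , d) (suc i) ¬d = helper (part (addBox mu i) 1 ℕₚ.<? x)
    where
    r = ratio x (newValue mu i)
    i⁻¹ = inv (newValue mu i - c₂ (suc x))
    collision : ∀ {m x} → suc m ≡ x → c₂ (suc m) - c₂ x ≡ 0ℚ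
    collision {m} refl = +-inverseʳ (c₂ (suc m))
    numerator : ∀ mu i → part mu 1 ℕ.< x → ¬ part (addBox mu i) 1 ℕ.< x → newValue mu i - c₂ x ≡ 0ℚ
    numerator []       i       p ¬q = collision (ℕₚ.≤-antisym p (ℕₚ.≮⇒≥ ¬q))
    numerator (w ∷ mu) zero    p ¬q = collision (ℕₚ.≤-antisym p (ℕₚ.≮⇒≥ ¬q))
    numerator (w ∷ mu) (suc i) p ¬q = contradiction p ¬q
    helper : Dec (part (addBox mu i) 1 ℕ.< x) → r * residue mu i ≡ 0ℚ
    helper (yes q) = trans (cong (r *_) (residue-nonstrict d i (λ d′ → ¬d (q , d′)))) (*-zeroʳ r)
    helper (no ¬q) = trans (cong (λ t → t * i⁻¹ * residue mu i) (numerator mu i p ¬q))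
                           (trans (cong (_* residue mu i) (*-zeroˡ i⁻¹)) (*-zeroˡ (residue mu i)))

  -- The coefficient of t^r in (1 - (2c+1)t + (c²-c)t²) B(t) - (1-ct)² A(t). Adding a box
  -- of value c moves a pair (y , c) to (c , z) with y + z = 2c + 1 and y z = c² - c, so
  -- the defect vanishes for the moments A before and B after.
  defect : ℚ → (ℕ → ℚ) → (ℕ → ℚ) → ℕ → ℚ
  defect c A B zero          = B 0 - A 0
  defect c A B (suc zero)    = B 1 - (c + c + 1ℚ) * B 0 - (A 1 - (c + c) * A 0)
  defect c A B (suc (suc r)) =
    B (suc (suc r)) - (c + c + 1ℚ) * B (suc r) + (c * c - c) * B r -
    (A (suc (suc r)) - (c + c) * A (suc r) + c * c * A r)

  -- A common first row multiplies both series by (1 - y t) / (1 - a t), and therefore the defect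
  -- too; a vanishing defect stays zero.
  defect-∷ : ∀ c x mu nu → (∀ r → defect c (moment mu) (moment nu) r ≡ 0ℚ) →
             ∀ r → defect c (moment (x ∷ mu)) (moment (x ∷ nu)) r ≡ 0ℚ
  defect-∷ c x mu nu δ zero    = refl
  defect-∷ c x mu nu δ (suc r) = trans (step r)
    (trans (cong₂ _-_ (cong₂ _+_ (trans (cong (a *_) (defect-∷ c x mu nu δ r)) (*-zeroʳ a)) (δ (suc r)))
                      (trans (cong (y *_) (δ r)) (*-zeroʳ y)))
           refl)
    where
    a = c₂ (suc x)
    y = c₂ x
    D = defect c (moment mu) (moment nu)
    D⁺ = defect c (moment (x ∷ mu)) (moment (x ∷ nu))
    at-1 : ∀ a y c A₁ B₁ →
      (a * 1ℚ + B₁ - y * 1ℚ) - (c + c + 1ℚ) * 1ℚ - ((a * 1ℚ + A₁ - y * 1ℚ) - (c + c) * 1ℚ) ≡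
      a * (1ℚ - 1ℚ) + (B₁ - (c + c + 1ℚ) * 1ℚ - (A₁ - (c + c) * 1ℚ)) - y * (1ℚ - 1ℚ)
    at-1 = solve-∀ ring
    at-2 : ∀ a y c A₁ A₂ B₁ B₂ →
      (a * (a * 1ℚ + B₁ - y * 1ℚ) + B₂ - y * B₁) - (c + c + 1ℚ) * (a * 1ℚ + B₁ - y * 1ℚ) + (c * c - c) * 1ℚ -
      ((a * (a * 1ℚ + A₁ - y * 1ℚ) + A₂ - y * A₁) - (c + c) * (a * 1ℚ + A₁ - y * 1ℚ) + c * c * 1ℚ) ≡
      a * ((a * 1ℚ + B₁ - y * 1ℚ) - (c + c + 1ℚ) * 1ℚ - ((a * 1ℚ + A₁ - y * 1ℚ) - (c + c) * 1ℚ)) +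
      (B₂ - (c + c + 1ℚ) * B₁ + (c * c - c) * 1ℚ - (A₂ - (c + c) * A₁ + c * c * 1ℚ)) -
      y * (B₁ - (c + c + 1ℚ) * 1ℚ - (A₁ - (c + c) * 1ℚ))
    at-2 = solve-∀ ring
    at-3 : ∀ a y c A₀ A₁ A₂ A₃ A⁺ B₀ B₁ B₂ B₃ B⁺ →
      (a * (a * (a * B⁺ + B₁ - y * B₀) + B₂ - y * B₁) + B₃ - y * B₂) -
      (c + c + 1ℚ) * (a * (a * B⁺ + B₁ - y * B₀) + B₂ - y * B₁) + (c * c - c) * (a * B⁺ + B₁ - y * B₀) -
      ((a * (a * (a * A⁺ + A₁ - y * A₀) + A₂ - y * A₁) + A₃ - y * A₂) -
       (c + c) * (a * (a * A⁺ + A₁ - y * A₀) + A₂ - y * A₁) + c * c * (a * A⁺ + A₁ - y * A₀)) ≡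
      a * ((a * (a * B⁺ + B₁ - y * B₀) + B₂ - y * B₁) - (c + c + 1ℚ) * (a * B⁺ + B₁ - y * B₀) + (c * c - c) * B⁺ -
           ((a * (a * A⁺ + A₁ - y * A₀) + A₂ - y * A₁) - (c + c) * (a * A⁺ + A₁ - y * A₀) + c * c * A⁺)) +
      (B₃ - (c + c + 1ℚ) * B₂ + (c * c - c) * B₁ - (A₃ - (c + c) * A₂ + c * c * A₁)) -
      y * (B₂ - (c + c + 1ℚ) * B₁ + (c * c - c) * B₀ - (A₂ - (c + c) * A₁ + c * c * A₀))
    at-3 = solve-∀ ring
    A = moment mu
    B = moment nu
    -- Comparing coefficients in (1 - a t) D⁺ = (1 - y t) D. The first two coefficients of a defect
    -- have formulas of their own, hence three cases.
    step : ∀ r → D⁺ (suc r) ≡ a * D⁺ r + D (suc r) - y * D r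
    step zero          = at-1 a y c (A 1) (B 1)
    step (suc zero)    = at-2 a y c (A 1) (A 2) (B 1) (B 2)
    step (suc (suc k)) = at-3 a y c
      (A k) (A (1 ℕ.+ k)) (A (2 ℕ.+ k)) (A (3 ℕ.+ k)) (moment (x ∷ mu) k)
      (B k) (B (1 ℕ.+ k)) (B (2 ℕ.+ k)) (B (3 ℕ.+ k)) (moment (x ∷ nu) k)

  -- With E the series of mu, A = (1 - y t) / (1 - c t) E and B = (1 - c t) / (1 - z t) E. Both
  -- sides of the relation are then (1 - y t)(1 - c t) E, once the quadratic is factored as (1 - y
  -- t)(1 - z t).
  defect-suc-head : ∀ x mu r → defect (c₂ (suc x)) (moment (x ∷ mu)) (moment (suc x ∷ mu)) r ≡ 0ℚ
  defect-suc-head x mu = go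
    where
    open ≡-Reasoning
    c = c₂ (suc x)
    y = c₂ x
    z = c₂ (suc (suc x))
    X = fromℕ x
    c≡ : c ≡ y + X
    c≡ = c₂-suc x
    z≡ : z ≡ y + X + (X + 1ℚ)
    z≡ = trans (c₂-suc (suc x)) (cong₂ _+_ c≡ (fromℕ-suc x))
    add : ∀ y X → (y + X) + (y + X) + 1ℚ ≡ y + (y + X + (X + 1ℚ))
    add = solve-∀ ring
    mul : ∀ y X → (y + X) * (y + X) - (y + X) ≡ y * (y + X + (X + 1ℚ)) + (X * (X - 1ℚ) - (y + y))
    mul = solve-∀ ring
    2c+1 : c + c + 1ℚ ≡ y + z
    2c+1 = trans (cong (λ t → t + t + 1ℚ) c≡) (trans (add y X) (cong (y +_) (sym z≡)))
    c²-c : c * c - c ≡ y * z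
    c²-c = begin
      c * c - c                                                ≡⟨ cong (λ t → t * t - t) c≡ ⟩
      (y + X) * (y + X) - (y + X)                              ≡⟨ mul y X ⟩
      y * (y + X + (X + 1ℚ)) + (X * (X - 1ℚ) - (y + y))        ≡⟨ cong₂ (λ s t → y * s + t) (sym z≡)
                                                                  (trans (cong (λ t → X * (X - 1ℚ) - t) (c₂-double x)) (+-inverseʳ (X * (X - 1ℚ)))) ⟩
      y * z + 0ℚ                                               ≡⟨ +-identityʳ (y * z) ⟩
      y * z                                                    ∎
    at-1 : ∀ y z c E → (z * 1ℚ + E - c * 1ℚ) - (y + z) * 1ℚ - ((c * 1ℚ + E - y * 1ℚ) - (c + c) * 1ℚ) ≡ 0ℚ
    at-1 = solve-∀ ring
    at-2 : ∀ y z c E₀ E₁ E₂ A B →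
      (z * (z * B + E₁ - c * E₀) + E₂ - c * E₁) - (y + z) * (z * B + E₁ - c * E₀) + y * z * B -
      ((c * (c * A + E₁ - y * E₀) + E₂ - y * E₁) - (c + c) * (c * A + E₁ - y * E₀) + c * c * A) ≡ 0ℚ
    at-2 = solve-∀ ring
    A = moment (x ∷ mu)
    B = moment (suc x ∷ mu)
    E = moment mu
    go : ∀ r → defect c A B r ≡ 0ℚ
    go zero          = refl
    go (suc zero)    = trans (cong (λ s → B 1 - s * B 0 - (A 1 - (c + c) * A 0)) 2c+1) (at-1 y z c (E 1))
    go (suc (suc r)) = trans
      (cong₂ (λ s p → B (2 ℕ.+ r) - s * B (1 ℕ.+ r) + p * B r -
                      (A (2 ℕ.+ r) - (c + c) * A (1 ℕ.+ r) + c * c * A r)) 2c+1 c²-c)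
      (at-2 y z c (E r) (E (1 ℕ.+ r)) (E (2 ℕ.+ r)) (A r) (B r))

  -- A row of length 0 contributes the factor 1, because `c₂ 0` and `c₂ 1` are both 0. Creating a
  -- new row thus becomes the growth of an empty one.
  moment-0∷ : ∀ mu r → moment (0 ∷ mu) r ≡ moment mu r
  moment-0∷ mu zero    = refl
  moment-0∷ mu (suc r) = simplify (moment (0 ∷ mu) r) (moment mu (suc r)) (moment mu r)
    where
    simplify : ∀ a b c → 0ℚ * a + b - 0ℚ * c ≡ b
    simplify = solve-∀ ring

  defect-cong : ∀ c {A A′} B → (∀ r → A r ≡ A′ r) → ∀ r → defect c A B r ≡ defect c A′ B r
  defect-cong c B eq zero          = cong (λ a → B 0 - a) (eq 0)
  defect-cong c B eq (suc zero)    = cong₂ (λ a a′ → B 1 - (c + c + 1ℚ) * B 0 - (a - (c + c) * a′)) (eq 1) (eq 0)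
  defect-cong c {A} {A′} B eq (suc (suc r)) =
    cong (λ a → B (suc (suc r)) - (c + c + 1ℚ) * B (suc r) + (c * c - c) * B r - a)
      (cong₂ _+_ (cong₂ (λ a a′ → a - (c + c) * a′) (eq (suc (suc r))) (eq (suc r)))
                 (cong (c * c *_) (eq r)))

  defect-addBox : ∀ mu i r → defect (newValue mu i) (moment mu) (moment (addBox mu i)) r ≡ 0ℚ
  defect-addBox []       i       r = trans (defect-cong 0ℚ (moment (1 ∷ [])) (λ s → sym (moment-0∷ [] s)) r)
                                           (defect-suc-head 0 [] r)
  defect-addBox (x ∷ mu) zero    r = defect-suc-head x mu r
  defect-addBox (x ∷ mu) (suc i) r = defect-∷ (newValue mu i) x mu (addBox mu i) (defect-addBox mu i) r

  -- The solution φ = B - A of the vanishing defect: (1 - (2z+1) t + (z² - z) t²) φ(t) = (t + z t²)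
  -- A(t), with A the moment series of mu.
  increment : ℕ → List ℕ → ℚ → ℚ
  increment zero          mu z = 0ℚ
  increment (suc zero)    mu z = 1ℚ
  increment (suc (suc r)) mu z =
    (z + z + 1ℚ) * increment (suc r) mu z - (z * z - z) * increment r mu z + moment mu (suc r) + z * moment mu r

  moment-addBox : ∀ mu i r → moment (addBox mu i) r ≡ moment mu r + increment r mu (newValue mu i)
  moment-addBox mu i zero          = refl
  moment-addBox mu i (suc zero)    = from-defect (newValue mu i) (moment mu 1) (moment (addBox mu i) 1) (defect-addBox mu i 1)
    where
    isolate : ∀ c A B → B ≡ (A + 1ℚ) + (B - (c + c + 1ℚ) * 1ℚ - (A - (c + c) * 1ℚ))
    isolate = solve-∀ ring
    from-defect : ∀ c A B → B - (c + c + 1ℚ) * 1ℚ - (A - (c + c) * 1ℚ) ≡ 0ℚ → B ≡ A + 1ℚ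
    from-defect c A B eq = trans (isolate c A B) (trans (cong (A + 1ℚ +_) eq) (+-identityʳ (A + 1ℚ)))
  moment-addBox mu i (suc (suc r)) = begin
    B (2 ℕ.+ r)
      ≡⟨ isolate c (A r) (A (1 ℕ.+ r)) (A (2 ℕ.+ r)) (B r) (B (1 ℕ.+ r)) (B (2 ℕ.+ r)) ⟩
    rhs (B r) (B (1 ℕ.+ r)) + defect c A B (2 ℕ.+ r)
      ≡⟨ trans (cong (rhs (B r) (B (1 ℕ.+ r)) +_) (defect-addBox mu i (2 ℕ.+ r))) (+-identityʳ (rhs (B r) (B (1 ℕ.+ r)))) ⟩
    rhs (B r) (B (1 ℕ.+ r))
      ≡⟨ cong₂ rhs (moment-addBox mu i r) (moment-addBox mu i (suc r)) ⟩
    rhs (A r + φ r) (A (1 ℕ.+ r) + φ (1 ℕ.+ r))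
      ≡⟨ collect c (A r) (A (1 ℕ.+ r)) (A (2 ℕ.+ r)) (φ r) (φ (1 ℕ.+ r)) ⟩
    A (2 ℕ.+ r) + φ (2 ℕ.+ r) ∎
    where
    open ≡-Reasoning
    c = newValue mu i
    A = moment mu
    B = moment (addBox mu i)
    φ = λ s → increment s mu c
    rhs : ℚ → ℚ → ℚ
    rhs b₀ b₁ = (c + c + 1ℚ) * b₁ - (c * c - c) * b₀ + (A (2 ℕ.+ r) - (c + c) * A (1 ℕ.+ r) + c * c * A r)
    isolate : ∀ c a₀ a₁ a₂ b₀ b₁ b₂ → b₂ ≡
      (c + c + 1ℚ) * b₁ - (c * c - c) * b₀ + (a₂ - (c + c) * a₁ + c * c * a₀) +
      (b₂ - (c + c + 1ℚ) * b₁ + (c * c - c) * b₀ - (a₂ - (c + c) * a₁ + c * c * a₀))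
    isolate = solve-∀ ring
    collect : ∀ c a₀ a₁ a₂ f₀ f₁ →
      (c + c + 1ℚ) * (a₁ + f₁) - (c * c - c) * (a₀ + f₀) + (a₂ - (c + c) * a₁ + c * c * a₀) ≡
      a₂ + ((c + c + 1ℚ) * f₁ - (c * c - c) * f₀ + a₁ + c * a₀)
    collect = solve-∀ ring

-- How symmetric functions of the contents change when a box is added.

module ContentValues where

  open Rationals
  open Residues
  open import Data.List.Base using (List; []; _∷_; _++_; map; concatMap; length; upTo)
  open import Data.List.Properties using (map-upTo; map-∘; map-++; upTo-∷ʳ; map-concatMap; concatMap-map; concatMap-cong; ++-assoc)
  open import Data.List.Relation.Binary.Permutation.Propositional as ↭ using (_↭_; ↭-refl; ↭-reflexive; ↭-trans)
  open import Data.List.Relation.Binary.Permutation.Propositional.Properties using (∷↭∷ʳ; ++⁺ˡ)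
    renaming (shift to ↭-shift)
  open import Data.Nat.Base as ℕ using (ℕ; zero; suc)
  import Data.Nat.Properties as ℕₚ
  open import Data.Nat.Combinatorics using (_C_)
  open import Data.Nat.ListAction using (sum)
  open import Data.Product.Base using (_,_)
  open import Data.Rational.Base hiding (NonZero)
  open import Data.Rational.Properties
  open import Algebra.Definitions.RawSemiring +-*-rawSemiring using (_^_)
  open import Function.Base using (_∘_)
  open import Relation.Binary.PropositionalEquality
  open import Tactic.RingSolver using (solve-∀)

  range-suc : ∀ n → range (suc n) ≡ 1 ∷ map suc (range n)
  range-suc n = cong (λ is → 1 ∷ map suc is) (sym (map-upTo suc n))

  range-∷ʳ : ∀ n → range (suc n) ≡ range n ++ (suc n ∷ [])
  range-∷ʳ n = trans (cong (map suc) (sym (upTo-∷ʳ n))) (map-++ suc (upTo n) (n ∷ []))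

  shiftBox : Box → Box
  shiftBox (i , j) = suc i , suc j

  firstRow : ℕ → List Box
  firstRow x = map (λ c → (1 , 1 ℕ.+ c)) (range x)

  diagram-∷ : ∀ x mu → diagram (x ∷ mu) ≡ firstRow x ++ map shiftBox (diagram mu)
  diagram-∷ x mu = trans (cong (concatMap rowBoxes) (range-suc (length mu)))
    (cong (firstRow x ++_) (begin
      concatMap rowBoxes (map suc (map suc (upTo (length mu))))
        ≡⟨ trans (concatMap-map rowBoxes suc (map suc (upTo (length mu))))
                 (concatMap-map (rowBoxes ∘ suc) suc (upTo (length mu))) ⟩
      concatMap (λ j → rowBoxes (suc (suc j))) (upTo (length mu))
        ≡⟨ concatMap-cong (λ j → map-∘ (range (part mu (suc j)))) (upTo (length mu)) ⟩
      concatMap (λ j → map shiftBox (rowBoxes′ (suc j))) (upTo (length mu))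
        ≡⟨ trans (sym (map-concatMap shiftBox (rowBoxes′ ∘ suc) (upTo (length mu))))
                 (cong (map shiftBox) (sym (concatMap-map rowBoxes′ suc (upTo (length mu))))) ⟩
      map shiftBox (diagram mu) ∎))
    where
    open ≡-Reasoning
    rowBoxes rowBoxes′ : ℕ → List Box
    rowBoxes i = map (λ c → (i , i ℕ.+ c)) (range (part (x ∷ mu) i))
    rowBoxes′ i = map (λ c → (i , i ℕ.+ c)) (range (part mu i))

  contentValues : List ℕ → List ℚ
  contentValues mu = map (λ b → fromℕ (content b C 2)) (diagram mu)

  -- Moving boxes along the diagonal preserves contents, so the lower rows keep theirs, while the
  -- first row has contents 1, ..., x.
  contentValues-∷ : ∀ x mu → contentValues (x ∷ mu) ≡ map c₂ (range x) ++ contentValues mu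
  contentValues-∷ x mu = trans (cong (map value) (diagram-∷ x mu))
    (trans (map-++ value (firstRow x) (map shiftBox (diagram mu)))
           (cong₂ _++_ (sym (map-∘ (range x))) (sym (map-∘ (diagram mu)))))
    where
    value : Box → ℚ
    value b = fromℕ (content b C 2)

  contentValues-addBox : ∀ mu i → contentValues (addBox mu i) ↭ newValue mu i ∷ contentValues mu
  contentValues-addBox []       i       = ↭-refl
  contentValues-addBox (x ∷ mu) zero    = ↭-trans (↭-reflexive (begin
    contentValues (suc x ∷ mu)                                  ≡⟨ contentValues-∷ (suc x) mu ⟩
    map c₂ (range (suc x)) ++ contentValues mu                  ≡⟨ cong (λ cs → map c₂ cs ++ contentValues mu) (range-∷ʳ x) ⟩
    map c₂ (range x ++ (suc x ∷ [])) ++ contentValues mu           ≡⟨ cong (_++ contentValues mu) (map-++ c₂ (range x) (suc x ∷ [])) ⟩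
    (map c₂ (range x) ++ (c₂ (suc x) ∷ [])) ++ contentValues mu    ≡⟨ ++-assoc (map c₂ (range x)) _ _ ⟩
    map c₂ (range x) ++ c₂ (suc x) ∷ contentValues mu           ∎))
    (↭-trans (↭-shift _ (map c₂ (range x)) (contentValues mu))
             (↭-reflexive (cong (c₂ (suc x) ∷_) (sym (contentValues-∷ x mu)))))
    where open ≡-Reasoning
  contentValues-addBox (x ∷ mu) (suc i) =
    ↭-trans (↭-reflexive (contentValues-∷ x (addBox mu i)))
    (↭-trans (++⁺ˡ (map c₂ (range x)) (contentValues-addBox mu i))
    (↭-trans (↭-shift _ (map c₂ (range x)) (contentValues mu))
             (↭-reflexive (cong (newValue mu i ∷_) (sym (contentValues-∷ x mu))))))

  open SymmetricFunction

  -- The coefficient of x^k in Q(x, x₁, x₂, …).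
  section : ℕ → SymmetricFunction → SymmetricFunction
  section k Q = record
    { coeff     = λ α → coeff Q (k ∷ α)
    ; padded    = λ α → padded Q (k ∷ α)
    ; symmetric = λ p → symmetric Q (↭.prep k p)
    ; degree    = degree Q ℕ.∸ k
    ; bounded   = λ α d∸k<s → bounded Q (k ∷ α)
        (ℕₚ.≤-<-trans (ℕₚ.m≤n+m∸n (degree Q) k) (ℕₚ.+-monoʳ-< k d∸k<s))
    }

  evaluate-cong : ∀ Q Q′ xs → (∀ α → coeff Q α ≡ coeff Q′ α) → degree Q ≡ degree Q′ →
                  evaluate Q xs ≡ evaluate Q′ xs
  evaluate-cong Q Q′ xs eq refl =
    ∑-cong (exponents (length xs) (degree Q)) (λ α → cong (_* monomial α xs) (eq α))

  evaluate-zero : ∀ Q xs → (∀ α → coeff Q α ≡ 0ℚ) → evaluate Q xs ≡ 0ℚ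
  evaluate-zero Q xs eq = ∑-zero (exponents (length xs) (degree Q))
    (λ {α} _ → trans (cong (_* monomial α xs) (eq α)) (*-zeroˡ (monomial α xs)))

  evaluate-∷ : ∀ Q x xs →
    evaluate Q (x ∷ xs) ≡ ∑ (upTo (suc (degree Q))) (λ k → x ^ k * evaluate (section k Q) xs)
  evaluate-∷ Q x xs = trans
    (∑-concatMap (λ k → map (k ∷_) (exponents (length xs) (degree Q ℕ.∸ k))) (upTo (suc (degree Q))) term)
    (∑-cong (upTo (suc (degree Q))) λ k →
      trans (∑-map (k ∷_) (exponents (length xs) (degree Q ℕ.∸ k)) term)
      (trans (∑-cong (exponents (length xs) (degree Q ℕ.∸ k)) (λ α → exchange (coeff Q (k ∷ α)) (x ^ k) (monomial α xs)))
             (∑-*ˡ (exponents (length xs) (degree Q ℕ.∸ k)) (x ^ k) (λ α → coeff Q (k ∷ α) * monomial α xs))))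
    where
    term : List ℕ → ℚ
    term α = coeff Q α * monomial α (x ∷ xs)
    exchange : ∀ a b c → a * (b * c) ≡ b * (a * c)
    exchange = solve-∀ ring

  ∑-upTo-extend : ∀ {m n} (φ : ℕ → ℚ) → m ℕ.≤ n → (∀ k → m ℕ.≤ k → φ k ≡ 0ℚ) → ∑ (upTo n) φ ≡ ∑ (upTo m) φ
  ∑-upTo-extend {n = n} φ ℕ.z≤n zeros = ∑-zero (upTo n) (λ {k} _ → zeros k ℕ.z≤n)
  ∑-upTo-extend {suc m} {suc n} φ (ℕ.s≤s m≤n) zeros =
    trans (∑-upTo-suc n φ)
    (trans (cong (φ 0 +_) (∑-upTo-extend (φ ∘ suc) m≤n (λ k m≤k → zeros (suc k) (ℕ.s≤s m≤k))))
           (sym (∑-upTo-suc m φ)))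

  -- Sections beyond the degree have only zero coefficients. The free bound `D` lets the expansions
  -- in two variables run over a common square of exponents, so that the variables can be exchanged.
  evaluate-∷-≤ : ∀ Q x xs {D} → degree Q ℕ.≤ D →
    evaluate Q (x ∷ xs) ≡ ∑ (upTo (suc D)) (λ k → x ^ k * evaluate (section k Q) xs)
  evaluate-∷-≤ Q x xs d≤D = trans (evaluate-∷ Q x xs)
    (sym (∑-upTo-extend (λ k → x ^ k * evaluate (section k Q) xs) (ℕ.s≤s d≤D) λ k d<k →
      trans (cong (x ^ k *_) (evaluate-zero (section k Q) xs
              (λ α → bounded Q (k ∷ α) (ℕₚ.<-≤-trans d<k (ℕₚ.m≤m+n k (sum α))))))
            (*-zeroʳ (x ^ k))))

  evaluate-swap : ∀ Q x y xs → evaluate Q (x ∷ y ∷ xs) ≡ evaluate Q (y ∷ x ∷ xs)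
  evaluate-swap Q x y xs = begin
    evaluate Q (x ∷ y ∷ xs)
      ≡⟨ expand Q x y ⟩
    ∑ ds (λ k → ∑ ds (λ l → x ^ k * (y ^ l * evaluate (section l (section k Q)) xs)))
      ≡⟨ ∑-swap ds ds (λ k l → x ^ k * (y ^ l * evaluate (section l (section k Q)) xs)) ⟩
    ∑ ds (λ l → ∑ ds (λ k → x ^ k * (y ^ l * evaluate (section l (section k Q)) xs)))
      ≡⟨ ∑-cong ds (λ l → ∑-cong ds (λ k →
           trans (cong (λ e → x ^ k * (y ^ l * e)) (evaluate-cong (section l (section k Q)) (section k (section l Q)) xs
                   (λ α → symmetric Q (↭.swap k l ↭.refl)) (∸-comm (degree Q) k l)))
                 (exchange (x ^ k) (y ^ l) (evaluate (section k (section l Q)) xs)))) ⟩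
    ∑ ds (λ l → ∑ ds (λ k → y ^ l * (x ^ k * evaluate (section k (section l Q)) xs)))
      ≡⟨ expand Q y x ⟨
    evaluate Q (y ∷ x ∷ xs) ∎
    where
    open ≡-Reasoning
    ds = upTo (suc (degree Q))
    exchange : ∀ a b c → a * (b * c) ≡ b * (a * c)
    exchange = solve-∀ ring
    ∸-comm : ∀ d k l → d ℕ.∸ k ℕ.∸ l ≡ d ℕ.∸ l ℕ.∸ k
    ∸-comm d k l = trans (ℕₚ.∸-+-assoc d k l)
      (trans (cong (d ℕ.∸_) (ℕₚ.+-comm k l)) (sym (ℕₚ.∸-+-assoc d l k)))
    expand : ∀ Q x y → let ds = upTo (suc (degree Q)) in evaluate Q (x ∷ y ∷ xs) ≡
      ∑ ds (λ k → ∑ ds (λ l → x ^ k * (y ^ l * evaluate (section l (section k Q)) xs)))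
    expand Q x y = trans (evaluate-∷ Q x (y ∷ xs)) (∑-cong (upTo (suc (degree Q))) λ k →
      trans (cong (x ^ k *_) (evaluate-∷-≤ (section k Q) y xs (ℕₚ.m∸n≤m (degree Q) k)))
            (sym (∑-*ˡ (upTo (suc (degree Q))) (x ^ k) (λ l → y ^ l * evaluate (section l (section k Q)) xs))))

  evaluate-↭ : ∀ Q {xs ys} → xs ↭ ys → evaluate Q xs ≡ evaluate Q ys
  evaluate-↭ Q ↭.refl         = refl
  evaluate-↭ Q (↭.trans p q)  = trans (evaluate-↭ Q p) (evaluate-↭ Q q)
  evaluate-↭ Q (↭.prep {xs} {ys} x p) = trans (evaluate-∷ Q x xs)
    (trans (∑-cong (upTo (suc (degree Q))) (λ k → cong (x ^ k *_) (evaluate-↭ (section k Q) p)))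
           (sym (evaluate-∷ Q x ys)))
  evaluate-↭ Q (↭.swap {xs} {ys} x y p) = trans (evaluate-swap Q x y xs)
    (trans (evaluate-∷ Q y (x ∷ xs))
    (trans (∑-cong (upTo (suc (degree Q))) (λ k → cong (y ^ k *_)
             (trans (evaluate-∷ (section k Q) x xs)
             (trans (∑-cong (upTo (suc (degree Q ℕ.∸ k)))
                      (λ l → cong (x ^ l *_) (evaluate-↭ (section l (section k Q)) p)))
                    (sym (evaluate-∷ (section k Q) x ys))))))
           (sym (evaluate-∷ Q y (x ∷ ys)))))

  -- A leading exponent 0 moves to the end by symmetry and is dropped there by padding.
  evaluate-section-0 : ∀ Q xs → evaluate (section 0 Q) xs ≡ evaluate Q xs
  evaluate-section-0 Q xs = evaluate-cong (section 0 Q) Q xs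
    (λ α → trans (symmetric Q (∷↭∷ʳ 0 α)) (padded Q α)) refl

  -- The constant term of the expansion in the new variable is Q itself, so the change involves only
  -- positive powers of the new value, each paired with a section of correspondingly lower degree.
  evaluate-addBox : ∀ Q mu i → evaluate Q (contentValues (addBox mu i)) ≡
    evaluate Q (contentValues mu) +
    ∑ (upTo (degree Q)) (λ k → newValue mu i ^ suc k * evaluate (section (suc k) Q) (contentValues mu))
  evaluate-addBox Q mu i = trans (evaluate-↭ Q (contentValues-addBox mu i))
    (trans (evaluate-∷ Q z xs)
    (trans (∑-upTo-suc (degree Q) (λ k → z ^ k * evaluate (section k Q) xs))
           (cong (_+ ∑ (upTo (degree Q)) (λ k → z ^ suc k * evaluate (section (suc k) Q) xs))
                 (trans (*-identityˡ (evaluate (section 0 Q) xs)) (evaluate-section-0 Q xs)))))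
    where
    z = newValue mu i
    xs = contentValues mu

-- The filtered algebra on which the averaging operator differs from the identity by lower order.

module Filtration where

  open Rationals
  open Residues
  open ContentValues
  open import Data.List.Base using (List; []; _∷_; upTo)
  open import Data.List.Membership.Propositional using (_∈_)
  open import Data.List.Relation.Unary.Any using (here; there)
  open import Data.List.Membership.Propositional.Properties using (∈-upTo⁻)
  open import Data.Nat.Base as ℕ using (ℕ; zero; suc)
  import Data.Nat.Properties as ℕₚ
  open import Data.Product.Base using (_×_; _,_; map₁; map₂; Σ-syntax)
  open import Data.Rational.Base hiding (NonZero)
  open import Data.Rational.Properties
  open import Algebra.Definitions.RawSemiring +-*-rawSemiring using (_^_)
  open import Function.Base using (_∘_)
  open import Relation.Binary.PropositionalEquality
  open import Tactic.RingSolver using (solve-∀)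

  open SymmetricFunction

  infixl 6 _⊕_
  infixl 7 _⊗_

  -- An algebra of functions of mu, filtered so that the difference operator
  -- g ↦ ∑ᵢ residue mu i * g (addBox mu i) - g mu lowers the order. The order of a
  -- symmetric function is twice its degree: a section by x^(k+1) loses 2 (k + 1),
  -- while the moment it produces has order only k + 1.
  data Order : ℕ → (List ℕ → ℚ) → Set where
    constant : ∀ q → Order 0 (λ _ → q)
    moment′  : ∀ r → Order r (λ mu → moment mu r)
    symm     : ∀ Q → Order (2 ℕ.* degree Q) (λ mu → evaluate Q (contentValues mu))
    _⊕_      : ∀ {d g h} → Order d g → Order d h → Order d (λ mu → g mu + h mu)
    _⊗_      : ∀ {d e g h} → Order d g → Order e h → Order (d ℕ.+ e) (λ mu → g mu * h mu)
    weaken   : ∀ {d e g} → d ℕ.≤ e → Order d g → Order e g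

  -- Polynomials in z, where z has order 1, of order strictly below d.
  data Below (d : ℕ) : (List ℕ → ℚ → ℚ) → Set where
    zero : Below d (λ _ _ → 0ℚ)
    term : ∀ {e g} k → e ℕ.+ k ℕ.< d → Order e g → Below d (λ mu z → z ^ k * g mu)
    _⊕_  : ∀ {φ ψ} → Below d φ → Below d ψ → Below d (λ mu z → φ mu z + ψ mu z)
    ext  : ∀ {φ ψ} → (∀ mu z → φ mu z ≡ ψ mu z) → Below d φ → Below d ψ

  weakenᵇ : ∀ {d e φ} → d ℕ.≤ e → Below d φ → Below e φ
  weakenᵇ d≤e zero         = zero
  weakenᵇ d≤e (term k p g) = term k (ℕₚ.<-≤-trans p d≤e) g
  weakenᵇ d≤e (φ ⊕ ψ)      = weakenᵇ d≤e φ ⊕ weakenᵇ d≤e ψ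
  weakenᵇ d≤e (ext eq φ)   = ext eq (weakenᵇ d≤e φ)

  scale : ∀ {d e g φ} → Order e g → Below d φ → Below (e ℕ.+ d) (λ mu z → g mu * φ mu z)
  scale {g = g} G zero = ext (λ mu z → sym (*-zeroʳ (g mu))) zero
  scale {d} {e} {g} G (term {e′} {h} k p H) = ext (λ mu z → exchange (g mu) (h mu) (z ^ k))
    (term k (subst (ℕ._< e ℕ.+ d) (sym (ℕₚ.+-assoc e e′ k)) (ℕₚ.+-monoʳ-< e p)) (G ⊗ H))
    where
    exchange : ∀ g h p → p * (g * h) ≡ g * (p * h)
    exchange = solve-∀ ring
  scale {g = g} G (_⊕_ {φ} {ψ} Φ Ψ) =
    ext (λ mu z → sym (*-distribˡ-+ (g mu) (φ mu z) (ψ mu z))) (scale G Φ ⊕ scale G Ψ)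
  scale {g = g} G (ext eq Φ) = ext (λ mu z → cong (g mu *_) (eq mu z)) (scale G Φ)

  raise : ∀ {d φ} k → Below d φ → Below (k ℕ.+ d) (λ mu z → z ^ k * φ mu z)
  raise k zero = ext (λ mu z → sym (*-zeroʳ (z ^ k))) zero
  raise {d} k (term {e} {h} l p H) =
    ext (λ mu z → trans (cong (_* h mu) (^-homo-* z k l)) (*-assoc (z ^ k) (z ^ l) (h mu)))
    (term (k ℕ.+ l) (subst (ℕ._< k ℕ.+ d) (rearrange k e l) (ℕₚ.+-monoʳ-< k p)) H)
    where
    rearrange : ∀ k e l → k ℕ.+ (e ℕ.+ l) ≡ e ℕ.+ (k ℕ.+ l)
    rearrange k e l = trans (sym (ℕₚ.+-assoc k e l)) (trans (cong (ℕ._+ l) (ℕₚ.+-comm k e)) (ℕₚ.+-assoc e k l))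
    ^-homo-* : ∀ z k l → z ^ (k ℕ.+ l) ≡ z ^ k * z ^ l
    ^-homo-* z zero    l = sym (*-identityˡ (z ^ l))
    ^-homo-* z (suc k) l = trans (cong (z *_) (^-homo-* z k l)) (sym (*-assoc z (z ^ k) (z ^ l)))
  raise k (_⊕_ {φ} {ψ} Φ Ψ) =
    ext (λ mu z → sym (*-distribˡ-+ (z ^ k) (φ mu z) (ψ mu z))) (raise k Φ ⊕ raise k Ψ)
  raise k (ext eq Φ) = ext (λ mu z → cong (z ^ k *_) (eq mu z)) (raise k Φ)

  multiply : ∀ {d e φ ψ} → Below d φ → Below e ψ → Below (d ℕ.+ e) (λ mu z → φ mu z * ψ mu z)
  multiply {ψ = ψ} zero Ψ = ext (λ mu z → sym (*-zeroˡ (ψ mu z))) zero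
  multiply {d} {e} {ψ = ψ} (term {e′} {g} k p G) Ψ =
    ext (λ mu z → sym (*-assoc (z ^ k) (g mu) (ψ mu z)))
    (weakenᵇ (subst (ℕ._≤ d ℕ.+ e) (trans (cong (ℕ._+ e) (ℕₚ.+-comm e′ k)) (ℕₚ.+-assoc k e′ e)) (ℕₚ.+-monoˡ-≤ e (ℕₚ.<⇒≤ p)))
             (raise k (scale G Ψ)))
  multiply {ψ = ψ} (_⊕_ {φ} {φ′} Φ Φ′) Ψ =
    ext (λ mu z → sym (*-distribʳ-+ (ψ mu z) (φ mu z) (φ′ mu z))) (multiply Φ Ψ ⊕ multiply Φ′ Ψ)
  multiply {ψ = ψ} (ext eq Φ) Ψ = ext (λ mu z → cong (_* ψ mu z) (eq mu z)) (multiply Φ Ψ)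

  below-∑ : ∀ {d} {A : Set} (xs : List A) {φ : A → List ℕ → ℚ → ℚ} → (∀ {x} → x ∈ xs → Below d (φ x)) →
            Below d (λ mu z → ∑ xs (λ x → φ x mu z))
  below-∑ []       Φ = zero
  below-∑ (x ∷ xs) Φ = Φ (here refl) ⊕ below-∑ xs (Φ ∘ there)

  -- Each step down in the recursion is compensated by at most as many powers of z. The strict drop
  -- enters through `moment mu (suc r)` and z times `moment mu r`, both of order r + 1 where r + 2
  -- would be the order of the moment.
  below-increment : ∀ r → Below r (increment r)
  below-increment zero          = zero
  below-increment (suc zero)    = ext (λ _ _ → refl) (term 0 (ℕ.s≤s ℕ.z≤n) (constant 1ℚ))
  below-increment (suc (suc r)) with below-increment (suc r) | below-increment r
  ... | I₁ | I₀ =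
    ext (λ mu z → collect z (increment (suc r) mu z) (increment r mu z) (moment mu (suc r)) (moment mu r))
      (raise 1 I₁ ⊕ raise 1 I₁ ⊕ weakenᵇ (ℕₚ.n≤1+n (suc r)) I₁ ⊕
       scale (constant (- 1ℚ)) (raise 2 I₀) ⊕ weakenᵇ (ℕₚ.n≤1+n (suc r)) (raise 1 I₀) ⊕
       term 0 (ℕ.s≤s (ℕₚ.≤-reflexive (ℕₚ.+-identityʳ (suc r)))) (moment′ (suc r)) ⊕
       term 1 (ℕ.s≤s (ℕₚ.≤-reflexive (ℕₚ.+-comm r 1))) (moment′ r))
    where
    collect : ∀ z i₁ i₀ m₁ m₀ →
      (z * 1ℚ) * i₁ + (z * 1ℚ) * i₁ + i₁ + (- 1ℚ) * ((z * (z * 1ℚ)) * i₀) + (z * 1ℚ) * i₀ + 1ℚ * m₁ + (z * 1ℚ) * m₀ ≡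
      (z + z + 1ℚ) * i₁ - (z * z - z) * i₀ + m₁ + z * m₀
    collect = solve-∀ ring

  -- The change depends on the row only through the value of the new box, and polynomially; such
  -- changes can be averaged by moments alone.
  Increment : ℕ → (List ℕ → ℚ) → Set
  Increment d g = Σ[ φ ∈ (List ℕ → ℚ → ℚ) ] Below d φ × (∀ mu i → g (addBox mu i) ≡ g mu + φ mu (newValue mu i))

  increment-symm : ∀ Q → Increment (2 ℕ.* degree Q) (λ mu → evaluate Q (contentValues mu))
  increment-symm Q =
    (λ mu z → ∑ (upTo (degree Q)) (λ k → sectionTerm k mu z)) ,
    below-∑ (upTo (degree Q)) {sectionTerm} (λ {k} k∈ → sections k (∈-upTo⁻ k∈)) ,
    evaluate-addBox Q
    where
    sectionTerm : ℕ → List ℕ → ℚ → ℚ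
    sectionTerm k mu z = z ^ suc k * evaluate (section (suc k) Q) (contentValues mu)
    sections : ∀ k → k ℕ.< degree Q → Below (2 ℕ.* degree Q) (sectionTerm k)
    sections k k<d = term (suc k) bound (symm (section (suc k) Q))
      where
      open ℕₚ.≤-Reasoning
      d = degree Q
      -- As k + 1 ≤ d, the left side is (d - (k + 1)) + d, which is less than 2 d because k + 1 is
      -- positive.
      bound : 2 ℕ.* (d ℕ.∸ suc k) ℕ.+ suc k ℕ.< 2 ℕ.* d
      bound = begin-strict
        2 ℕ.* (d ℕ.∸ suc k) ℕ.+ suc k                ≡⟨ cong (λ s → (d ℕ.∸ suc k) ℕ.+ s ℕ.+ suc k) (ℕₚ.+-identityʳ (d ℕ.∸ suc k)) ⟩
        (d ℕ.∸ suc k) ℕ.+ (d ℕ.∸ suc k) ℕ.+ suc k    ≡⟨ ℕₚ.+-assoc (d ℕ.∸ suc k) (d ℕ.∸ suc k) (suc k) ⟩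
        (d ℕ.∸ suc k) ℕ.+ ((d ℕ.∸ suc k) ℕ.+ suc k)  ≡⟨ cong ((d ℕ.∸ suc k) ℕ.+_) (ℕₚ.m∸n+n≡m k<d) ⟩
        (d ℕ.∸ suc k) ℕ.+ d                          <⟨ ℕₚ.+-monoˡ-< d (ℕₚ.∸-monoʳ-< {d} {suc k} {0} ℕ.z<s k<d) ⟩
        d ℕ.+ d                                      ≡⟨ cong (d ℕ.+_) (ℕₚ.+-identityʳ d) ⟨
        2 ℕ.* d                                      ∎

  increment-⊕ : ∀ {d g h} → Increment d g → Increment d h → Increment d (λ mu → g mu + h mu)
  increment-⊕ {g = g} {h} (φ , Φ , eq) (ψ , Ψ , eq′) = (λ mu z → φ mu z + ψ mu z) , Φ ⊕ Ψ , λ mu i →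
    trans (cong₂ _+_ (eq mu i) (eq′ mu i)) (exchange (g mu) (φ mu (newValue mu i)) (h mu) (ψ mu (newValue mu i)))
    where
    exchange : ∀ a b c d → (a + b) + (c + d) ≡ (a + c) + (b + d)
    exchange = solve-∀ ring

  -- The product rule. Each cross term has the full order of one factor and the lowered order of the
  -- other; the product of the two increments is lower still or equally low.
  increment-⊗ : ∀ {d e g h} → Order d g → Order e h → Increment d g → Increment e h →
                Increment (d ℕ.+ e) (λ mu → g mu * h mu)
  increment-⊗ {d} {e} {g} {h} G H (φ , Φ , eq) (ψ , Ψ , eq′) =
    (λ mu z → g mu * ψ mu z + h mu * φ mu z + φ mu z * ψ mu z) ,
    scale G Ψ ⊕ weakenᵇ (ℕₚ.≤-reflexive (ℕₚ.+-comm e d)) (scale H Φ) ⊕ multiply Φ Ψ ,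
    λ mu i → trans (cong₂ _*_ (eq mu i) (eq′ mu i))
                   (expand (g mu) (φ mu (newValue mu i)) (h mu) (ψ mu (newValue mu i)))
    where
    expand : ∀ a b c d → (a + b) * (c + d) ≡ a * c + (a * d + c * b + b * d)
    expand = solve-∀ ring

  incrementOf : ∀ {d g} → Order d g → Increment d g
  incrementOf (constant q)   = (λ _ _ → 0ℚ) , zero , λ _ _ → sym (+-identityʳ q)
  incrementOf (moment′ r)    = increment r , below-increment r , λ mu i → moment-addBox mu i r
  incrementOf (symm Q)       = increment-symm Q
  incrementOf (_⊕_ {g = g} {h} G H) = increment-⊕ {g = g} {h} (incrementOf G) (incrementOf H)
  incrementOf (G ⊗ H)        = increment-⊗ G H (incrementOf G) (incrementOf H)
  incrementOf (weaken d≤e G) = map₂ (map₁ (weakenᵇ d≤e)) (incrementOf G)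

  -- No monomial has order below 0, so only zeros remain.
  below-0 : ∀ {φ} → Below 0 φ → ∀ mu z → φ mu z ≡ 0ℚ
  below-0 zero         mu z = refl
  below-0 (φ ⊕ ψ)      mu z = cong₂ _+_ (below-0 φ mu z) (below-0 ψ mu z)
  below-0 (ext eq φ)   mu z = trans (sym (eq mu z)) (below-0 φ mu z)

  -- Stated for functions of the row; the operator U sends g to `average mu (g ∘ addBox mu)`.
  average : List ℕ → (ℕ → ℚ) → ℚ
  average mu φ = ∑ (rows mu) (λ i → residue mu i * φ i)

  Average : ℕ → (List ℕ → ℚ → ℚ) → Set
  Average d φ = Σ[ g ∈ (List ℕ → ℚ) ] Order d g ×
    (∀ {mu} → Decreasing mu → average mu (λ i → φ mu (newValue mu i)) ≡ g mu)

  -- The factor `g mu` does not depend on the row, and averaging z^k leaves `moment mu k`, which has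
  -- the same order k.
  average-term : ∀ {d e g} k → e ℕ.+ k ℕ.≤ d → Order e g → Average d (λ mu z → z ^ k * g mu)
  average-term {g = g} k p G = (λ mu → g mu * moment mu k) , weaken p (G ⊗ moment′ k) , λ {mu} dec →
    trans (∑-cong (rows mu) (λ i → exchange (residue mu i) (newValue mu i ^ k) (g mu)))
    (trans (∑-*ˡ (rows mu) (g mu) (λ i → residue mu i * newValue mu i ^ k))
           (cong (g mu *_) (moments dec k)))
    where
    exchange : ∀ w p g → w * (p * g) ≡ g * (w * p)
    exchange = solve-∀ ring

  average-⊕ : ∀ {d φ ψ} → Average d φ → Average d ψ → Average d (λ mu z → φ mu z + ψ mu z)
  average-⊕ {φ = φ} {ψ} (g , G , eq) (h , H , eq′) = (λ mu → g mu + h mu) , G ⊕ H , λ {mu} dec →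
    trans (∑-cong (rows mu) (λ i → *-distribˡ-+ (residue mu i) (φ mu (newValue mu i)) (ψ mu (newValue mu i))))
    (trans (∑-+ (rows mu) (λ i → residue mu i * φ mu (newValue mu i)) (λ i → residue mu i * ψ mu (newValue mu i)))
           (cong₂ _+_ (eq dec) (eq′ dec)))

  average-ext : ∀ {d φ ψ} → (∀ mu z → φ mu z ≡ ψ mu z) → Average d φ → Average d ψ
  average-ext eq (g , G , eq′) = g , G , λ {mu} dec →
    trans (∑-cong (rows mu) (λ i → cong (residue mu i *_) (sym (eq mu (newValue mu i))))) (eq′ dec)

  average-below : ∀ {d φ} → Below (suc d) φ → Average d φ
  average-below zero                 = (λ _ → 0ℚ) , weaken ℕ.z≤n (constant 0ℚ) ,
                                       λ {mu} _ → ∑-zero (rows mu) (λ {i} _ → *-zeroʳ (residue mu i))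
  average-below (term k (ℕ.s≤s p) G) = average-term k p G
  average-below (_⊕_ {φ} {ψ} Φ Ψ)      = average-⊕ {φ = φ} {ψ} (average-below Φ) (average-below Ψ)
  average-below (ext {φ} {ψ} eq Φ)     = average-ext {φ = φ} {ψ} eq (average-below Φ)

  average-increment : ∀ {mu} → Decreasing mu → ∀ c (φ : ℕ → ℚ) → average mu (λ i → c + φ i) ≡ c + average mu φ
  average-increment {mu} dec c φ =
    trans (∑-cong (rows mu) (λ i → expand (residue mu i) c (φ i)))
    (trans (∑-linear (rows mu) c (residue mu) 1ℚ (λ i → residue mu i * φ i))
           (cong₂ _+_ (trans (cong (c *_) (residues-sum dec)) (*-identityʳ c)) (*-identityˡ (average mu φ))))
    where
    expand : ∀ w c f → w * (c + f) ≡ c * w + 1ℚ * (w * f)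
    expand = solve-∀ ring

  -- Order 0 leaves no room for a change, so g is constant along added boxes, and the residues sum
  -- to 1. This ends the descent in the order.
  average-order-0 : ∀ {g} → Order 0 g → ∀ {mu} → Decreasing mu → average mu (g ∘ addBox mu) ≡ g mu
  average-order-0 {g} G {mu} dec = helper (incrementOf G)
    where
    helper : Increment 0 g → average mu (g ∘ addBox mu) ≡ g mu
    helper (φ , Φ , eq) = trans
      (∑-cong (rows mu) (λ i → cong (residue mu i *_) (trans (eq mu i) (cong (g mu +_) (below-0 Φ mu (newValue mu i))))))
      (trans (average-increment dec (g mu) (λ _ → 0ℚ))
      (trans (cong (g mu +_) (∑-zero (rows mu) (λ {i} _ → *-zeroʳ (residue mu i)))) (+-identityʳ (g mu))))

  Difference : ℕ → (List ℕ → ℚ) → Set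
  Difference d g = Σ[ h ∈ (List ℕ → ℚ) ] Order d h ×
    (∀ {mu} → Decreasing mu → average mu (g ∘ addBox mu) ≡ g mu + h mu)

  average-order-suc : ∀ {d g} → Order (suc d) g → Difference d g
  average-order-suc {d} {g} G = helper (incrementOf G)
    where
    combine : ∀ {φ} → (∀ mu i → g (addBox mu i) ≡ g mu + φ mu (newValue mu i)) → Average d φ → Difference d g
    combine {φ} eq (h , H , eq′) = h , H , λ {mu} dec →
      trans (∑-cong (rows mu) (λ i → cong (residue mu i *_) (eq mu i)))
      (trans (average-increment dec (g mu) (λ i → φ mu (newValue mu i))) (cong (g mu +_) (eq′ dec)))
    helper : Increment (suc d) g → Difference d g
    helper (φ , Φ , eq) = combine {φ} eq (average-below Φ)

-- Standard fillings as linear extensions, counted by the box of the smallest entry.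

module LinearExtensions where

  open Rationals
  open import Data.List.Base using (List; []; _∷_; map; filter; length; upTo; zip)
  open import Data.List.Properties using (length-map; map-cong-local; map-∘; filter-accept; filter-reject; filter-all; length-upTo)
  open import Data.List.Membership.Propositional using (_∈_)
  open import Data.List.Relation.Binary.Permutation.Propositional as ↭ using (_↭_; ↭-refl; ↭-sym; ↭-swap)
  open import Data.List.Relation.Binary.Permutation.Propositional.Properties using (All-resp-↭; ↭-length)
  open import Data.List.Relation.Unary.All as All using (All; []; _∷_)
  import Data.List.Relation.Unary.All.Properties as Allₚ
  open import Data.List.Relation.Unary.AllPairs using (AllPairs; []; _∷_)
  import Data.List.Relation.Unary.AllPairs.Properties as AllPairsₚ
  open import Data.List.Relation.Unary.Unique.Propositional using (Unique)
  open import Data.Nat.Base using (ℕ; zero; suc; _<_; s<s)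
  import Data.Nat.Properties as ℕₚ
  open import Data.Product.Base using (_×_; _,_; proj₁; proj₂; map₂)
  open import Data.Product.Properties using (≡-dec)
  open import Data.Rational.Base using (ℚ; 1ℚ; _+_; _*_)
  open import Data.Rational.Properties using (*-identityʳ; *-zeroˡ; +-comm)
  open import Data.Sum.Base using (_⊎_; inj₁; inj₂; [_,_]′)
  open import Function.Base using (_∘_; id)
  open import Function.Bundles using (_⇔_; mk⇔; Equivalence)
  open import Relation.Binary.PropositionalEquality
  open import Relation.Nullary.Decidable using (Dec; yes; no; ¬?; _×-dec_; _⊎-dec_)
  open import Relation.Nullary.Negation using (¬_; contradiction)
  open import Relation.Unary using (Decidable)

  ⟦⟧-cong : ∀ {P Q : Set} (p : Dec P) (q : Dec Q) → P ⇔ Q → ⟦ p ⟧ ≡ ⟦ q ⟧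
  ⟦⟧-cong (yes p) q P⇔Q = sym (⟦yes⟧ q (Equivalence.to P⇔Q p))
  ⟦⟧-cong (no ¬p) q P⇔Q = sym (⟦no⟧ q (¬p ∘ Equivalence.from P⇔Q))

  ⟦⟧-× : ∀ {P Q : Set} (p : Dec P) (q : Dec Q) → ⟦ p ×-dec q ⟧ ≡ ⟦ p ⟧ * ⟦ q ⟧
  ⟦⟧-× (yes _) (yes _) = refl
  ⟦⟧-× (yes _) (no _)  = refl
  ⟦⟧-× (no _)  q       = sym (*-zeroˡ ⟦ q ⟧)

  fromℕ-length-filter : ∀ {A : Set} {P : A → Set} (P? : Decidable P) xs →
    fromℕ (length (filter P? xs)) ≡ ∑ xs (λ x → ⟦ P? x ⟧)
  fromℕ-length-filter P? xs =
    trans (fromℕ-length (filter P? xs)) (trans (∑-filter P? xs (λ _ → 1ℚ)) (∑-cong xs (λ x → *-identityʳ ⟦ P? x ⟧)))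
    where
    fromℕ-length : ∀ {A : Set} (xs : List A) → fromℕ (length xs) ≡ ∑ xs (λ _ → 1ℚ)
    fromℕ-length []       = refl
    fromℕ-length (x ∷ xs) = trans (fromℕ-suc (length xs)) (trans (+-comm (fromℕ (length xs)) 1ℚ) (cong (1ℚ +_) (fromℕ-length xs)))

  picks : ∀ {A : Set} → List A → List (A × List A)
  picks []       = []
  picks (x ∷ xs) = (x , xs) ∷ map (map₂ (x ∷_)) (picks xs)

  picks-length : ∀ {A : Set} (xs : List A) → All (λ p → suc (length (proj₂ p)) ≡ length xs) (picks xs)
  picks-length []       = []
  picks-length (x ∷ xs) = refl ∷ Allₚ.map⁺ (All.map (cong suc) (picks-length xs))

  _≟ᵇ_ : (b b′ : Box) → Dec (b ≡ b′)
  _≟ᵇ_ = ≡-dec ℕₚ._≟_ ℕₚ._≟_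

  remove : Box → List Box → List Box
  remove b = filter (λ b′ → ¬? (b′ ≟ᵇ b))

  -- `picks` deletes a position while `remove` deletes every copy of a value; without repetitions
  -- the two agree.
  picks-remove : ∀ {bs} → Unique bs → picks bs ≡ map (λ b → b , remove b bs) bs
  picks-remove []             = refl
  picks-remove {b ∷ bs} (b∉ ∷ u) = cong₂ _∷_ (cong (b ,_) (sym remove-head)) (begin
    map (map₂ (b ∷_)) (picks bs)                           ≡⟨ cong (map (map₂ (b ∷_))) (picks-remove u) ⟩
    map (map₂ (b ∷_)) (map (λ b′ → b′ , remove b′ bs) bs)  ≡⟨ map-∘ bs ⟨
    map (λ b′ → b′ , b ∷ remove b′ bs) bs                  ≡⟨ map-cong-local (All.map (λ {b′} b≢b′ → cong (b′ ,_)
                                                               (sym (filter-accept (λ c → ¬? (c ≟ᵇ b′)) b≢b′))) b∉) ⟩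
    map (λ b′ → b′ , remove b′ (b ∷ bs)) bs                ∎)
    where
    open ≡-Reasoning
    remove-head : remove b (b ∷ bs) ≡ bs
    remove-head = trans (filter-reject (λ c → ¬? (c ≟ᵇ b)) (λ ≢ → ≢ refl))
                        (filter-all (λ c → ¬? (c ≟ᵇ b)) (All.map (λ b≢c c≡b → b≢c (sym c≡b)) b∉))

  Before : Box → Box → Set
  Before b b′ = (row b ≡ row b′ × col b < col b′) ⊎ (col b ≡ col b′ × row b < row b′)

  before? : ∀ b b′ → Dec (Before b b′)
  before? b b′ = ((row b ℕₚ.≟ row b′) ×-dec (col b ℕₚ.<? col b′)) ⊎-dec ((col b ℕₚ.≟ col b′) ×-dec (row b ℕₚ.<? row b′))

  Minimal : List Box → Box → Set
  Minimal bs b = All (λ b′ → ¬ Before b′ b) bs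

  minimal? : ∀ bs b → Dec (Minimal bs b)
  minimal? bs b = All.all? (λ b′ → ¬? (before? b′ b)) bs

  -- Counts the linear extensions of bs only when n is its length.
  linearExtensions : ℕ → List Box → ℚ
  linearExtensions zero    bs = 1ℚ
  linearExtensions (suc n) bs = ∑ (picks bs) λ (b , bs′) → ⟦ minimal? bs′ b ⟧ * linearExtensions n bs′

  -- The place where x is inserted into the word of labels decides which box receives x. Since φ
  -- ignores the order of the pairs, that box can be brought to the front, leaving the remaining
  -- boxes to the old word.
  ∑-insertions : ∀ (φ : Filling → ℚ) → (∀ {S T} → S ↭ T → φ S ≡ φ T) →
    ∀ x bs π → length bs ≡ suc (length π) →
    ∑ (insertions x π) (λ ρ → φ (zip bs ρ)) ≡ ∑ (picks bs) (λ (b , bs′) → φ ((b , x) ∷ zip bs′ π))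
  ∑-insertions φ inv x (b ∷ [])      []       refl = refl
  ∑-insertions φ inv x (b ∷ b₁ ∷ bs) (y ∷ π)  eq   = cong (φ ((b , x) ∷ (b₁ , y) ∷ zip bs π) +_) (begin
    ∑ (map (y ∷_) (insertions x π)) (λ ρ → φ (zip (b ∷ b₁ ∷ bs) ρ))
      ≡⟨ ∑-map (y ∷_) (insertions x π) (λ ρ → φ (zip (b ∷ b₁ ∷ bs) ρ)) ⟩
    ∑ (insertions x π) (λ ρ → φ ((b , y) ∷ zip (b₁ ∷ bs) ρ))
      ≡⟨ ∑-insertions (λ T → φ ((b , y) ∷ T)) (λ p → inv (↭.prep (b , y) p)) x (b₁ ∷ bs) π (ℕₚ.suc-injective eq) ⟩
    ∑ (picks (b₁ ∷ bs)) (λ (b′ , bs′) → φ ((b , y) ∷ (b′ , x) ∷ zip bs′ π))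
      ≡⟨ ∑-cong (picks (b₁ ∷ bs)) (λ (b′ , bs′) → inv (↭-swap (b , y) (b′ , x) ↭-refl)) ⟩
    ∑ (picks (b₁ ∷ bs)) (λ (b′ , bs′) → φ ((b′ , x) ∷ zip (b ∷ bs′) (y ∷ π)))
      ≡⟨ ∑-map (map₂ (b ∷_)) (picks (b₁ ∷ bs)) (λ (b′ , bs′) → φ ((b′ , x) ∷ zip bs′ (y ∷ π))) ⟨
    ∑ (map (map₂ (b ∷_)) (picks (b₁ ∷ bs))) (λ (b′ , bs′) → φ ((b′ , x) ∷ zip bs′ (y ∷ π))) ∎)
    where open ≡-Reasoning

  isStandard-resp-↭ : ∀ {S T} → S ↭ T → IsStandard S → IsStandard T
  isStandard-resp-↭ p std = All-resp-↭ p (All.map (All-resp-↭ p) std)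

  all-zip₁⁺ : ∀ {P : Box → Set} {bs} (π : List ℕ) → All P bs → All (P ∘ proj₁) (zip bs π)
  all-zip₁⁺ π       []       = []
  all-zip₁⁺ []      (p ∷ ps) = []
  all-zip₁⁺ (_ ∷ π) (p ∷ ps) = p ∷ all-zip₁⁺ π ps

  all-zip₁⁻ : ∀ {P : Box → Set} bs (π : List ℕ) → length bs ≡ length π → All (P ∘ proj₁) (zip bs π) → All P bs
  all-zip₁⁻ []       π       eq ps       = []
  all-zip₁⁻ (b ∷ bs) (_ ∷ π) eq (p ∷ ps) = p ∷ all-zip₁⁻ bs π (ℕₚ.suc-injective eq) ps

  all-zip₂⁺ : ∀ {P : ℕ → Set} (bs : List Box) {π} → All P π → All (P ∘ proj₂) (zip bs π)
  all-zip₂⁺ []       ps       = []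
  all-zip₂⁺ (b ∷ bs) []       = []
  all-zip₂⁺ (b ∷ bs) (p ∷ ps) = p ∷ all-zip₂⁺ bs ps

  -- As x is below all other labels, the conditions involving b only forbid a box before b.
  isStandard-∷ : ∀ {b x bs π} → length bs ≡ length π → All (x <_) π →
    IsStandard ((b , x) ∷ zip bs π) ⇔ (Minimal bs b × IsStandard (zip bs π))
  isStandard-∷ {b} {x} {bs} {π} eq x< = mk⇔ to from
    where
    to : IsStandard ((b , x) ∷ zip bs π) → Minimal bs b × IsStandard (zip bs π)
    to (_ ∷ std) = all-zip₁⁻ bs π eq (All.zipWith minimal (all-zip₂⁺ bs x< , std)) , All.map All.tail std
      where
      minimal : ∀ {p} → x < proj₂ p × All (Increasing p) ((b , x) ∷ zip bs π) → ¬ Before (proj₁ p) b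
      minimal (x<k , (inc ∷ _)) = [ ℕₚ.<-asym x<k ∘ proj₁ inc , ℕₚ.<-asym x<k ∘ proj₂ inc ]′
    from : Minimal bs b × IsStandard (zip bs π) → IsStandard ((b , x) ∷ zip bs π)
    from (min , std) =
      (((λ (_ , c<c) → contradiction c<c (ℕₚ.<-irrefl refl)) , (λ (_ , c<c) → contradiction c<c (ℕₚ.<-irrefl refl))) ∷
       All.map (λ x<k → (λ _ → x<k) , (λ _ → x<k)) (all-zip₂⁺ bs x<)) ∷
      All.zipWith (λ (¬before , inc) → ((λ c → contradiction (inj₁ c) ¬before) , (λ c → contradiction (inj₂ c) ¬before)) ∷ inc)
                  (all-zip₁⁺ π min , std)

  -- Labels are assigned from the smallest up: the head of an ascending list goes to a minimal box,
  -- and the rest fills what remains. The ascending order is what makes the head smaller than every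
  -- later label.
  ∑-standard : ∀ ks bs → AllPairs _<_ ks → length bs ≡ length ks →
    ∑ (permutations ks) (λ π → ⟦ isStandard? (zip bs π) ⟧) ≡ linearExtensions (length ks) bs
  ∑-standard []       []  _         _  = refl
  ∑-standard (x ∷ ks) bs (x< ∷ asc) eq = begin
    ∑ (permutations (x ∷ ks)) (λ π → std (zip bs π))
      ≡⟨ ∑-concatMap (insertions x) (permutations ks) (λ π → std (zip bs π)) ⟩
    ∑ (permutations ks) (λ π → ∑ (insertions x π) (λ ρ → std (zip bs ρ)))
      ≡⟨ ∑-cong-∈ (permutations ks) (λ π∈ → insert (Equivalence.to (∈-permutations⇔ ks) π∈)) ⟩
    ∑ (permutations ks) (λ π → ∑ (picks bs) (λ (b , bs′) → ⟦ minimal? bs′ b ⟧ * std (zip bs′ π)))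
      ≡⟨ ∑-swap (permutations ks) (picks bs) (λ π (b , bs′) → ⟦ minimal? bs′ b ⟧ * std (zip bs′ π)) ⟩
    ∑ (picks bs) (λ (b , bs′) → ∑ (permutations ks) (λ π → ⟦ minimal? bs′ b ⟧ * std (zip bs′ π)))
      ≡⟨ ∑-cong-∈ (picks bs) (λ {(b , bs′)} p∈ →
           trans (∑-*ˡ (permutations ks) ⟦ minimal? bs′ b ⟧ (λ π → std (zip bs′ π)))
                 (cong (⟦ minimal? bs′ b ⟧ *_) (∑-standard ks bs′ asc (picked p∈)))) ⟩
    linearExtensions (suc (length ks)) bs ∎
    where
    open ≡-Reasoning
    std : Filling → ℚ
    std T = ⟦ isStandard? T ⟧
    std-↭ : ∀ {S T} → S ↭ T → std S ≡ std T
    std-↭ {S} {T} p = ⟦⟧-cong (isStandard? S) (isStandard? T) (mk⇔ (isStandard-resp-↭ p) (isStandard-resp-↭ (↭-sym p)))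
    picked : ∀ {p} → p ∈ picks bs → length (proj₂ p) ≡ length ks
    picked p∈ = ℕₚ.suc-injective (trans (All.lookup (picks-length bs) p∈) eq)
    insert : ∀ {π} → π ↭ ks →
      ∑ (insertions x π) (λ ρ → std (zip bs ρ)) ≡ ∑ (picks bs) (λ (b , bs′) → ⟦ minimal? bs′ b ⟧ * std (zip bs′ π))
    insert {π} π↭ = trans (∑-insertions std std-↭ x bs π (trans eq (cong suc (sym (↭-length π↭)))))
      (∑-cong-∈ (picks bs) (λ {(b , bs′)} p∈ →
        trans (⟦⟧-cong (isStandard? ((b , x) ∷ zip bs′ π)) (minimal? bs′ b ×-dec isStandard? (zip bs′ π))
                (isStandard-∷ (trans (picked p∈) (sym (↭-length π↭))) (All-resp-↭ (↭-sym π↭) x<)))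
              (⟦⟧-× (minimal? bs′ b) (isStandard? (zip bs′ π)))))

  range-ascending : ∀ n → AllPairs _<_ (range n)
  range-ascending n = AllPairsₚ.map⁺ (AllPairsₚ.applyUpTo⁺₁ id n (λ i<j _ → s<s i<j))

  length-range : ∀ n → length (range n) ≡ n
  length-range n = trans (length-map suc (upTo n)) (length-upTo n)

  f-linearExtensions : ∀ lam mu → fromℕ (f lam mu) ≡ linearExtensions (length (skewDiagram lam mu)) (skewDiagram lam mu)
  f-linearExtensions lam mu = begin
    fromℕ (f lam mu)
      ≡⟨ fromℕ-length-filter isStandard? (bijectiveFillings bs) ⟩
    ∑ (bijectiveFillings bs) (λ T → ⟦ isStandard? T ⟧)
      ≡⟨ ∑-map (zip bs) (permutations (range (length bs))) (λ T → ⟦ isStandard? T ⟧) ⟩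
    ∑ (permutations (range (length bs))) (λ π → ⟦ isStandard? (zip bs π) ⟧)
      ≡⟨ ∑-standard (range (length bs)) bs (range-ascending (length bs)) (sym (length-range (length bs))) ⟩
    linearExtensions (length (range (length bs))) bs
      ≡⟨ cong (λ n → linearExtensions n bs) (length-range (length bs)) ⟩
    linearExtensions (length bs) bs ∎
    where
    open ≡-Reasoning
    bs = skewDiagram lam mu

  linearExtensions-suc : ∀ n {bs} → Unique bs → linearExtensions (suc n) bs ≡
    ∑ (filter (λ b → minimal? (remove b bs) b) bs) (λ b → linearExtensions n (remove b bs))
  linearExtensions-suc n {bs} u = begin
    ∑ (picks bs) (λ (b , bs′) → ⟦ minimal? bs′ b ⟧ * linearExtensions n bs′)
      ≡⟨ cong (λ ps → ∑ ps (λ (b , bs′) → ⟦ minimal? bs′ b ⟧ * linearExtensions n bs′)) (picks-remove u) ⟩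
    ∑ (map (λ b → b , remove b bs) bs) (λ (b , bs′) → ⟦ minimal? bs′ b ⟧ * linearExtensions n bs′)
      ≡⟨ ∑-map (λ b → b , remove b bs) bs (λ (b , bs′) → ⟦ minimal? bs′ b ⟧ * linearExtensions n bs′) ⟩
    ∑ bs (λ b → ⟦ minimal? (remove b bs) b ⟧ * linearExtensions n (remove b bs))
      ≡⟨ ∑-filter (λ b → minimal? (remove b bs) b) bs (λ b → linearExtensions n (remove b bs)) ⟨
    ∑ (filter (λ b → minimal? (remove b bs) b) bs) (λ b → linearExtensions n (remove b bs)) ∎
    where open ≡-Reasoning

-- Minimal boxes of λ/μ correspond to the admissible additions of one box to μ.

module BoxAddition where

  open Rationals
  open Residues
  open ContentValues using (shiftBox; firstRow; diagram-∷)
  open LinearExtensions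
  open import Data.List.Base using (List; []; _∷_; map; filter; length)
  open import Data.List.Membership.Propositional using (_∈_; _∉_)
  open import Data.List.Membership.Propositional.Properties
    using (∈-map⁺; ∈-map⁻; ∈-++⁺ˡ; ∈-++⁺ʳ; ∈-++⁻; ∈-filter⁺; ∈-filter⁻; ∈-upTo⁺; ∈-upTo⁻)
  open import Data.List.Membership.Propositional.Properties.WithK using (unique∧set⇒bag)
  import Data.List.Membership.DecPropositional as DecMembership
  open import Data.List.Relation.Binary.BagAndSetEquality using (∼bag⇒↭)
  open import Data.List.Relation.Binary.Permutation.Propositional using (_↭_)
  open import Data.List.Relation.Unary.All as All using (All; []; _∷_)
  open import Data.List.Relation.Unary.Unique.Propositional using (Unique; []; _∷_)
  import Data.List.Relation.Unary.Unique.Propositional.Properties as Uniqueₚ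
  open import Data.Nat.Base using (ℕ; zero; suc; _+_; _<_; _≤_; z≤n; s≤s; z<s)
  open import Data.Nat.ListAction using (sum)
  import Data.Nat.Properties as ℕₚ
  open import Data.Product.Base using (_×_; _,_; proj₁; proj₂; ∃-syntax)
  open import Data.Product.Properties using (≡-dec)
  open import Data.Rational.Base as ℚ using (ℚ)
  import Data.Rational.Properties as ℚₚ
  open import Data.Sum.Base using (_⊎_; inj₁; inj₂; [_,_]′)
  open import Data.Unit.Base using (⊤; tt)
  open import Function.Base using (_∘_)
  open import Function.Bundles using (_⇔_; mk⇔; Equivalence)
  open import Relation.Binary.PropositionalEquality
  open import Relation.Nullary.Decidable using (yes; no; ¬?; _×-dec_)
  open import Relation.Nullary.Negation using (¬_; contradiction)
  open import Relation.Unary using (Decidable)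

  open DecMembership (≡-dec ℕₚ._≟_ ℕₚ._≟_) using (_∈?_)

  -- Membership in the diagram as inequalities. Rows past the last one are excluded because `part`
  -- is 0 there.
  InShape : List ℕ → Box → Set
  InShape mu (i , j) = 0 < i × i < j × j ≤ i + part mu i

  ∈-range⁺ : ∀ {n c} → 0 < c → c ≤ n → c ∈ range n
  ∈-range⁺ {c = suc c} _ c<n = ∈-map⁺ suc (∈-upTo⁺ c<n)

  ∈-range⁻ : ∀ {n c} → c ∈ range n → 0 < c × c ≤ n
  ∈-range⁻ p with ∈-map⁻ suc p
  ... | _ , q , refl = z<s , ∈-upTo⁻ q

  ∈-diagram⁺ : ∀ mu {b} → InShape mu b → b ∈ diagram mu
  ∈-diagram⁺ [] {i , j} (_ , i<j , j≤) = contradiction (ℕₚ.≤-trans j≤ (ℕₚ.≤-reflexive (ℕₚ.+-identityʳ i))) (ℕₚ.<⇒≱ i<j)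
  ∈-diagram⁺ (x ∷ mu) {1 , suc j} (_ , s≤s 0<j , s≤s j≤) =
    subst ((1 , suc j) ∈_) (sym (diagram-∷ x mu)) (∈-++⁺ˡ (∈-map⁺ (λ c → 1 , suc c) (∈-range⁺ 0<j j≤)))
  ∈-diagram⁺ (x ∷ mu) {suc (suc i) , suc j} (_ , s≤s i<j , s≤s j≤) =
    subst ((suc (suc i) , suc j) ∈_) (sym (diagram-∷ x mu))
      (∈-++⁺ʳ (firstRow x) (∈-map⁺ shiftBox (∈-diagram⁺ mu {suc i , j} (z<s , i<j , j≤))))

  ∈-diagram⁻ : ∀ mu {b} → b ∈ diagram mu → InShape mu b
  ∈-diagram⁻ (x ∷ mu) {b} p with ∈-++⁻ (firstRow x) (subst (b ∈_) (diagram-∷ x mu) p)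
  ... | inj₁ q with ∈-map⁻ (λ c → 1 , suc c) q
  ...   | c , c∈ , refl = z<s , s≤s (proj₁ (∈-range⁻ c∈)) , s≤s (proj₂ (∈-range⁻ c∈))
  ∈-diagram⁻ (x ∷ mu) {b} p | inj₂ q with ∈-map⁻ shiftBox q
  ...   | (zero , j) , r , refl = contradiction (proj₁ (∈-diagram⁻ mu r)) (λ ())
  ...   | (suc i , j) , r , refl = let (_ , i<j , j≤) = ∈-diagram⁻ mu r in z<s , s≤s i<j , s≤s j≤

  range-unique : ∀ n → Unique (range n)
  range-unique n = Uniqueₚ.map⁺ ℕₚ.suc-injective (Uniqueₚ.upTo⁺ n)

  diagram-unique : ∀ mu → Unique (diagram mu)
  diagram-unique []       = []
  diagram-unique (x ∷ mu) = subst Unique (sym (diagram-∷ x mu))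
    (Uniqueₚ.++⁺ (Uniqueₚ.map⁺ (λ { refl → refl }) (range-unique x))
                 (Uniqueₚ.map⁺ (λ { refl → refl }) (diagram-unique mu)) disjoint)
    where
    disjoint : ∀ {b} → ¬ (b ∈ firstRow x × b ∈ map shiftBox (diagram mu))
    disjoint (p , q) with ∈-map⁻ (λ c → 1 , suc c) p | ∈-map⁻ shiftBox q
    ... | _ , _ , refl | _ , r , refl = contradiction (proj₁ (∈-diagram⁻ mu r)) (λ ())

  outside? : ∀ mu → Decidable (λ b → b ∉ diagram mu)
  outside? mu b = ¬? (b ∈? diagram mu)

  part-addBox-≡ : ∀ mu {i} → i ≤ length mu → part (addBox mu i) (suc i) ≡ suc (part mu (suc i))
  part-addBox-≡ []       z≤n      = refl
  part-addBox-≡ (x ∷ mu) z≤n      = refl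
  part-addBox-≡ (x ∷ mu) (s≤s i≤) = part-addBox-≡ mu i≤

  part-addBox-≢ : ∀ mu {i} j → i ≤ length mu → j ≢ i → part (addBox mu i) (suc j) ≡ part mu (suc j)
  part-addBox-≢ []       zero    z≤n      j≢i = contradiction refl j≢i
  part-addBox-≢ []       (suc j) z≤n      j≢i = refl
  part-addBox-≢ (x ∷ mu) zero    z≤n      j≢i = contradiction refl j≢i
  part-addBox-≢ (x ∷ mu) (suc j) z≤n      j≢i = refl
  part-addBox-≢ (x ∷ mu) zero    (s≤s i≤) j≢i = refl
  part-addBox-≢ (x ∷ mu) (suc j) (s≤s i≤) j≢i = part-addBox-≢ mu j i≤ (j≢i ∘ cong suc)

  sum-addBox : ∀ mu {i} → i ≤ length mu → sum (addBox mu i) ≡ suc (sum mu)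
  sum-addBox []       z≤n      = refl
  sum-addBox (x ∷ mu) z≤n      = refl
  sum-addBox (x ∷ mu) (s≤s i≤) = trans (cong (x +_) (sum-addBox mu i≤)) (ℕₚ.+-suc x (sum mu))

  addBox-⊇ : ∀ mu {i} → i ≤ length mu → addBox mu i ⊇ mu
  addBox-⊇ []       _        j             = z≤n
  addBox-⊇ (x ∷ mu) z≤n      zero          = z≤n
  addBox-⊇ (x ∷ mu) z≤n      (suc zero)    = ℕₚ.n≤1+n x
  addBox-⊇ (x ∷ mu) z≤n      (suc (suc j)) = ℕₚ.≤-refl
  addBox-⊇ (x ∷ mu) (s≤s i≤) zero          = z≤n
  addBox-⊇ (x ∷ mu) (s≤s i≤) (suc zero)    = ℕₚ.≤-refl
  addBox-⊇ (x ∷ mu) (s≤s i≤) (suc (suc j)) = addBox-⊇ mu i≤ (suc j)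

  addedBox : List ℕ → ℕ → Box
  addedBox mu i = suc i , suc (suc i + part mu (suc i))

  InShape-addBox : ∀ mu {i} → i ≤ length mu → ∀ b → InShape (addBox mu i) b ⇔ (InShape mu b ⊎ b ≡ addedBox mu i)
  InShape-addBox mu {i} i≤ (zero , c)  = mk⇔ (λ { (() , _) }) (λ { (inj₁ (() , _)) ; (inj₂ ()) })
  InShape-addBox mu {i} i≤ (suc r , c) with r ℕₚ.≟ i
  ... | no r≢i rewrite part-addBox-≢ mu r i≤ r≢i = mk⇔ inj₁ (λ { (inj₁ p) → p ; (inj₂ refl) → contradiction refl r≢i })
  ... | yes refl rewrite part-addBox-≡ mu i≤ | ℕₚ.+-suc r (part mu (suc r)) = mk⇔ to from
    where
    end = suc (suc (r + part mu (suc r)))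
    to : 0 < suc r × suc r < c × c ≤ end → InShape mu (suc r , c) ⊎ (suc r , c) ≡ (suc r , end)
    to (_ , r<c , c≤) with ℕₚ.m≤n⇒m<n∨m≡n c≤
    ... | inj₁ (s≤s c<) = inj₁ (z<s , r<c , c<)
    ... | inj₂ refl     = inj₂ refl
    from : InShape mu (suc r , c) ⊎ (suc r , c) ≡ (suc r , end) → 0 < suc r × suc r < c × c ≤ end
    from (inj₁ (_ , r<c , c≤)) = z<s , r<c , ℕₚ.m≤n⇒m≤1+n c≤
    from (inj₂ refl)           = z<s , s≤s (s≤s (ℕₚ.m≤m+n r (part mu (suc r)))) , ℕₚ.≤-refl

  filter-filter : ∀ {A : Set} {P Q R : A → Set} (P? : Decidable P) (Q? : Decidable Q) (R? : Decidable R) →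
    (∀ x → R x ⇔ (P x × Q x)) → ∀ xs → filter Q? (filter P? xs) ≡ filter R? xs
  filter-filter P? Q? R? R⇔ [] = refl
  filter-filter P? Q? R? R⇔ (x ∷ xs) with P? x | R? x
  ... | no ¬p | yes r = contradiction (proj₁ (Equivalence.to (R⇔ x) r)) ¬p
  ... | no ¬p | no ¬r = filter-filter P? Q? R? R⇔ xs
  ... | yes p | r? with Q? x | r?
  ...   | yes q | yes r = cong (x ∷_) (filter-filter P? Q? R? R⇔ xs)
  ...   | yes q | no ¬r = contradiction (Equivalence.from (R⇔ x) (p , q)) ¬r
  ...   | no ¬q | yes r = contradiction (proj₂ (Equivalence.to (R⇔ x) r)) ¬q
  ...   | no ¬q | no ¬r = filter-filter P? Q? R? R⇔ xs

  -- Both sides filter `diagram lam` by equivalent conditions, so they agree as lists, and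
  -- `linearExtensions` can be rewritten directly.
  skewDiagram-addBox : ∀ lam mu {i} → i ≤ length mu →
    remove (addedBox mu i) (skewDiagram lam mu) ≡ skewDiagram lam (addBox mu i)
  skewDiagram-addBox lam mu {i} i≤ =
    filter-filter (outside? mu) (λ b → ¬? (b ≟ᵇ addedBox mu i)) (outside? (addBox mu i))
      (λ b → mk⇔ (to b) (from b)) (diagram lam)
    where
    to : ∀ b → b ∉ diagram (addBox mu i) → b ∉ diagram mu × b ≢ addedBox mu i
    to b b∉ = (λ b∈ → b∉ (grow (inj₁ (∈-diagram⁻ mu b∈)))) , (λ b≡ → b∉ (grow (inj₂ b≡)))
      where
      grow : InShape mu b ⊎ b ≡ addedBox mu i → b ∈ diagram (addBox mu i)
      grow = ∈-diagram⁺ (addBox mu i) ∘ Equivalence.from (InShape-addBox mu i≤ b)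
    from : ∀ b → b ∉ diagram mu × b ≢ addedBox mu i → b ∉ diagram (addBox mu i)
    from b (b∉ , b≢) b∈ = [ b∉ ∘ ∈-diagram⁺ mu , b≢ ]′ (Equivalence.to (InShape-addBox mu i≤ b) (∈-diagram⁻ (addBox mu i) b∈))

  decreasing? : Decidable Decreasing
  decreasing? []       = yes tt
  decreasing? (x ∷ mu) = (part mu 1 ℕₚ.<? x) ×-dec decreasing? mu

  -- The local criterion for a grown row: the row above must be longer by at least two. It is
  -- checked against geometry more easily than `Decreasing`.
  Addable : List ℕ → ℕ → Set
  Addable mu zero    = ⊤
  Addable mu (suc i) = suc (part mu (suc (suc i))) < part mu (suc i)

  addable-length : ∀ mu i → Addable mu i → i ≤ length mu
  addable-length mu       zero          _ = z≤n
  addable-length []       (suc i)       ()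
  addable-length (x ∷ mu) (suc zero)    _ = s≤s z≤n
  addable-length (x ∷ mu) (suc (suc i)) a = s≤s (addable-length mu (suc i) a)

  addable⇒decreasing : ∀ {mu} → Decreasing mu → ∀ i → Addable mu i → Decreasing (addBox mu i)
  addable⇒decreasing {[]}         _       i             _ = z<s , tt
  addable⇒decreasing {x ∷ mu}     (p , d) zero          _ = ℕₚ.m<n⇒m<1+n p , d
  addable⇒decreasing {x ∷ []}     (p , d) (suc zero)    a = a , z<s , tt
  addable⇒decreasing {x ∷ y ∷ mu} (p , d) (suc zero)    a = a , addable⇒decreasing d zero tt
  addable⇒decreasing {x ∷ []}     (p , d) (suc (suc i)) ()
  addable⇒decreasing {x ∷ y ∷ mu} (p , d) (suc (suc i)) a = p , addable⇒decreasing d (suc i) a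

  decreasing⇒addable : ∀ mu i → i ≤ length mu → Decreasing (addBox mu i) → Addable mu i
  decreasing⇒addable mu           zero          _        _       = tt
  decreasing⇒addable (x ∷ [])     (suc zero)    _        (p , _) = p
  decreasing⇒addable (x ∷ [])     (suc (suc i)) (s≤s ()) _
  decreasing⇒addable (x ∷ y ∷ mu) (suc zero)    _        (p , _) = p
  decreasing⇒addable (x ∷ y ∷ mu) (suc (suc i)) (s≤s i≤) (_ , d) = decreasing⇒addable (y ∷ mu) (suc i) i≤ d

  part-step : ∀ {mu} → Decreasing mu → ∀ i → 0 < part mu (suc (suc i)) → part mu (suc (suc i)) < part mu (suc i)
  part-step {[]}     d       i       ()
  part-step {x ∷ mu} (p , d) zero    _   = p
  part-step {x ∷ mu} (p , d) (suc i) 0<  = part-step d i 0<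

  -- Each step down moves the start of a row right by one but shortens it by at least one, so the
  -- right ends of the nonempty rows never advance.
  row-end-mono : ∀ {mu} → Decreasing mu → ∀ {i j} → i ≤ j → 0 < part mu (suc j) → j + part mu (suc j) ≤ i + part mu (suc i)
  row-end-mono {mu} d {i} {j} i≤j 0< with ℕₚ.m≤n⇒m<n∨m≡n i≤j
  ... | inj₂ refl = ℕₚ.≤-refl
  row-end-mono {mu} d {i} {suc j} i≤j 0< | inj₁ (s≤s i≤j′) = begin
    suc j + part mu (suc (suc j))   ≡⟨ ℕₚ.+-suc j (part mu (suc (suc j))) ⟨
    j + suc (part mu (suc (suc j))) ≤⟨ ℕₚ.+-monoʳ-≤ j step ⟩
    j + part mu (suc j)             ≤⟨ row-end-mono d i≤j′ (ℕₚ.≤-<-trans z≤n step) ⟩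
    i + part mu (suc i)             ∎
    where
    open ℕₚ.≤-Reasoning
    step = part-step d j 0<

  module _ {lam mu} (lam↓ : Decreasing lam) (mu↓ : Decreasing mu) (lam⊇mu : lam ⊇ mu) where

    private
      bs = skewDiagram lam mu

    ∈-skew⁺ : ∀ {b} → InShape lam b → ¬ InShape mu b → b ∈ bs
    ∈-skew⁺ p ¬q = ∈-filter⁺ (outside? mu) (∈-diagram⁺ lam p) (¬q ∘ ∈-diagram⁻ mu)

    ∈-skew⁻ : ∀ {b} → b ∈ bs → InShape lam b × ¬ InShape mu b
    ∈-skew⁻ p = let q , r = ∈-filter⁻ (outside? mu) {xs = diagram lam} p in ∈-diagram⁻ lam q , r ∘ ∈-diagram⁺ mu

    skewDiagram-unique : Unique bs
    skewDiagram-unique = Uniqueₚ.filter⁺ (outside? mu) (diagram-unique lam)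

    Extendable : ℕ → Set
    Extendable i = Decreasing (addBox mu i) × lam ⊇ addBox mu i

    extendable? : Decidable Extendable
    extendable? i = decreasing? (addBox mu i) ×-dec (lam ⊇? addBox mu i)

    -- A minimal box has no left or upper neighbour in λ/μ. The left neighbour forces it to follow
    -- the end of its row of μ, the upper one forces the row above to be long enough.
    minimal⇒extendable : ∀ {b} → b ∈ bs → Minimal (remove b bs) b → ∃[ i ] i ≤ length mu × Extendable i × b ≡ addedBox mu i
    minimal⇒extendable {r , c} b∈ min with ∈-skew⁻ b∈
    minimal⇒extendable {suc i , suc c} b∈ min | (_ , s≤s i<c , c≤) , ∉mu =
      i , i≤ , (addable⇒decreasing mu↓ i addable , contains) , cong (suc i ,_) c≡
      where
      end<c : suc i + part mu (suc i) < suc c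
      end<c = ℕₚ.≰⇒> (λ c≤′ → ∉mu (z<s , s≤s i<c , c≤′))
      ¬before : ∀ {b} → InShape lam b → ¬ InShape mu b → ¬ Before b (suc i , suc c)
      ¬before {b} p ¬q before = All.lookup min
        (∈-filter⁺ (λ b′ → ¬? (b′ ≟ᵇ (suc i , suc c))) (∈-skew⁺ p ¬q) (λ { refl → irreflexive before })) before
        where
        irreflexive : ∀ {b} → ¬ Before b b
        irreflexive (inj₁ (_ , <′)) = ℕₚ.<-irrefl refl <′
        irreflexive (inj₂ (_ , <′)) = ℕₚ.<-irrefl refl <′
      -- A gap after the end of the row would put the left neighbour into λ/μ.
      c≡ : suc c ≡ suc (suc i + part mu (suc i))
      c≡ = [ (λ { (s≤s <c) → contradiction (inj₁ (refl , ℕₚ.n<1+n c))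
                    (¬before (z<s , ℕₚ.≤-<-trans (ℕₚ.m≤m+n (suc i) _) <c , ℕₚ.≤-trans (ℕₚ.n≤1+n c) c≤)
                             (λ (_ , _ , c≤′) → ℕₚ.<⇒≱ <c c≤′)) })
           , sym ]′ (ℕₚ.m≤n⇒m<n∨m≡n end<c)
      0<lam : 0 < part lam (suc i)
      0<lam = ℕₚ.+-cancelˡ-< (suc i) 0 (part lam (suc i))
        (ℕₚ.<-≤-trans (subst (_< suc c) (sym (ℕₚ.+-identityʳ (suc i))) (s≤s i<c)) c≤)
      addable′ : ∀ i → suc i < suc c → suc c ≤ suc i + part lam (suc i) → 0 < part lam (suc i) →
                 suc c ≡ suc (suc i + part mu (suc i)) →
                 (∀ {b} → InShape lam b → ¬ InShape mu b → ¬ Before b (suc i , suc c)) → Addable mu i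
      addable′ zero    _   _  _   _  _ = tt
      -- If the row above is too short, the upper neighbour lies outside μ; it lies in λ by
      -- `row-end-mono`, against minimality.
      addable′ (suc i) i<c c≤ 0<lam c≡ ¬before = ℕₚ.≰⇒> λ short →
        ¬before {suc i , suc c}
          (z<s , ℕₚ.<-trans (ℕₚ.n<1+n (suc i)) i<c ,
           ℕₚ.≤-trans c≤ (s≤s (row-end-mono lam↓ (ℕₚ.n≤1+n i) 0<lam)))
          (λ (_ , _ , c≤′) → ℕₚ.<⇒≱ (too-long short) c≤′)
          (inj₂ (refl , ℕₚ.n<1+n (suc i)))
        where
        too-long : part mu (suc i) ≤ suc (part mu (suc (suc i))) → suc i + part mu (suc i) < suc c
        too-long short = begin-strict
          suc i + part mu (suc i)                 ≤⟨ ℕₚ.+-monoʳ-≤ (suc i) short ⟩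
          suc i + suc (part mu (suc (suc i)))     ≡⟨ ℕₚ.+-suc (suc i) _ ⟩
          suc (suc i) + part mu (suc (suc i))     <⟨ ℕₚ.n<1+n _ ⟩
          suc (suc (suc i) + part mu (suc (suc i))) ≡⟨ c≡ ⟨
          suc c                                   ∎
          where open ℕₚ.≤-Reasoning
      addable : Addable mu i
      addable = addable′ i (s≤s i<c) c≤ 0<lam c≡ ¬before
      i≤ = addable-length mu i addable
      contains : lam ⊇ addBox mu i
      contains zero = ℕₚ.≤-trans (ℕₚ.≤-reflexive (part-0 (addBox mu i))) z≤n
      contains (suc j) with j ℕₚ.≟ i
      ... | no j≢i   = subst (_≤ part lam (suc j)) (sym (part-addBox-≢ mu j i≤ j≢i)) (lam⊇mu (suc j))
      ... | yes refl = subst (_≤ part lam (suc j)) (sym (part-addBox-≡ mu i≤))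
        (ℕₚ.+-cancelˡ-≤ (suc j) _ _ (subst (_≤ suc j + part lam (suc j)) (trans c≡ (sym (ℕₚ.+-suc (suc j) _))) c≤))

    -- Boxes of λ to the left in the same row lie in μ because the added box comes just after its
    -- end; those above in the same column lie in μ because the rows above reach that column.
    extendable⇒minimal : ∀ {i} → i ≤ length mu → Extendable i →
      addedBox mu i ∈ bs × Minimal (remove (addedBox mu i) bs) (addedBox mu i)
    extendable⇒minimal {i} i≤ (dec , ⊇add) = ∈-skew⁺ in-lam not-in-mu , All.tabulate minimal
      where
      end = part mu (suc i)
      in-lam : InShape lam (addedBox mu i)
      in-lam = z<s , s≤s (s≤s (ℕₚ.m≤m+n i end)) ,
        subst (_≤ suc i + part lam (suc i)) (ℕₚ.+-suc (suc i) end)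
          (ℕₚ.+-monoʳ-≤ (suc i) (subst (_≤ part lam (suc i)) (part-addBox-≡ mu i≤) (⊇add (suc i))))
      not-in-mu : ¬ InShape mu (addedBox mu i)
      not-in-mu (_ , _ , c≤) = ℕₚ.1+n≰n c≤
      minimal : ∀ {b} → b ∈ remove (addedBox mu i) bs → ¬ Before b (addedBox mu i)
      minimal {b} b∈ before with ∈-skew⁻ (proj₁ (∈-filter⁻ (λ b′ → ¬? (b′ ≟ᵇ addedBox mu i)) {xs = bs} b∈))
      minimal {suc r , c} b∈ (inj₁ (refl , c<)) | (0<r , r<c , _) , ∉mu = ∉mu (0<r , r<c , ℕₚ.≤-pred c<)
      minimal {suc r , c} b∈ (inj₂ (refl , s≤s r<i)) | (0<r , r<c , _) , ∉mu =
        ∉mu (0<r , r<c , above i r<i (decreasing⇒addable mu i i≤ dec))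
        where
        -- The row directly above reaches the column of the added box by addability, and all higher
        -- rows end no earlier.
        above : ∀ i → r < i → Addable mu i → suc (suc i + part mu (suc i)) ≤ suc r + part mu (suc r)
        above (suc i) (s≤s r≤i) add = begin
          suc (suc (suc i) + part mu (suc (suc i))) ≡⟨ cong suc (ℕₚ.+-suc (suc i) _) ⟨
          suc (suc i + suc (part mu (suc (suc i)))) ≡⟨ ℕₚ.+-suc (suc i) _ ⟨
          suc i + suc (suc (part mu (suc (suc i)))) ≤⟨ ℕₚ.+-monoʳ-≤ (suc i) add ⟩
          suc i + part mu (suc i)                   ≤⟨ s≤s (row-end-mono mu↓ r≤i (ℕₚ.≤-<-trans z≤n add)) ⟩
          suc r + part mu (suc r)                   ∎
          where open ℕₚ.≤-Reasoning

    -- Both lists are free of repetitions, so having the same members makes them permutations of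
    -- each other.
    minimal-boxes : filter (λ b → minimal? (remove b bs) b) bs ↭ map (addedBox mu) (filter extendable? (rows mu))
    minimal-boxes = ∼bag⇒↭ (unique∧set⇒bag
      (Uniqueₚ.filter⁺ (λ b → minimal? (remove b bs) b) skewDiagram-unique)
      (Uniqueₚ.map⁺ (λ eq → ℕₚ.suc-injective (cong proj₁ eq)) (Uniqueₚ.filter⁺ extendable? (Uniqueₚ.upTo⁺ (suc (length mu)))))
      (mk⇔ to from))
      where
      to : ∀ {b} → b ∈ filter (λ b → minimal? (remove b bs) b) bs → b ∈ map (addedBox mu) (filter extendable? (rows mu))
      to p with ∈-filter⁻ (λ b → minimal? (remove b bs) b) {xs = bs} p
      ... | b∈ , min with minimal⇒extendable b∈ min
      ...   | i , i≤ , ext , refl = ∈-map⁺ (addedBox mu) (∈-filter⁺ extendable? (∈-upTo⁺ (s≤s i≤)) ext)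
      from : ∀ {b} → b ∈ map (addedBox mu) (filter extendable? (rows mu)) → b ∈ filter (λ b → minimal? (remove b bs) b) bs
      from p with ∈-map⁻ (addedBox mu) p
      ... | i , i∈ , refl with ∈-filter⁻ extendable? {xs = rows mu} i∈
      ...   | i< , ext with extendable⇒minimal (ℕₚ.≤-pred (∈-upTo⁻ i<)) ext
      ...     | b∈ , min = ∈-filter⁺ (λ b → minimal? (remove b bs) b) b∈ min

  sum-mono : ∀ lam mu → lam ⊇ mu → sum mu ≤ sum lam
  sum-mono lam       []       sub = z≤n
  sum-mono []        (y ∷ mu) sub = ℕₚ.+-mono-≤ (sub 1) (sum-mono [] mu ([]⊇-tail sub))
  sum-mono (x ∷ lam) (y ∷ mu) sub = ℕₚ.+-mono-≤ (sub 1) (sum-mono lam mu (⊇-tail sub))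

  -- The last box of a row of λ longer than that of μ would lie in the difference.
  skewDiagram-empty : ∀ lam mu → skewDiagram lam mu ≡ [] → mu ⊇ lam
  skewDiagram-empty lam mu eq zero = ℕₚ.≤-trans (ℕₚ.≤-reflexive (part-0 lam)) z≤n
  skewDiagram-empty lam mu eq (suc i) = ℕₚ.≮⇒≥ λ longer →
    ∉[] (subst (box ∈_) eq (∈-filter⁺ (outside? mu) (∈-diagram⁺ lam (in-lam longer)) (λ b∈ → not-in-mu longer (∈-diagram⁻ mu b∈))))
    where
    box : Box
    box = suc i , suc i + part lam (suc i)
    ∉[] : ¬ box ∈ []
    ∉[] ()
    in-lam : part mu (suc i) < part lam (suc i) → InShape lam box
    in-lam longer = z<s , ℕₚ.m<m+n (suc i) (ℕₚ.≤-<-trans z≤n longer) , ℕₚ.≤-refl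
    not-in-mu : part mu (suc i) < part lam (suc i) → ¬ InShape mu box
    not-in-mu longer (_ , _ , ≤) = ℕₚ.<⇒≱ longer (ℕₚ.+-cancelˡ-≤ (suc i) _ _ ≤)

  -- Removing the smallest entry leaves a tableau on a smaller skew shape. The two conditions stay
  -- separate brackets: the first is independent of λ, and the second will select the extensions of
  -- the enlarged partition.
  f-addBox : ∀ {lam mu} → Decreasing lam → Decreasing mu → lam ⊇ mu → sum mu < sum lam →
    fromℕ (f lam mu) ≡
    ∑ (rows mu) (λ i → ⟦ decreasing? (addBox mu i) ⟧ ℚ.* (⟦ lam ⊇? addBox mu i ⟧ ℚ.* fromℕ (f lam (addBox mu i))))
  f-addBox {lam} {mu} lam↓ mu↓ lam⊇mu mu<lam =
    trans (f-linearExtensions lam mu) (expand (length bs) refl)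
    where
    open ≡-Reasoning
    bs = skewDiagram lam mu
    ok? = extendable? lam↓ mu↓ lam⊇mu
    bs-unique = skewDiagram-unique lam↓ mu↓ lam⊇mu
    removed : ∀ {n i} → length bs ≡ suc n → i ≤ length mu → addedBox mu i ∈ bs →
      length (remove (addedBox mu i) bs) ≡ n
    removed {n} {i} len i≤ b∈ = ℕₚ.suc-injective (trans
      (All.lookup (picks-length bs) (subst ((addedBox mu i , remove (addedBox mu i) bs) ∈_) (sym (picks-remove bs-unique)) (∈-map⁺ (λ b → b , remove b bs) b∈))) len)
    shrink : ∀ {n} → length bs ≡ suc n → ∀ {i} → i ∈ filter ok? (rows mu) →
      linearExtensions n (remove (addedBox mu i) bs) ≡ fromℕ (f lam (addBox mu i))
    shrink {n} len {i} i∈ =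
      trans (cong₂ linearExtensions
              (sym (trans (cong length (sym (skewDiagram-addBox lam mu i≤))) (removed len i≤ b∈)))
              (skewDiagram-addBox lam mu i≤))
            (sym (f-linearExtensions lam (addBox mu i)))
      where
      i<×ext = ∈-filter⁻ ok? {xs = rows mu} i∈
      i≤ = ℕₚ.≤-pred (∈-upTo⁻ (proj₁ i<×ext))
      b∈ = proj₁ (extendable⇒minimal lam↓ mu↓ lam⊇mu i≤ (proj₂ i<×ext))
    expand : ∀ n → length bs ≡ n → linearExtensions n bs ≡
      ∑ (rows mu) (λ i → ⟦ decreasing? (addBox mu i) ⟧ ℚ.* (⟦ lam ⊇? addBox mu i ⟧ ℚ.* fromℕ (f lam (addBox mu i))))
    expand zero    len = contradiction (sum-mono mu lam (skewDiagram-empty lam mu (empty len))) (ℕₚ.<⇒≱ mu<lam)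
      where
      empty : ∀ {A : Set} {xs : List A} → length xs ≡ 0 → xs ≡ []
      empty {xs = []} _ = refl
    expand (suc n) len = begin
      linearExtensions (suc n) bs
        ≡⟨ linearExtensions-suc n bs-unique ⟩
      ∑ (filter (λ b → minimal? (remove b bs) b) bs) (λ b → linearExtensions n (remove b bs))
        ≡⟨ ∑-↭ (λ b → linearExtensions n (remove b bs)) (minimal-boxes lam↓ mu↓ lam⊇mu) ⟩
      ∑ (map (addedBox mu) (filter ok? (rows mu))) (λ b → linearExtensions n (remove b bs))
        ≡⟨ ∑-map (addedBox mu) (filter ok? (rows mu)) (λ b → linearExtensions n (remove b bs)) ⟩
      ∑ (filter ok? (rows mu)) (λ i → linearExtensions n (remove (addedBox mu i) bs))
        ≡⟨ ∑-cong-∈ (filter ok? (rows mu)) (shrink len) ⟩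
      ∑ (filter ok? (rows mu)) (λ i → fromℕ (f lam (addBox mu i)))
        ≡⟨ ∑-filter ok? (rows mu) (λ i → fromℕ (f lam (addBox mu i))) ⟩
      ∑ (rows mu) (λ i → ⟦ ok? i ⟧ ℚ.* fromℕ (f lam (addBox mu i)))
        ≡⟨ ∑-cong (rows mu) (λ i → trans
             (cong (ℚ._* fromℕ (f lam (addBox mu i))) (⟦⟧-× (decreasing? (addBox mu i)) (lam ⊇? addBox mu i)))
             (ℚₚ.*-assoc ⟦ decreasing? (addBox mu i) ⟧ ⟦ lam ⊇? addBox mu i ⟧ (fromℕ (f lam (addBox mu i))))) ⟩
      ∑ (rows mu) (λ i → ⟦ decreasing? (addBox mu i) ⟧ ℚ.* (⟦ lam ⊇? addBox mu i ⟧ ℚ.* fromℕ (f lam (addBox mu i)))) ∎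

-- The hook product, one row at a time.

module Hooks where

  open Residues using (Decreasing)
  open ContentValues using (shiftBox; firstRow; diagram-∷; range-suc; range-∷ʳ)
  open BoxAddition using (∈-diagram⁻; ∈-range⁻; row-end-mono)
  open import Data.List.Base using (List; []; _∷_; map; filter; length; _++_)
  open import Data.List.Membership.Propositional using (_∈_)
  open import Data.List.Properties using (map-∘; map-++; map-cong-local; filter-++; length-++; filter-none)
  open import Data.List.Relation.Unary.All as All using (All; []; _∷_)
  open import Data.List.Relation.Unary.Any using (here; there)
  open import Data.Nat.Base using (ℕ; zero; suc; _+_; _*_; _∸_; _<_; _≤_; z≤n; s≤s)
  open import Data.Nat.ListAction using (product)
  open import Data.Nat.ListAction.Properties using (product-++)
  open import Data.Nat.Properties
  open import Data.Nat.Tactic.RingSolver using (solve-∀)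
  open import Data.Product.Base using (_,_; proj₁; proj₂)
  open import Data.Sum.Base using (inj₁; inj₂)
  open import Function.Base using (_∘_)
  open import Function.Bundles using (_⇔_; mk⇔; Equivalence)
  open import Relation.Binary.PropositionalEquality
  open import Relation.Nullary.Decidable using (yes; no; _×-dec_)
  open import Relation.Nullary.Negation using (¬_; contradiction)
  open import Relation.Unary using (Decidable)

  count : ∀ {A : Set} {P : A → Set} → Decidable P → List A → ℕ
  count P? xs = length (filter P? xs)

  count-++ : ∀ {A : Set} {P : A → Set} (P? : Decidable P) xs ys → count P? (xs ++ ys) ≡ count P? xs + count P? ys
  count-++ P? xs ys = trans (cong length (filter-++ P? xs ys)) (length-++ (filter P? xs))

  count-map : ∀ {A B : Set} {P : B → Set} (P? : Decidable P) (g : A → B) xs → count P? (map g xs) ≡ count (P? ∘ g) xs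
  count-map P? g []       = refl
  count-map P? g (x ∷ xs) with P? (g x)
  ... | yes _ = cong suc (count-map P? g xs)
  ... | no _  = count-map P? g xs

  count-cong : ∀ {A : Set} {P Q : A → Set} (P? : Decidable P) (Q? : Decidable Q) xs →
    (∀ {x} → x ∈ xs → P x ⇔ Q x) → count P? xs ≡ count Q? xs
  count-cong P? Q? []       eq = refl
  count-cong P? Q? (x ∷ xs) eq with P? x | Q? x
  ... | yes _ | yes _ = cong suc (count-cong P? Q? xs (eq ∘ there))
  ... | no _  | no _  = count-cong P? Q? xs (eq ∘ there)
  ... | yes p | no ¬q = contradiction (Equivalence.to (eq (here refl)) p) ¬q
  ... | no ¬p | yes q = contradiction (Equivalence.from (eq (here refl)) q) ¬p

  count-none : ∀ {A : Set} {P : A → Set} (P? : Decidable P) xs → (∀ {x} → x ∈ xs → ¬ P x) → count P? xs ≡ 0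
  count-none P? xs ¬P = cong length (filter-none P? (All.tabulate ¬P))

  count-diagram-∷ : ∀ {P : Box → Set} (P? : Decidable P) x mu →
    count P? (diagram (x ∷ mu)) ≡ count (λ c → P? (1 , suc c)) (range x) + count (P? ∘ shiftBox) (diagram mu)
  count-diagram-∷ P? x mu = trans (cong (count P?) (diagram-∷ x mu))
    (trans (count-++ P? (firstRow x) (map shiftBox (diagram mu)))
           (cong₂ _+_ (count-map P? (λ c → 1 , suc c) (range x)) (count-map P? shiftBox (diagram mu))))

  count-range-suc : ∀ {P : ℕ → Set} (P? : Decidable P) n → count P? (range (suc n)) ≡ count P? (range n) + count P? (suc n ∷ [])
  count-range-suc P? n = trans (cong (count P?) (range-∷ʳ n)) (count-++ P? (range n) (suc n ∷ []))

  count-yes : ∀ {A : Set} {P : A → Set} (P? : Decidable P) x → P x → count P? (x ∷ []) ≡ 1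
  count-yes P? x p with P? x
  ... | yes _ = refl
  ... | no ¬p = contradiction p ¬p

  count-> : ∀ c n → count (λ c′ → c <? c′) (range n) ≡ n ∸ c
  count-> c zero    = sym (0∸n≡0 c)
  count-> c (suc n) with c ≤? n
  ... | yes c≤n = trans (count-range-suc (c <?_) n)
    (trans (cong₂ _+_ (count-> c n) (count-yes (c <?_) (suc n) (s≤s c≤n)))
           (trans (+-comm (n ∸ c) 1) (sym (+-∸-assoc 1 c≤n))))
  ... | no c≰n = trans (count-none (c <?_) (range (suc n)) (λ c′∈ c<c′ → c≰n (≤-pred (≤-trans c<c′ (proj₂ (∈-range⁻ c′∈))))))
                       (sym (m≤n⇒m∸n≡0 (≰⇒> c≰n)))

  count-≡ : ∀ {c n} → 0 < c → c ≤ n → count (λ c′ → c′ ≟ c) (range n) ≡ 1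
  count-≡ {suc c} {zero}  _ ()
  count-≡ {c}     {suc n} 0<c c≤ with m≤n⇒m<n∨m≡n c≤
  ... | inj₁ (s≤s c≤n) = trans (count-range-suc (_≟ c) n)
    (trans (cong₂ _+_ (count-≡ 0<c c≤n) (count-none (_≟ c) (suc n ∷ []) (λ { (here refl) refl → 1+n≰n c≤n }))) refl)
  ... | inj₂ refl = trans (count-range-suc (_≟ c) n)
    (cong₂ _+_ (count-none (_≟ c) (range n) (λ c∈ c′≡c → 1+n≰n (≤-trans (≤-reflexive (sym c′≡c)) (proj₂ (∈-range⁻ c∈)))))
               (count-yes (_≟ c) (suc n) refl))

  -- A new first row is neither right of nor below the old boxes, and in the term `part lam (col b)`
  -- the shift of the columns cancels the shift of the rows.
  hook-shift : ∀ x mu {b} → b ∈ diagram mu → hook (x ∷ mu) (shiftBox b) ≡ hook mu b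
  hook-shift x mu {i , suc j} b∈ = cong suc (cong (_+ part mu (suc j)) (cong₂ _+_ arm leg))
    where
    0<i = proj₁ (∈-diagram⁻ mu b∈)
    arm : count (λ b′ → (row b′ ≟ suc i) ×-dec (suc (suc j) <? col b′)) (diagram (x ∷ mu)) ≡
          count (λ b′ → (row b′ ≟ i) ×-dec (suc j <? col b′)) (diagram mu)
    arm = trans (count-diagram-∷ (λ b′ → (row b′ ≟ suc i) ×-dec (suc (suc j) <? col b′)) x mu) (cong₂ _+_
      (count-none _ (range x) (λ { _ (refl , _) → contradiction 0<i (λ ()) }))
      (count-cong _ _ (diagram mu) (λ _ → mk⇔ (λ (p , q) → suc-injective p , ≤-pred q) (λ (p , q) → cong suc p , s≤s q))))
    leg : count (λ b′ → (col b′ ≟ suc (suc j)) ×-dec (suc i <? row b′)) (diagram (x ∷ mu)) ≡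
          count (λ b′ → (col b′ ≟ suc j) ×-dec (i <? row b′)) (diagram mu)
    leg = trans (count-diagram-∷ (λ b′ → (col b′ ≟ suc (suc j)) ×-dec (suc i <? row b′)) x mu) (cong₂ _+_
      (count-none _ (range x) (λ { _ (_ , s≤s ()) }))
      (count-cong _ _ (diagram mu) (λ _ → mk⇔ (λ (p , q) → suc-injective p , ≤-pred q) (λ (p , q) → cong suc p , s≤s q))))
  hook-shift x mu {i , zero} b∈ = contradiction (proj₁ (proj₂ (∈-diagram⁻ mu b∈))) (λ ())

  columnLength : List ℕ → ℕ → ℕ
  columnLength mu c = count (λ b → col b ≟ c) (diagram mu)

  -- What the rows of mu contribute to the hook of (1 , 1 + c) once mu is placed
  -- below a first row.
  below : List ℕ → ℕ → ℕ
  below mu c = columnLength mu c + part mu c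

  hook-firstRow : ∀ x mu {c} → 0 < c → hook (x ∷ mu) (1 , suc c) ≡ suc (x ∸ c + below mu c)
  hook-firstRow x mu {suc c} _ = cong suc (trans
    (cong (_+ part mu (suc c)) (cong₂ _+_ arm leg))
    (+-assoc (x ∸ suc c) (columnLength mu (suc c)) (part mu (suc c))))
    where
    arm : count (λ b′ → (row b′ ≟ 1) ×-dec (suc (suc c) <? col b′)) (diagram (x ∷ mu)) ≡ x ∸ suc c
    arm = trans (count-diagram-∷ (λ b′ → (row b′ ≟ 1) ×-dec (suc (suc c) <? col b′)) x mu)
      (trans (cong₂ _+_
        (trans (count-cong _ (suc c <?_) (range x) (λ _ → mk⇔ (≤-pred ∘ proj₂) (λ q → refl , s≤s q))) (count-> (suc c) x))
        (count-none _ (diagram mu) (λ { b∈ (refl , _) → contradiction (proj₁ (∈-diagram⁻ mu b∈)) (λ ()) })))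
      (+-identityʳ (x ∸ suc c)))
    leg : count (λ b′ → (col b′ ≟ suc (suc c)) ×-dec (1 <? row b′)) (diagram (x ∷ mu)) ≡ columnLength mu (suc c)
    leg = trans (count-diagram-∷ (λ b′ → (col b′ ≟ suc (suc c)) ×-dec (1 <? row b′)) x mu) (cong₂ _+_
      (count-none _ (range x) (λ { _ (_ , s≤s ()) }))
      (count-cong _ (λ b → col b ≟ suc c) (diagram mu)
        (λ b∈ → mk⇔ (suc-injective ∘ proj₁) (λ p → cong suc p , s≤s (proj₁ (∈-diagram⁻ mu b∈))))))

  columnLength-1 : ∀ mu → columnLength mu 1 ≡ 0
  columnLength-1 mu = count-none (λ b → col b ≟ 1) (diagram mu)
    (λ b∈ → λ { refl → let (0<i , i<1 , _) = ∈-diagram⁻ mu b∈ in <⇒≱ i<1 0<i })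

  columnLength-suc : ∀ y mu c → columnLength (y ∷ mu) (suc c) ≡ count (_≟ c) (range y) + columnLength mu c
  columnLength-suc y mu c = trans (count-diagram-∷ (λ b → col b ≟ suc c) y mu) (cong₂ _+_
    (count-cong _ (_≟ c) (range y) (λ _ → mk⇔ suc-injective (cong suc)))
    (count-cong _ (λ b → col b ≟ c) (diagram mu) (λ _ → mk⇔ suc-injective (cong suc))))

  below-1 : ∀ y mu → below (y ∷ mu) 1 ≡ y
  below-1 y mu = cong (_+ y) (columnLength-1 (y ∷ mu))

  -- Within reach of the row y the column gains exactly one box, while the term from `part` only
  -- changes its index.
  below-suc : ∀ y mu {c} → 0 < c → c ≤ y → below (y ∷ mu) (suc c) ≡ suc (below mu c)
  below-suc y mu {suc c} 0<c c≤y = cong (_+ part mu (suc c))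
    (trans (columnLength-suc y mu (suc c)) (cong (_+ columnLength mu (suc c)) (count-≡ 0<c c≤y)))

  -- Row ends of mu do not exceed column y, which excludes both a box in column c and a nonempty row
  -- of index c.
  below-far : ∀ {y mu} → Decreasing (y ∷ mu) → ∀ {c} → y < c → below mu c ≡ 0
  below-far {y} {mu} (p , d) {suc c} (s≤s y≤c) = cong₂ _+_
    (count-none (λ b → col b ≟ suc c) (diagram mu) short) (n≤0⇒n≡0 (≮⇒≥ few))
    where
    short : ∀ {b} → b ∈ diagram mu → ¬ col b ≡ suc c
    short {suc i , j} b∈ refl = let (_ , i<j , j≤) = ∈-diagram⁻ mu b∈ in
      <⇒≱ (≤-<-trans (≤-pred (≤-trans j≤ (s≤s (row-end-mono d z≤n
        (+-cancelˡ-< (suc i) 0 (part mu (suc i)) (<-≤-trans (subst (_< suc c) (sym (+-identityʳ (suc i))) i<j) j≤)))))) p) y≤c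
    short {zero , j} b∈ refl = contradiction (proj₁ (∈-diagram⁻ mu b∈)) (λ ())
    few : ¬ 0 < part mu (suc c)
    few 0<p = <⇒≱ (≤-<-trans (≤-trans (m≤m+n c (part mu (suc c))) (row-end-mono d z≤n 0<p)) p) y≤c

  below-suc-far : ∀ {y mu} → Decreasing (y ∷ mu) → ∀ {c} → y < c → below (y ∷ mu) (suc c) ≡ 0
  below-suc-far {y} {mu} d {suc c} y<c = trans (cong (_+ part mu (suc c))
    (trans (columnLength-suc y mu (suc c)) (cong (_+ columnLength mu (suc c))
      (count-none (_≟ suc c) (range y) (λ c∈ c≡ → <⇒≱ y<c (≤-trans (≤-reflexive (sym c≡)) (proj₂ (∈-range⁻ c∈))))))))
    (below-far d y<c)

  ∏ : ℕ → (ℕ → ℕ) → ℕ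
  ∏ n φ = product (map φ (range n))

  ∏-cong : ∀ n {φ ψ : ℕ → ℕ} → (∀ {c} → 0 < c → c ≤ n → φ c ≡ ψ c) → ∏ n φ ≡ ∏ n ψ
  ∏-cong n eq = cong product (map-cong-local {xs = range n} (All.tabulate λ c∈ → let 0<c , c≤n = ∈-range⁻ c∈ in eq 0<c c≤n))

  ∏-suc : ∀ n φ → ∏ (suc n) φ ≡ φ 1 * ∏ n (φ ∘ suc)
  ∏-suc n φ = trans (cong (product ∘ map φ) (range-suc n)) (cong (λ xs → φ 1 * product xs) (sym (map-∘ (range n))))

  ∏-+ : ∀ m n φ → ∏ (m + n) φ ≡ ∏ m φ * ∏ n (λ c → φ (m + c))
  ∏-+ zero    n φ = sym (+-identityʳ (∏ n φ))
  ∏-+ (suc m) n φ = begin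
    ∏ (suc (m + n)) φ                                          ≡⟨ ∏-suc (m + n) φ ⟩
    φ 1 * ∏ (m + n) (φ ∘ suc)                                  ≡⟨ cong (φ 1 *_) (∏-+ m n (φ ∘ suc)) ⟩
    φ 1 * (∏ m (φ ∘ suc) * ∏ n (λ c → φ (suc m + c)))          ≡⟨ *-assoc (φ 1) (∏ m (φ ∘ suc)) _ ⟨
    φ 1 * ∏ m (φ ∘ suc) * ∏ n (λ c → φ (suc m + c))            ≡⟨ cong (_* ∏ n (λ c → φ (suc m + c))) (∏-suc m φ) ⟨
    ∏ (suc m) φ * ∏ n (λ c → φ (suc m + c))                    ∎
    where open ≡-Reasoning

  -- For decreasing x ∷ mu this is x! times the product of (x + μⱼ) / (x - μⱼ), by `rowHooks-[]` and
  -- `rowHooks-∷`.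
  rowHooks : ℕ → List ℕ → ℕ
  rowHooks x mu = ∏ x (λ c → suc (x ∸ c + below mu c))

  H-∷ : ∀ x mu → H (x ∷ mu) ≡ rowHooks x mu * H mu
  H-∷ x mu = begin
    product (map (hook (x ∷ mu)) (diagram (x ∷ mu)))
      ≡⟨ cong (product ∘ map (hook (x ∷ mu))) (diagram-∷ x mu) ⟩
    product (map (hook (x ∷ mu)) (firstRow x ++ map shiftBox (diagram mu)))
      ≡⟨ cong product (map-++ (hook (x ∷ mu)) (firstRow x) _) ⟩
    product (map (hook (x ∷ mu)) (firstRow x) ++ map (hook (x ∷ mu)) (map shiftBox (diagram mu)))
      ≡⟨ product-++ (map (hook (x ∷ mu)) (firstRow x)) _ ⟩
    product (map (hook (x ∷ mu)) (firstRow x)) * product (map (hook (x ∷ mu)) (map shiftBox (diagram mu)))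
      ≡⟨ cong₂ (λ as bs → product as * product bs)
           (trans (sym (map-∘ (range x))) (map-cong-local (All.tabulate λ c∈ → hook-firstRow x mu (proj₁ (∈-range⁻ c∈)))))
           (trans (sym (map-∘ (diagram mu))) (map-cong-local (All.tabulate (hook-shift x mu)))) ⟩
    rowHooks x mu * H mu ∎
    where open ≡-Reasoning

  -- With the row y present, the first hook is x + y. The hooks at c = 2, ..., y + 1 equal those at
  -- c - 1 without it, a longer leg making up for a shorter arm. Beyond them only arms are left,
  -- giving d! instead of (d + 1)!, and d + 1 = x - y.
  rowHooks-∷ : ∀ y d {mu} → Decreasing (y ∷ mu) → let x = suc (y + d) in
    rowHooks x (y ∷ mu) * suc d ≡ (x + y) * rowHooks x mu
  rowHooks-∷ y d {mu} dec = begin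
    rowHooks x (y ∷ mu) * suc d      ≡⟨ cong (_* suc d) top ⟩
    (x + y) * (A * T) * suc d        ≡⟨ rearrange (x + y) A T (suc d) ⟩
    (x + y) * (A * (suc d * T))      ≡⟨ cong ((x + y) *_) bottom ⟨
    (x + y) * rowHooks x mu          ∎
    where
    open ≡-Reasoning
    x = suc (y + d)
    A = ∏ y (λ c → suc (x ∸ c + below mu c))
    T = ∏ d (λ c → suc (d ∸ c))
    rearrange : ∀ s a t e → s * (a * t) * e ≡ s * (a * (e * t))
    rearrange = solve-∀
    top : rowHooks x (y ∷ mu) ≡ (x + y) * (A * T)
    top = begin
      rowHooks x (y ∷ mu)
        ≡⟨ ∏-suc (y + d) (λ c → suc (x ∸ c + below (y ∷ mu) c)) ⟩
      suc (y + d + below (y ∷ mu) 1) * ∏ (y + d) (λ c → suc (y + d ∸ c + below (y ∷ mu) (suc c)))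
        ≡⟨ cong₂ _*_ (cong (λ b → suc (y + d + b)) (below-1 y mu))
             (∏-+ y d (λ c → suc (y + d ∸ c + below (y ∷ mu) (suc c)))) ⟩
      (x + y) * (∏ y (λ c → suc (y + d ∸ c + below (y ∷ mu) (suc c))) *
                 ∏ d (λ c → suc (y + d ∸ (y + c) + below (y ∷ mu) (suc (y + c)))))
        ≡⟨ cong ((x + y) *_) (cong₂ _*_ (∏-cong y near) (∏-cong d far)) ⟩
      (x + y) * (A * T) ∎
      where
      near : ∀ {c} → 0 < c → c ≤ y → suc (y + d ∸ c + below (y ∷ mu) (suc c)) ≡ suc (x ∸ c + below mu c)
      near {c} 0<c c≤y = cong suc (begin
        y + d ∸ c + below (y ∷ mu) (suc c)   ≡⟨ cong (y + d ∸ c +_) (below-suc y mu 0<c c≤y) ⟩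
        y + d ∸ c + suc (below mu c)         ≡⟨ +-suc (y + d ∸ c) (below mu c) ⟩
        suc (y + d ∸ c) + below mu c         ≡⟨ cong (_+ below mu c) (+-∸-assoc 1 (≤-trans c≤y (m≤m+n y d))) ⟨
        x ∸ c + below mu c                   ∎)
      far : ∀ {c} → 0 < c → c ≤ d → suc (y + d ∸ (y + c) + below (y ∷ mu) (suc (y + c))) ≡ suc (d ∸ c)
      far {c} 0<c c≤d = cong suc (trans
        (cong₂ _+_ ([m+n]∸[m+o]≡n∸o y d c) (below-suc-far dec (m<m+n y 0<c))) (+-identityʳ (d ∸ c)))
    bottom : rowHooks x mu ≡ A * (suc d * T)
    bottom = begin
      rowHooks x mu
        ≡⟨ cong (λ n → ∏ n (λ c → suc (x ∸ c + below mu c))) (sym (+-suc y d)) ⟩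
      ∏ (y + suc d) (λ c → suc (x ∸ c + below mu c))
        ≡⟨ ∏-+ y (suc d) (λ c → suc (x ∸ c + below mu c)) ⟩
      A * ∏ (suc d) (λ c → suc (x ∸ (y + c) + below mu (y + c)))
        ≡⟨ cong (A *_) (trans (∏-cong (suc d) far) (∏-suc d (λ c → suc (suc d ∸ c)))) ⟩
      A * (suc d * T) ∎
      where
      far : ∀ {c} → 0 < c → c ≤ suc d → suc (x ∸ (y + c) + below mu (y + c)) ≡ suc (suc d ∸ c)
      far {c} 0<c c≤d = cong suc (trans
        (cong₂ _+_ (trans (cong (_∸ (y + c)) (sym (+-suc y d))) ([m+n]∸[m+o]≡n∸o y (suc d) c)) (below-far dec (m<m+n y 0<c)))
        (+-identityʳ (suc d ∸ c)))

  rowHooks-[] : ∀ x → rowHooks (suc x) [] ≡ suc x * rowHooks x []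
  rowHooks-[] x = trans (∏-suc x (λ c → suc (suc x ∸ c + below [] c)))
    (cong₂ _*_ (cong suc (+-identityʳ x)) (∏-cong x λ {c} _ _ → cong (λ b → suc (x ∸ c + b)) (below-[] c)))
    where
    below-[] : ∀ c → below [] (suc c) ≡ below [] c
    below-[] c = refl

-- Quotients of hook products as residues.

module Densities where

  open Rationals
  open Residues
  open Hooks using (rowHooks; H-∷; rowHooks-∷; rowHooks-[])
  open import Data.List.Base using (List; []; _∷_; length)
  open import Data.List.Relation.Unary.All using (All; []; _∷_)
  open import Data.Nat.Base as ℕ using (ℕ; zero; suc; pred; z≤n)
  open import Data.Nat.ListAction using (sum)
  import Data.Nat.Properties as ℕₚ
  import Data.Nat.Tactic.RingSolver as ℕ-Solver
  open import Data.Product.Base using (_,_; proj₁; proj₂)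
  open import Data.Rational.Base hiding (NonZero)
  open import Data.Rational.Properties
  open import Function.Base using (_∘_)
  open import Relation.Binary.PropositionalEquality
  open import Tactic.RingSolver using (solve-∀)

  rowHooksℚ : ℕ → List ℕ → ℚ
  rowHooksℚ x mu = fromℕ (rowHooks x mu)

  fromℕ-∸ : ∀ {m n d} → m ≡ n ℕ.+ d → fromℕ d ≡ fromℕ m - fromℕ n
  fromℕ-∸ {n = n} {d} refl = trans (expand (fromℕ n) (fromℕ d)) (cong (_- fromℕ n) (sym (fromℕ-+ n d)))
    where
    expand : ∀ n d → d ≡ (n + d) - n
    expand = solve-∀ ring

  rowHooksℚ-∷ : ∀ {x y mu} → Decreasing (x ∷ y ∷ mu) →
    rowHooksℚ x (y ∷ mu) * (fromℕ x - fromℕ y) ≡ (fromℕ x + fromℕ y) * rowHooksℚ x mu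
  rowHooksℚ-∷ {x} {y} {mu} (y<x , dec) = helper (x ℕ.∸ suc y) (sym (ℕₚ.m+[n∸m]≡n y<x))
    where
    helper : ∀ d {x} → x ≡ suc y ℕ.+ d → rowHooksℚ x (y ∷ mu) * (fromℕ x - fromℕ y) ≡ (fromℕ x + fromℕ y) * rowHooksℚ x mu
    helper d {x} refl = begin
      rowHooksℚ x (y ∷ mu) * (fromℕ x - fromℕ y)      ≡⟨ cong (rowHooksℚ x (y ∷ mu) *_) (fromℕ-∸ {x} {y} {suc d} (sym (ℕₚ.+-suc y d))) ⟨
      rowHooksℚ x (y ∷ mu) * fromℕ (suc d)            ≡⟨ fromℕ-* (rowHooks x (y ∷ mu)) (suc d) ⟨
      fromℕ (rowHooks x (y ∷ mu) ℕ.* suc d)           ≡⟨ cong fromℕ (rowHooks-∷ y d dec) ⟩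
      fromℕ ((x ℕ.+ y) ℕ.* rowHooks x mu)             ≡⟨ fromℕ-* (x ℕ.+ y) (rowHooks x mu) ⟩
      fromℕ (x ℕ.+ y) * rowHooksℚ x mu                ≡⟨ cong (_* rowHooksℚ x mu) (fromℕ-+ x y) ⟩
      (fromℕ x + fromℕ y) * rowHooksℚ x mu            ∎
      where open ≡-Reasoning

  drop-second : ∀ {x y mu} → Decreasing (x ∷ y ∷ mu) → Decreasing (x ∷ mu)
  drop-second (y<x , p , d) = ℕₚ.<-trans p y<x , d

  -- When a lower row grows from M to M + 1, only its factor (X + M) / (X - M) changes, becoming (X
  -- + M + 1) / (X - M - 1). The case of a new row is M = 0.
  rowHooksℚ-addBox : ∀ {x mu} → Decreasing (x ∷ mu) → ∀ i → Decreasing (x ∷ addBox mu i) →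
    let X = fromℕ x ; M = fromℕ (part mu (suc i)) in
    rowHooksℚ x (addBox mu i) * ((X + M) * (X - M - 1ℚ)) ≡ rowHooksℚ x mu * ((X - M) * (X + M + 1ℚ))
  rowHooksℚ-addBox {x} {[]} dec i dec′ = begin
    a * ((X + 0ℚ) * (X - 0ℚ - 1ℚ))        ≡⟨ left a X ⟩
    a * (X - 1ℚ) * X                      ≡⟨ cong (_* X) (rowHooksℚ-∷ {x} {1} {[]} dec′) ⟩
    (X + 1ℚ) * b * X                      ≡⟨ right b X ⟩
    b * ((X - 0ℚ) * (X + 0ℚ + 1ℚ))        ∎
    where
    open ≡-Reasoning
    X = fromℕ x
    a = rowHooksℚ x (1 ∷ [])
    b = rowHooksℚ x []
    left : ∀ a X → a * ((X + 0ℚ) * (X - 0ℚ - 1ℚ)) ≡ a * (X - 1ℚ) * X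
    left = solve-∀ ring
    right : ∀ b X → (X + 1ℚ) * b * X ≡ b * ((X - 0ℚ) * (X + 0ℚ + 1ℚ))
    right = solve-∀ ring
  rowHooksℚ-addBox {x} {y ∷ mu} dec zero dec′ = begin
    a * ((X + Y) * (X - Y - 1ℚ))          ≡⟨ left a X Y ⟩
    a * (X - (Y + 1ℚ)) * (X + Y)          ≡⟨ cong (λ s → a * (X - s) * (X + Y)) (fromℕ-suc y) ⟨
    a * (X - fromℕ (suc y)) * (X + Y)     ≡⟨ cong (_* (X + Y)) (rowHooksℚ-∷ {x} {suc y} {mu} dec′) ⟩
    (X + fromℕ (suc y)) * c * (X + Y)     ≡⟨ cong (λ s → (X + s) * c * (X + Y)) (fromℕ-suc y) ⟩
    (X + (Y + 1ℚ)) * c * (X + Y)          ≡⟨ middle c X Y ⟩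
    ((X + Y) * c) * (X + Y + 1ℚ)          ≡⟨ cong (_* (X + Y + 1ℚ)) (rowHooksℚ-∷ {x} {y} {mu} dec) ⟨
    b * (X - Y) * (X + Y + 1ℚ)            ≡⟨ *-assoc b (X - Y) (X + Y + 1ℚ) ⟩
    b * ((X - Y) * (X + Y + 1ℚ))          ∎
    where
    open ≡-Reasoning
    X = fromℕ x
    Y = fromℕ y
    a = rowHooksℚ x (suc y ∷ mu)
    b = rowHooksℚ x (y ∷ mu)
    c = rowHooksℚ x mu
    left : ∀ a X Y → a * ((X + Y) * (X - Y - 1ℚ)) ≡ a * (X - (Y + 1ℚ)) * (X + Y)
    left = solve-∀ ring
    middle : ∀ c X Y → (X + (Y + 1ℚ)) * c * (X + Y) ≡ ((X + Y) * c) * (X + Y + 1ℚ)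
    middle = solve-∀ ring
  -- The untouched row y contributes the same factor to both sides and is cancelled.
  rowHooksℚ-addBox {x} {y ∷ mu} dec (suc i) dec′ = *-cancelˡ (fromℕ-difference-≢0 (ℕₚ.<⇒≢ (proj₁ dec) ∘ sym)) (begin
    (X - Y) * (a * s)                     ≡⟨ regroup (X - Y) a s ⟩
    (a * (X - Y)) * s                     ≡⟨ cong (_* s) (rowHooksℚ-∷ {x} {y} {addBox mu i} dec′) ⟩
    ((X + Y) * a₀) * s                    ≡⟨ *-assoc (X + Y) a₀ s ⟩
    (X + Y) * (a₀ * s)                    ≡⟨ cong ((X + Y) *_) (rowHooksℚ-addBox {x} {mu} (drop-second {x} {y} dec) i (drop-second {x} {y} dec′)) ⟩
    (X + Y) * (b₀ * t)                    ≡⟨ *-assoc (X + Y) b₀ t ⟨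
    ((X + Y) * b₀) * t                    ≡⟨ cong (_* t) (rowHooksℚ-∷ {x} {y} {mu} dec) ⟨
    (b * (X - Y)) * t                     ≡⟨ regroup (X - Y) b t ⟨
    (X - Y) * (b * t)                     ∎)
    where
    open ≡-Reasoning
    X = fromℕ x
    Y = fromℕ y
    M = fromℕ (part mu (suc i))
    s = (X + M) * (X - M - 1ℚ)
    t = (X - M) * (X + M + 1ℚ)
    a = rowHooksℚ x (y ∷ addBox mu i)
    b = rowHooksℚ x (y ∷ mu)
    a₀ = rowHooksℚ x (addBox mu i)
    b₀ = rowHooksℚ x mu
    regroup : ∀ d a s → d * (a * s) ≡ (a * d) * s
    regroup = solve-∀ ring

  2ℚ≢0 : 2ℚ ≢ 0ℚ
  2ℚ≢0 ()

  -- Raising x turns each (x + y) / (x - y) into (x + 1 + y) / (x + 1 - y), and the quotient is a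
  -- factor of the resolvent by the factorisations of `c₂`. The 2 comes from the pole at 0: the
  -- value `c₂ (suc x)` there is half of (x + 1) x.
  rowHooksℚ-suc : ∀ {x mu} → Decreasing (x ∷ mu) →
    2ℚ * rowHooksℚ x mu ≡ rowHooksℚ (suc x) mu * (fromℕ x * resolvent mu (c₂ (suc x)))
  rowHooksℚ-suc {x} {[]} dec = *-cancelˡ c≢0 (begin
    c * (2ℚ * r)                       ≡⟨ left c r ⟩
    (c + c) * r                        ≡⟨ cong (_* r) 2c ⟩
    (X + 1ℚ) * X * r                   ≡⟨ middle X r (c * inv c) (*-inv c≢0) ⟩
    (X + 1ℚ) * r * X * (c * inv c)     ≡⟨ cong (λ s → s * r * X * (c * inv c)) (fromℕ-suc x) ⟨
    fromℕ (suc x) * r * X * (c * inv c) ≡⟨ cong (λ s → s * X * (c * inv c)) (trans (cong fromℕ (rowHooks-[] x)) (fromℕ-* (suc x) (rowHooks x []))) ⟨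
    r′ * X * (c * inv c)               ≡⟨ right c (inv c) r′ X ⟩
    c * (r′ * (X * inv c))             ∎)
    where
    open ≡-Reasoning
    X = fromℕ x
    c = c₂ (suc x)
    r = rowHooksℚ x []
    r′ = rowHooksℚ (suc x) []
    2c : c + c ≡ (X + 1ℚ) * X
    2c = trans (c₂-double (suc x)) (trans (cong (λ s → s * (s - 1ℚ)) (fromℕ-suc x)) (simplify X))
      where
      simplify : ∀ X → (X + 1ℚ) * (X + 1ℚ - 1ℚ) ≡ (X + 1ℚ) * X
      simplify = solve-∀ ring
    c≢0 : c ≢ 0ℚ
    c≢0 c≡0 = *-≢0 {X + 1ℚ} {X}
      (λ eq → fromℕ-≢0 {suc x} (λ ()) (trans (fromℕ-suc x) eq))
      (fromℕ-≢0 (ℕₚ.<⇒≢ (proj₁ dec) ∘ sym))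
      (trans (sym 2c) (cong (λ t → t + t) c≡0))
    left : ∀ c r → c * (2ℚ * r) ≡ (c + c) * r
    left = solve-∀ ring
    middle : ∀ X r i → i ≡ 1ℚ → (X + 1ℚ) * X * r ≡ (X + 1ℚ) * r * X * i
    middle X r i eq = trans (swap X r) (trans (sym (*-identityʳ ((X + 1ℚ) * r * X))) (cong ((X + 1ℚ) * r * X *_) (sym eq)))
      where
      swap : ∀ X r → (X + 1ℚ) * X * r ≡ (X + 1ℚ) * r * X
      swap = solve-∀ ring
    right : ∀ c i r X → r * X * (c * i) ≡ c * (r * (X * i))
    right = solve-∀ ring
  rowHooksℚ-suc {x} {y ∷ mu} dec = *-cancelˡ D≢0 (begin
    2ℚ * D * (2ℚ * r)                                       ≡⟨ cong (_* (2ℚ * r)) (2*[c₂-c₂]′ x y) ⟩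
    (X - Y) * (X + 1ℚ + Y) * (2ℚ * r)                       ≡⟨ shuffle₁ X Y r ⟩
    2ℚ * (X + 1ℚ + Y) * (r * (X - Y))                       ≡⟨ cong (2ℚ * (X + 1ℚ + Y) *_) (rowHooksℚ-∷ {x} {y} {mu} dec) ⟩
    2ℚ * (X + 1ℚ + Y) * ((X + Y) * r₀)                      ≡⟨ shuffle₂ X Y r₀ ⟩
    (X + 1ℚ + Y) * (X + Y) * (2ℚ * r₀)                      ≡⟨ cong ((X + 1ℚ + Y) * (X + Y) *_) (rowHooksℚ-suc {x} {mu} (drop-second {x} {y} dec)) ⟩
    (X + 1ℚ + Y) * (X + Y) * (r₀′ * (X * q))                ≡⟨ shuffle₃ X Y r₀′ q ⟩
    ((X + 1ℚ + Y) * r₀′) * (X + Y) * (X * q)                ≡⟨ cong (λ s → (s + Y) * r₀′ * (X + Y) * (X * q)) (fromℕ-suc x) ⟨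
    ((fromℕ (suc x) + Y) * r₀′) * (X + Y) * (X * q)         ≡⟨ cong (λ s → s * (X + Y) * (X * q)) (rowHooksℚ-∷ {suc x} {y} {mu} (ℕₚ.m<n⇒m<1+n (proj₁ dec) , proj₂ dec)) ⟨
    (r′ * (fromℕ (suc x) - Y)) * (X + Y) * (X * q)          ≡⟨ cong (λ s → (r′ * (s - Y)) * (X + Y) * (X * q)) (fromℕ-suc x) ⟩
    (r′ * (X + 1ℚ - Y)) * (X + Y) * (X * q)                 ≡⟨ shuffle₄ X Y r′ q ⟩
    r′ * (X * q) * ((X + Y) * (X + 1ℚ - Y))                 ≡⟨ cong (r′ * (X * q) *_) (2*[c₂-c₂] x y) ⟨
    r′ * (X * q) * (2ℚ * N)                                 ≡⟨ *-identityʳ (r′ * (X * q) * (2ℚ * N)) ⟨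
    r′ * (X * q) * (2ℚ * N) * 1ℚ                            ≡⟨ cong (r′ * (X * q) * (2ℚ * N) *_) (*-inv D≢0′) ⟨
    r′ * (X * q) * (2ℚ * N) * (D * inv D)                   ≡⟨ shuffle₅ r′ X q N D (inv D) ⟩
    2ℚ * D * (r′ * (X * (N * inv D * q)))                   ∎)
    where
    open ≡-Reasoning
    X = fromℕ x
    Y = fromℕ y
    D = c₂ (suc x) - c₂ (suc y)
    N = c₂ (suc x) - c₂ y
    q = resolvent mu (c₂ (suc x))
    r = rowHooksℚ x (y ∷ mu)
    r′ = rowHooksℚ (suc x) (y ∷ mu)
    r₀ = rowHooksℚ x mu
    r₀′ = rowHooksℚ (suc x) mu
    D≢0′ : D ≢ 0ℚ
    D≢0′ = x-y≢0 (λ eq → c₂-injective eq (ℕₚ.<⇒≢ (proj₁ dec) ∘ sym))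
    D≢0 : 2ℚ * D ≢ 0ℚ
    D≢0 = *-≢0 {2ℚ} {D} 2ℚ≢0 D≢0′
    shuffle₁ : ∀ X Y r → (X - Y) * (X + 1ℚ + Y) * (2ℚ * r) ≡ 2ℚ * (X + 1ℚ + Y) * (r * (X - Y))
    shuffle₁ = solve-∀ ring
    shuffle₂ : ∀ X Y r → 2ℚ * (X + 1ℚ + Y) * ((X + Y) * r) ≡ (X + 1ℚ + Y) * (X + Y) * (2ℚ * r)
    shuffle₂ = solve-∀ ring
    shuffle₃ : ∀ X Y r q → (X + 1ℚ + Y) * (X + Y) * (r * (X * q)) ≡ ((X + 1ℚ + Y) * r) * (X + Y) * (X * q)
    shuffle₃ = solve-∀ ring
    shuffle₄ : ∀ X Y r q → (r * (X + 1ℚ - Y)) * (X + Y) * (X * q) ≡ r * (X * q) * ((X + Y) * (X + 1ℚ - Y))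
    shuffle₄ = solve-∀ ring
    shuffle₅ : ∀ r X q N D i → r * (X * q) * (2ℚ * N) * (D * i) ≡ 2ℚ * D * (r * (X * (N * i * q)))
    shuffle₅ = solve-∀ ring

  -- The quotient in `rowHooksℚ-addBox`, with its four linear factors gathered into two differences
  -- of `c₂`; the factors 2 cancel.
  rowHooksℚ-ratio : ∀ {x mu} → Decreasing (x ∷ mu) → ∀ i → Decreasing (x ∷ addBox mu i) →
    rowHooksℚ x mu ≡ ratio x (newValue mu i) * rowHooksℚ x (addBox mu i)
  rowHooksℚ-ratio {x} {mu} dec i dec′ = *-cancelˡ 2D≢0 (begin
    2ℚ * D * r                                 ≡⟨ cong (_* r) (2*[c₂-c₂]′ m x) ⟩
    (M - X) * (M + 1ℚ + X) * r                 ≡⟨ shuffle₁ M X r ⟩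
    - (r * ((X - M) * (X + M + 1ℚ)))           ≡⟨ cong -_ (rowHooksℚ-addBox dec i dec′) ⟨
    - (r′ * ((X + M) * (X - M - 1ℚ)))          ≡⟨ shuffle₂ M X r′ ⟩
    (M + X) * (M + 1ℚ - X) * r′                ≡⟨ cong (_* r′) (2*[c₂-c₂] m x) ⟨
    2ℚ * N * r′                                ≡⟨ *-identityʳ (2ℚ * N * r′) ⟨
    2ℚ * N * r′ * 1ℚ                           ≡⟨ cong (2ℚ * N * r′ *_) (*-inv D≢0) ⟨
    2ℚ * N * r′ * (D * inv D)                  ≡⟨ shuffle₃ N r′ D (inv D) ⟩
    2ℚ * D * (N * inv D * r′)                  ∎)
    where
    open ≡-Reasoning
    m = part mu (suc i)
    M = fromℕ m
    X = fromℕ x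
    D = newValue mu i - c₂ (suc x)
    N = newValue mu i - c₂ x
    r = rowHooksℚ x mu
    r′ = rowHooksℚ x (addBox mu i)
    D≢0 : D ≢ 0ℚ
    D≢0 = x-y≢0 (newValue-distinct dec i)
    2D≢0 : 2ℚ * D ≢ 0ℚ
    2D≢0 = *-≢0 {2ℚ} {D} 2ℚ≢0 D≢0
    shuffle₁ : ∀ M X r → (M - X) * (M + 1ℚ + X) * r ≡ - (r * ((X - M) * (X + M + 1ℚ)))
    shuffle₁ = solve-∀ ring
    shuffle₂ : ∀ M X r → - (r * ((X + M) * (X - M - 1ℚ))) ≡ (M + X) * (M + 1ℚ - X) * r
    shuffle₂ = solve-∀ ring
    shuffle₃ : ∀ N r D i → 2ℚ * N * r * (D * i) ≡ 2ℚ * D * (N * i * r)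
    shuffle₃ = solve-∀ ring

  -- |mu| - ℓ(mu) when all parts are positive.
  excess : List ℕ → ℕ
  excess []       = 0
  excess (x ∷ mu) = pred x ℕ.+ excess mu

  twoPower : List ℕ → ℚ
  twoPower mu = fromℕ (2 ℕ.^ excess mu)

  twoPower-∷ : ∀ x mu → twoPower (x ∷ mu) ≡ fromℕ (2 ℕ.^ pred x) * twoPower mu
  twoPower-∷ x mu = trans (cong fromℕ (ℕₚ.^-distribˡ-+-* 2 (pred x) (excess mu)))
                          (fromℕ-* (2 ℕ.^ pred x) (2 ℕ.^ excess mu))

  Hℚ : List ℕ → ℚ
  Hℚ mu = fromℕ (H mu)

  Hℚ-∷ : ∀ x mu → Hℚ (x ∷ mu) ≡ rowHooksℚ x mu * Hℚ mu
  Hℚ-∷ x mu = trans (cong fromℕ (H-∷ x mu)) (fromℕ-* (rowHooks x mu) (H mu))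

  -- Induction down to the growing row: every row above it contributes a `ratio`, and the row itself
  -- its residue together with one more power of 2. A new row has length 1 and brings no power of 2,
  -- matching the residue 1 of the empty partition.
  residue-hooks : ∀ {mu} → Decreasing mu → ∀ i → Decreasing (addBox mu i) →
    twoPower (addBox mu i) * Hℚ mu ≡ residue mu i * twoPower mu * Hℚ (addBox mu i)
  residue-hooks {[]}     _         i       _         = refl
  residue-hooks {zero ∷ mu} (() , _)
  residue-hooks {suc x ∷ mu} dec   zero    _         = begin
    twoPower (suc (suc x) ∷ mu) * Hℚ (suc x ∷ mu)
      ≡⟨ cong₂ _*_ (trans (twoPower-∷ (suc (suc x)) mu) (cong (_* k) (fromℕ-* 2 (2 ℕ.^ x)))) (Hℚ-∷ (suc x) mu) ⟩
    2ℚ * t * k * (r * h)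
      ≡⟨ shuffle₁ t k r h ⟩
    t * k * h * (2ℚ * r)
      ≡⟨ cong (t * k * h *_) (rowHooksℚ-suc {suc x} {mu} dec) ⟩
    t * k * h * (r′ * (fromℕ (suc x) * q))
      ≡⟨ cong (λ s → t * k * h * (r′ * (s * q))) difference ⟩
    t * k * h * (r′ * ((c₂ (suc (suc x)) - c₂ (suc x)) * q))
      ≡⟨ shuffle₂ t k h r′ ((c₂ (suc (suc x)) - c₂ (suc x)) * q) ⟩
    (c₂ (suc (suc x)) - c₂ (suc x)) * q * (t * k) * (r′ * h)
      ≡⟨ cong₂ (λ a b → (c₂ (suc (suc x)) - c₂ (suc x)) * q * a * b) (twoPower-∷ (suc x) mu) (Hℚ-∷ (suc (suc x)) mu) ⟨
    residue (suc x ∷ mu) 0 * twoPower (suc x ∷ mu) * Hℚ (suc (suc x) ∷ mu) ∎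
    where
    open ≡-Reasoning
    t = fromℕ (2 ℕ.^ x)
    k = twoPower mu
    r = rowHooksℚ (suc x) mu
    r′ = rowHooksℚ (suc (suc x)) mu
    h = Hℚ mu
    q = resolvent mu (c₂ (suc (suc x)))
    cancel : ∀ a b → b ≡ (a + b) - a
    cancel = solve-∀ ring
    difference : fromℕ (suc x) ≡ c₂ (suc (suc x)) - c₂ (suc x)
    difference = trans (cancel (c₂ (suc x)) (fromℕ (suc x))) (cong (_- c₂ (suc x)) (sym (c₂-suc (suc x))))
    shuffle₁ : ∀ t k r h → 2ℚ * t * k * (r * h) ≡ t * k * h * (2ℚ * r)
    shuffle₁ = solve-∀ ring
    shuffle₂ : ∀ t k h r w → t * k * h * (r * w) ≡ w * (t * k) * (r * h)
    shuffle₂ = solve-∀ ring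
  residue-hooks {x ∷ mu} dec       (suc i) dec′      = begin
    twoPower (x ∷ addBox mu i) * Hℚ (x ∷ mu)
      ≡⟨ cong₂ _*_ (twoPower-∷ x (addBox mu i)) (Hℚ-∷ x mu) ⟩
    t * k′ * (r * h)
      ≡⟨ cong (λ s → t * k′ * (s * h)) (rowHooksℚ-ratio dec i dec′) ⟩
    t * k′ * (w * r′ * h)
      ≡⟨ shuffle₁ t k′ w r′ h ⟩
    t * w * r′ * (k′ * h)
      ≡⟨ cong (t * w * r′ *_) (residue-hooks {mu} (proj₂ dec) i (proj₂ dec′)) ⟩
    t * w * r′ * (residue mu i * k * h′)
      ≡⟨ shuffle₂ t w r′ (residue mu i) k h′ ⟩
    w * residue mu i * (t * k) * (r′ * h′)
      ≡⟨ cong₂ (λ a b → w * residue mu i * a * b) (twoPower-∷ x mu) (Hℚ-∷ x (addBox mu i)) ⟨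
    residue (x ∷ mu) (suc i) * twoPower (x ∷ mu) * Hℚ (x ∷ addBox mu i) ∎
    where
    open ≡-Reasoning
    t = fromℕ (2 ℕ.^ pred x)
    k = twoPower mu
    k′ = twoPower (addBox mu i)
    r = rowHooksℚ x mu
    r′ = rowHooksℚ x (addBox mu i)
    h = Hℚ mu
    h′ = Hℚ (addBox mu i)
    w = ratio x (newValue mu i)
    shuffle₁ : ∀ t k w r h → t * k * (w * r * h) ≡ t * w * r * (k * h)
    shuffle₁ = solve-∀ ring
    shuffle₂ : ∀ t w r s k h → t * w * r * (s * k * h) ≡ w * s * (t * k) * (r * h)
    shuffle₂ = solve-∀ ring

  -- The factor of weight lam mu that depends only on lam, up to f lam mu.
  density : List ℕ → ℚ
  density mu = twoPower mu * inv (Hℚ mu)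

  Hℚ-≢0 : ∀ mu → Hℚ mu ≢ 0ℚ
  Hℚ-≢0 mu = fromℕ-≢0 (ℕ.≢-nonZero⁻¹ (H mu) ⦃ H-nonZero mu ⦄)

  density-addBox : ∀ {mu} → Decreasing mu → ∀ i → Decreasing (addBox mu i) →
    density (addBox mu i) ≡ density mu * residue mu i
  density-addBox {mu} dec i dec′ = begin
    k′ * inv h′                              ≡⟨ *-identityʳ (k′ * inv h′) ⟨
    k′ * inv h′ * 1ℚ                         ≡⟨ cong (k′ * inv h′ *_) (*-inv (Hℚ-≢0 mu)) ⟨
    k′ * inv h′ * (h * inv h)                ≡⟨ shuffle₁ k′ (inv h′) h (inv h) ⟩
    k′ * h * (inv h′ * inv h)                ≡⟨ cong (_* (inv h′ * inv h)) (residue-hooks dec i dec′) ⟩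
    w * k * h′ * (inv h′ * inv h)            ≡⟨ shuffle₂ w k h′ (inv h′) (inv h) ⟩
    k * inv h * w * (h′ * inv h′)            ≡⟨ cong (k * inv h * w *_) (*-inv (Hℚ-≢0 (addBox mu i))) ⟩
    k * inv h * w * 1ℚ                       ≡⟨ *-identityʳ (k * inv h * w) ⟩
    k * inv h * w                            ∎
    where
    open ≡-Reasoning
    k = twoPower mu
    k′ = twoPower (addBox mu i)
    h = Hℚ mu
    h′ = Hℚ (addBox mu i)
    w = residue mu i
    shuffle₁ : ∀ k i h j → k * i * (h * j) ≡ k * h * (i * j)
    shuffle₁ = solve-∀ ring
    shuffle₂ : ∀ w k h i j → w * k * h * (i * j) ≡ k * j * w * (h * i)
    shuffle₂ = solve-∀ ring

  sum-excess : ∀ {mu} → All (0 ℕ.<_) mu → sum mu ≡ excess mu ℕ.+ length mu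
  sum-excess []                          = refl
  sum-excess {suc x ∷ mu} (_ ∷ ps) = trans (cong (suc x ℕ.+_) (sum-excess ps)) (rearrange x (excess mu) (length mu))
    where
    rearrange : ∀ x e l → suc x ℕ.+ (e ℕ.+ l) ≡ (x ℕ.+ e) ℕ.+ suc l
    rearrange = ℕ-Solver.solve-∀

  excess-mono : ∀ lam mu → lam ⊇ mu → excess mu ℕ.≤ excess lam
  excess-mono lam       []       sub = z≤n
  excess-mono []        (y ∷ mu) sub = ℕₚ.+-mono-≤ (ℕₚ.pred-mono-≤ (sub 1)) (excess-mono [] mu ([]⊇-tail sub))
  excess-mono (x ∷ lam) (y ∷ mu) sub = ℕₚ.+-mono-≤ (ℕₚ.pred-mono-≤ (sub 1)) (excess-mono lam mu (⊇-tail sub))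

  -- Multiplying by the constant `twoPower mu` completes the exponent of 2 to the full excess of λ.
  -- Containment gives `excess mu` at most `excess lam`, so no subtraction truncates.
  weight-density : ∀ {lam mu} → All (0 ℕ.<_) lam → All (0 ℕ.<_) mu → lam ⊇ mu →
    twoPower mu * weight lam mu ≡ density lam * fromℕ (f lam mu)
  weight-density {lam} {mu} lam>0 mu>0 lam⊇mu = begin
    twoPower mu * weight lam mu
      ≡⟨ cong (twoPower mu *_) (/-fromℕ (2 ℕ.^ e ℕ.* f lam mu) (H lam) ⦃ H-nonZero lam ⦄) ⟩
    twoPower mu * (fromℕ (2 ℕ.^ e ℕ.* f lam mu) * inv (Hℚ lam))
      ≡⟨ cong (λ s → twoPower mu * (s * inv (Hℚ lam))) (fromℕ-* (2 ℕ.^ e) (f lam mu)) ⟩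
    twoPower mu * (fromℕ (2 ℕ.^ e) * fromℕ (f lam mu) * inv (Hℚ lam))
      ≡⟨ shuffle (twoPower mu) (fromℕ (2 ℕ.^ e)) (fromℕ (f lam mu)) (inv (Hℚ lam)) ⟩
    twoPower mu * fromℕ (2 ℕ.^ e) * inv (Hℚ lam) * fromℕ (f lam mu)
      ≡⟨ cong (λ s → s * inv (Hℚ lam) * fromℕ (f lam mu)) powers ⟩
    twoPower lam * inv (Hℚ lam) * fromℕ (f lam mu) ∎
    where
    open ≡-Reasoning
    e = (sum lam ℕ.+ length mu) ℕ.∸ (sum mu ℕ.+ length lam)
    shuffle : ∀ a b c d → a * (b * c * d) ≡ a * b * d * c
    shuffle = solve-∀ ring
    rearrange : ∀ a b c → (a ℕ.+ b) ℕ.+ c ≡ (b ℕ.+ c) ℕ.+ a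
    rearrange = ℕ-Solver.solve-∀
    rearrange′ : ∀ a b c → (a ℕ.+ b) ℕ.+ c ≡ (c ℕ.+ b) ℕ.+ a
    rearrange′ = ℕ-Solver.solve-∀
    exponent : e ≡ excess lam ℕ.∸ excess mu
    exponent = trans (cong₂ ℕ._∸_
        (trans (cong (ℕ._+ length mu) (sum-excess lam>0)) (rearrange (excess lam) (length lam) (length mu)))
        (trans (cong (ℕ._+ length lam) (sum-excess mu>0)) (rearrange′ (excess mu) (length mu) (length lam))))
      (ℕₚ.[m+n]∸[m+o]≡n∸o (length lam ℕ.+ length mu) (excess lam) (excess mu))
    powers : twoPower mu * fromℕ (2 ℕ.^ e) ≡ twoPower lam
    powers = trans (sym (fromℕ-* (2 ℕ.^ excess mu) (2 ℕ.^ e))) (cong fromℕ (trans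
      (sym (ℕₚ.^-distribˡ-+-* 2 (excess mu) e))
      (cong (2 ℕ.^_) (trans (cong (excess mu ℕ.+_) exponent) (ℕₚ.m+[n∸m]≡n (excess-mono lam mu lam⊇mu))))))

open Rationals
open Residues
open ContentValues using (contentValues)
open Filtration
open LinearExtensions
open BoxAddition
open Densities
open import Data.List.Base using (List; []; _∷_; map; filter; length)
open import Data.List.Membership.Propositional using (_∈_)
open import Data.List.Membership.Propositional.Properties using (∈-upTo⁻)
open import Data.List.Properties using (filter-none)
open import Data.List.Relation.Unary.All as All using (All; []; _∷_)
open import Data.List.Relation.Unary.AllPairs using ([]; _∷_)
open import Data.List.Relation.Unary.Any using (here; there)
open import Data.List.Relation.Unary.Unique.Propositional using (Unique)
open import Data.Nat.Base as ℕ using (ℕ; zero; suc)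
open import Data.Nat.ListAction using (sum)
import Data.Nat.Properties as ℕₚ
open import Data.Product.Base using (_×_; _,_; proj₂; ∃-syntax)
open import Data.Rational.Base hiding (NonZero)
open import Data.Rational.Properties
open import Data.Sum.Base using (inj₁; inj₂)
open import Function.Base using (_∘_)
open import Function.Bundles using (mk⇔; Equivalence)
open import Relation.Binary.PropositionalEquality
open import Relation.Nullary.Decidable using (Dec; yes; no; _×-dec_)
open import Relation.Nullary.Negation using (¬_; contradiction)
open import Tactic.RingSolver using (solve-∀)

-- Weighted sums over extensions as iterates of the averaging operator.

weighted : (List ℕ → ℚ) → ℕ → List ℕ → ℚ
weighted g n mu = ∑ (extensions mu n) (λ lam → density lam * fromℕ (f lam mu) * g lam)

∈-extensions⁻ : ∀ mu n {lam} → lam ∈ extensions mu n → IsStrict lam × sum lam ≡ sum mu ℕ.+ n × lam ⊇ mu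
∈-extensions⁻ mu n = Equivalence.to (∈-extensions⇔ mu n)

extensions-addBox : ∀ mu n {i} → i ℕ.≤ length mu →
  filter (λ lam → lam ⊇? addBox mu i) (extensions mu (suc n)) ≡ extensions (addBox mu i) n
extensions-addBox mu n {i} i≤ = trans
  (filter-filter (λ lam → (sum lam ℕₚ.≟ sum mu ℕ.+ suc n) ×-dec (lam ⊇? mu)) (λ lam → lam ⊇? addBox mu i)
    (λ lam → (sum lam ℕₚ.≟ sum (addBox mu i) ℕ.+ n) ×-dec (lam ⊇? addBox mu i))
    (λ lam → mk⇔ (λ (size , sub) → (trans size (sym size≡) , λ j → ℕₚ.≤-trans (addBox-⊇ mu i≤ j) (sub j)) , sub)
                 (λ ((size , _) , sub) → trans size size≡ , sub))
    (strictUpTo (sum mu ℕ.+ suc n)))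
  (cong (λ N → filter (λ lam → (sum lam ℕₚ.≟ sum (addBox mu i) ℕ.+ n) ×-dec (lam ⊇? addBox mu i)) (strictUpTo N)) size≡)
  where
  size≡ : sum mu ℕ.+ suc n ≡ sum (addBox mu i) ℕ.+ n
  size≡ = trans (ℕₚ.+-suc (sum mu) n) (cong (ℕ._+ n) (sym (sum-addBox mu i≤)))

-- The first box added to μ is split off from every tableau. After exchanging sums, the bracket of
-- containment narrows the outer extensions to those of the enlarged partition.
weighted-suc : ∀ g n {mu} → Decreasing mu →
  weighted g (suc n) mu ≡ ∑ (rows mu) (λ i → ⟦ decreasing? (addBox mu i) ⟧ * weighted g n (addBox mu i))
weighted-suc g n {mu} dec = begin
  ∑ exts (λ lam → density lam * fromℕ (f lam mu) * g lam)
    ≡⟨ ∑-cong-∈ exts (λ {lam} lam∈ → expand lam (∈-extensions⁻ mu (suc n) lam∈)) ⟩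
  ∑ exts (λ lam → ∑ (rows mu) (λ i → ⟦ d i ⟧ * (⟦ lam ⊇? addBox mu i ⟧ * v i lam)))
    ≡⟨ ∑-swap exts (rows mu) (λ lam i → ⟦ d i ⟧ * (⟦ lam ⊇? addBox mu i ⟧ * v i lam)) ⟩
  ∑ (rows mu) (λ i → ∑ exts (λ lam → ⟦ d i ⟧ * (⟦ lam ⊇? addBox mu i ⟧ * v i lam)))
    ≡⟨ ∑-cong-∈ (rows mu) (λ {i} i∈ → trans
         (∑-*ˡ exts ⟦ d i ⟧ (λ lam → ⟦ lam ⊇? addBox mu i ⟧ * v i lam))
         (cong (⟦ d i ⟧ *_) (trans (sym (∑-filter (λ lam → lam ⊇? addBox mu i) exts (v i)))
                                   (cong (λ es → ∑ es (v i)) (extensions-addBox mu n (ℕₚ.≤-pred (∈-upTo⁻ i∈))))))) ⟩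
  ∑ (rows mu) (λ i → ⟦ d i ⟧ * weighted g n (addBox mu i)) ∎
  where
  open ≡-Reasoning
  exts = extensions mu (suc n)
  d : ∀ i → Dec (Decreasing (addBox mu i))
  d i = decreasing? (addBox mu i)
  v : ℕ → List ℕ → ℚ
  v i lam = density lam * fromℕ (f lam (addBox mu i)) * g lam
  distribute : ∀ a b k h x → (k * h) * (a * (b * x)) ≡ a * (b * (k * x * h))
  distribute = solve-∀ ring
  exchange : ∀ k x h → k * x * h ≡ (k * h) * x
  exchange = solve-∀ ring
  expand : ∀ lam → IsStrict lam × sum lam ≡ sum mu ℕ.+ suc n × lam ⊇ mu →
    density lam * fromℕ (f lam mu) * g lam ≡ ∑ (rows mu) (λ i → ⟦ d i ⟧ * (⟦ lam ⊇? addBox mu i ⟧ * v i lam))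
  expand lam (strict , size , sub) = begin
    density lam * fromℕ (f lam mu) * g lam
      ≡⟨ exchange (density lam) (fromℕ (f lam mu)) (g lam) ⟩
    density lam * g lam * fromℕ (f lam mu)
      ≡⟨ cong (density lam * g lam *_) (f-addBox (strict⇒decreasing strict) dec sub
           (subst (sum mu ℕ.<_) (sym size) (ℕₚ.m<m+n (sum mu) ℕ.z<s))) ⟩
    density lam * g lam * ∑ (rows mu) (λ i → ⟦ d i ⟧ * (⟦ lam ⊇? addBox mu i ⟧ * fromℕ (f lam (addBox mu i))))
      ≡⟨ ∑-*ˡ (rows mu) (density lam * g lam) (λ i → ⟦ d i ⟧ * (⟦ lam ⊇? addBox mu i ⟧ * fromℕ (f lam (addBox mu i)))) ⟨
    ∑ (rows mu) (λ i → density lam * g lam * (⟦ d i ⟧ * (⟦ lam ⊇? addBox mu i ⟧ * fromℕ (f lam (addBox mu i)))))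
      ≡⟨ ∑-cong (rows mu) (λ i → distribute ⟦ d i ⟧ ⟦ lam ⊇? addBox mu i ⟧ (density lam) (g lam) (fromℕ (f lam (addBox mu i)))) ⟩
    ∑ (rows mu) (λ i → ⟦ d i ⟧ * (⟦ lam ⊇? addBox mu i ⟧ * v i lam)) ∎

⊇-sum-≡ : ∀ {lam mu} → All (0 ℕ.<_) lam → All (0 ℕ.<_) mu → lam ⊇ mu → sum lam ≡ sum mu → lam ≡ mu
⊇-sum-≡ []       []       sub eq = refl
⊇-sum-≡ []       (p ∷ _)  sub eq = contradiction (sub 1) (ℕₚ.<⇒≱ p)
⊇-sum-≡ (p ∷ _)  []       sub eq = contradiction (ℕₚ.m+n≡0⇒m≡0 _ eq) (ℕₚ.<⇒≢ p ∘ sym)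
⊇-sum-≡ {x ∷ lam} {y ∷ mu} (_ ∷ ps) (_ ∷ qs) sub eq with ℕₚ.m≤n⇒m<n∨m≡n (sub 1)
... | inj₂ refl = cong (x ∷_) (⊇-sum-≡ ps qs (⊇-tail sub) (ℕₚ.+-cancelˡ-≡ x (sum lam) (sum mu) eq))
... | inj₁ y<x  = contradiction (sym eq) (ℕₚ.<⇒≢ (ℕₚ.+-mono-<-≤ y<x (sum-mono lam mu (⊇-tail sub))))

unique-singleton : ∀ {A : Set} {a : A} {xs} → Unique xs → (∀ {x} → x ∈ xs → x ≡ a) → a ∈ xs → xs ≡ a ∷ []
unique-singleton {xs = x ∷ []}     _                ≡a _ = cong (_∷ []) (≡a (here refl))
unique-singleton {xs = x ∷ y ∷ xs} ((x≢y ∷ _) ∷ _) ≡a _ =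
  contradiction (trans (≡a (here refl)) (sym (≡a (there (here refl))))) x≢y

extensions-0 : ∀ {mu} → IsStrict mu → extensions mu 0 ≡ mu ∷ []
extensions-0 {mu} strict = unique-singleton (extensions-unique mu 0)
  (λ lam∈ → let (_ , lam>0) , size , sub = ∈-extensions⁻ mu 0 lam∈ in
    ⊇-sum-≡ lam>0 (proj₂ strict) sub (trans size (ℕₚ.+-identityʳ (sum mu))))
  (Equivalence.from (∈-extensions⇔ mu 0) (strict , sym (ℕₚ.+-identityʳ (sum mu)) , λ _ → ℕₚ.≤-refl))

f-self : ∀ mu → fromℕ (f mu mu) ≡ 1ℚ
f-self mu = trans (f-linearExtensions mu mu) (cong (λ bs → linearExtensions (length bs) bs)
  (filter-none (outside? mu) {diagram mu} (All.tabulate (λ b∈ b∉ → b∉ b∈))))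

weighted-0 : ∀ g {mu} → Decreasing mu → weighted g 0 mu ≡ density mu * g mu
weighted-0 g {mu} dec = begin
  ∑ (extensions mu 0) (λ lam → density lam * fromℕ (f lam mu) * g lam)
    ≡⟨ cong (λ es → ∑ es (λ lam → density lam * fromℕ (f lam mu) * g lam)) (extensions-0 (decreasing⇒strict dec)) ⟩
  density mu * fromℕ (f mu mu) * g mu + 0ℚ
    ≡⟨ cong (λ s → density mu * s * g mu + 0ℚ) (f-self mu) ⟩
  density mu * 1ℚ * g mu + 0ℚ
    ≡⟨ simplify (density mu) (g mu) ⟩
  density mu * g mu ∎
  where
  open ≡-Reasoning
  simplify : ∀ k h → k * 1ℚ * h + 0ℚ ≡ k * h
  simplify = solve-∀ ring

⟦⟧-*-cong : ∀ {A : Set} (d : Dec A) {a b : ℚ} → (A → a ≡ b) → ⟦ d ⟧ * a ≡ ⟦ d ⟧ * b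
⟦⟧-*-cong (yes p)         eq = cong (1ℚ *_) (eq p)
⟦⟧-*-cong (no _)  {a} {b} eq = trans (*-zeroˡ a) (sym (*-zeroˡ b))

-- The bracket of strictness disappears because residues at non-admissible rows are zero anyway.
weighted-1 : ∀ g {mu} → Decreasing mu → weighted g 1 mu ≡ density mu * average mu (g ∘ addBox mu)
weighted-1 g {mu} dec = trans (weighted-suc g 0 dec) (trans
  (∑-cong (rows mu) (λ i → compare i (decreasing? (addBox mu i))))
  (∑-*ˡ (rows mu) (density mu) (λ i → residue mu i * g (addBox mu i))))
  where
  compare : ∀ i (d : Dec (Decreasing (addBox mu i))) →
    ⟦ d ⟧ * weighted g 0 (addBox mu i) ≡ density mu * (residue mu i * g (addBox mu i))
  compare i (yes dec′) = trans (*-identityˡ (weighted g 0 (addBox mu i)))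
    (trans (weighted-0 g dec′)
    (trans (cong (_* g (addBox mu i)) (density-addBox dec i dec′))
           (*-assoc (density mu) (residue mu i) (g (addBox mu i)))))
  compare i (no ¬dec′) = trans (*-zeroˡ (weighted g 0 (addBox mu i))) (sym
    (trans (cong (λ w → density mu * (w * g (addBox mu i))) (residue-nonstrict dec i ¬dec′))
           (vanish (density mu) (g (addBox mu i)))))
    where
    vanish : ∀ k h → k * (0ℚ * h) ≡ 0ℚ
    vanish = solve-∀ ring

-- The equation for g applies at the outer end, where the last box is added, whereas `weighted-suc`
-- splits off the first box. Induction on n carries the equation through, as `weighted-suc` is
-- linear in the function.
weighted-difference : ∀ {g h} → (∀ {mu} → Decreasing mu → average mu (g ∘ addBox mu) ≡ g mu + h mu) →
  ∀ n {mu} → Decreasing mu → weighted g (suc n) mu ≡ weighted g n mu + weighted h n mu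
weighted-difference {g} {h} eq zero {mu} dec = begin
  weighted g 1 mu                                  ≡⟨ weighted-1 g dec ⟩
  density mu * average mu (g ∘ addBox mu)          ≡⟨ cong (density mu *_) (eq dec) ⟩
  density mu * (g mu + h mu)                       ≡⟨ *-distribˡ-+ (density mu) (g mu) (h mu) ⟩
  density mu * g mu + density mu * h mu            ≡⟨ cong₂ _+_ (weighted-0 g dec) (weighted-0 h dec) ⟨
  weighted g 0 mu + weighted h 0 mu                ∎
  where open ≡-Reasoning
weighted-difference {g} {h} eq (suc n) {mu} dec = begin
  weighted g (suc (suc n)) mu
    ≡⟨ weighted-suc g (suc n) dec ⟩
  ∑ (rows mu) (λ i → ⟦ d i ⟧ * weighted g (suc n) (addBox mu i))
    ≡⟨ ∑-cong (rows mu) (λ i → trans (⟦⟧-*-cong (d i) (weighted-difference {g} {h} eq n))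
         (*-distribˡ-+ ⟦ d i ⟧ (weighted g n (addBox mu i)) (weighted h n (addBox mu i)))) ⟩
  ∑ (rows mu) (λ i → ⟦ d i ⟧ * weighted g n (addBox mu i) + ⟦ d i ⟧ * weighted h n (addBox mu i))
    ≡⟨ ∑-+ (rows mu) (λ i → ⟦ d i ⟧ * weighted g n (addBox mu i)) (λ i → ⟦ d i ⟧ * weighted h n (addBox mu i)) ⟩
  ∑ (rows mu) (λ i → ⟦ d i ⟧ * weighted g n (addBox mu i)) + ∑ (rows mu) (λ i → ⟦ d i ⟧ * weighted h n (addBox mu i))
    ≡⟨ cong₂ _+_ (weighted-suc g n dec) (weighted-suc h n dec) ⟨
  weighted g (suc n) mu + weighted h (suc n) mu ∎
  where
  open ≡-Reasoning
  d : ∀ i → Dec (Decreasing (addBox mu i))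
  d i = decreasing? (addBox mu i)

-- Newton expansions and discrete summation.

binomial : ℕ → ℚ → ℚ
binomial zero    x = 1ℚ
binomial (suc k) x = binomial k x * (x - fromℕ k) * inv (fromℕ (suc k))

binomial-pascal : ∀ k x → binomial (suc k) (x + 1ℚ) ≡ binomial (suc k) x + binomial k x
binomial-pascal zero    x = simplify x
  where
  simplify : ∀ x → 1ℚ * (x + 1ℚ - 0ℚ) * 1ℚ ≡ 1ℚ * (x - 0ℚ) * 1ℚ + 1ℚ
  simplify = solve-∀ ring
binomial-pascal (suc k) x = begin
  binomial (suc k) (x + 1ℚ) * (x + 1ℚ - fromℕ (suc k)) * i₂
    ≡⟨ cong₂ (λ b s → b * (x + 1ℚ - s) * i₂) (binomial-pascal k x) (fromℕ-suc k) ⟩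
  (b₀ * (x - K) * i₁ + b₀) * (x + 1ℚ - (K + 1ℚ)) * i₂
    ≡⟨ split b₀ x K i₁ i₂ ⟩
  b₀ * (x - K) * i₁ * (x - K) * i₂ + b₀ * (x - K) * i₂ * 1ℚ
    ≡⟨ cong (λ s → b₀ * (x - K) * i₁ * (x - K) * i₂ + b₀ * (x - K) * i₂ * s)
         (trans (sym (*-inv (fromℕ-≢0 {suc k} (λ ())))) (cong (_* i₁) (fromℕ-suc k))) ⟩
  b₀ * (x - K) * i₁ * (x - K) * i₂ + b₀ * (x - K) * i₂ * ((K + 1ℚ) * i₁)
    ≡⟨ regroup b₀ x K i₁ i₂ ⟩
  b₀ * (x - K) * i₁ * (x - (K + 1ℚ)) * i₂ + b₀ * (x - K) * i₁ * ((K + 1ℚ + 1ℚ) * i₂)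
    ≡⟨ cong (λ s → b₀ * (x - K) * i₁ * (x - (K + 1ℚ)) * i₂ + b₀ * (x - K) * i₁ * s)
         (trans (cong (_* i₂) (trans (cong (_+ 1ℚ) (sym (fromℕ-suc k))) (sym (fromℕ-suc (suc k)))))
                (*-inv (fromℕ-≢0 {suc (suc k)} (λ ())))) ⟩
  b₀ * (x - K) * i₁ * (x - (K + 1ℚ)) * i₂ + b₀ * (x - K) * i₁ * 1ℚ
    ≡⟨ cong₂ (λ s t → b₀ * (x - K) * i₁ * (x - s) * i₂ + t) (sym (fromℕ-suc k)) (*-identityʳ (b₀ * (x - K) * i₁)) ⟩
  binomial (suc (suc k)) x + binomial (suc k) x ∎
  where
  open ≡-Reasoning
  K = fromℕ k
  b₀ = binomial k x
  i₁ = inv (fromℕ (suc k))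
  i₂ = inv (fromℕ (suc (suc k)))
  split : ∀ b x K i j → (b * (x - K) * i + b) * (x + 1ℚ - (K + 1ℚ)) * j ≡
    b * (x - K) * i * (x - K) * j + b * (x - K) * j * 1ℚ
  split = solve-∀ ring
  regroup : ∀ b x K i j →
    b * (x - K) * i * (x - K) * j + b * (x - K) * j * ((K + 1ℚ) * i) ≡
    b * (x - K) * i * (x - (K + 1ℚ)) * j + b * (x - K) * i * ((K + 1ℚ + 1ℚ) * j)
  regroup = solve-∀ ring

binomial-0 : ∀ k → binomial (suc k) 0ℚ ≡ 0ℚ
binomial-0 zero    = refl
binomial-0 (suc k) = trans (cong (λ b → b * (0ℚ - fromℕ (suc k)) * inv (fromℕ (suc (suc k)))) (binomial-0 k))
  (vanish (0ℚ - fromℕ (suc k)) (inv (fromℕ (suc (suc k)))))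
  where
  vanish : ∀ a b → 0ℚ * a * b ≡ 0ℚ
  vanish = solve-∀ ring

-- Coefficients in the basis of binomials starting at index k; raising the start index is a discrete
-- antiderivative.
newton : ℕ → List ℚ → ℚ → ℚ
newton k []       x = 0ℚ
newton k (c ∷ cs) x = c * binomial k x + newton (suc k) cs x

newton-shift : ∀ k cs x → newton (suc k) cs (x + 1ℚ) ≡ newton (suc k) cs x + newton k cs x
newton-shift k []       x = refl
newton-shift k (c ∷ cs) x = trans
  (cong₂ (λ b s → c * b + s) (binomial-pascal k x) (newton-shift (suc k) cs x))
  (regroup c (binomial (suc k) x) (binomial k x) (newton (suc (suc k)) cs x) (newton (suc k) cs x))
  where
  regroup : ∀ c b b′ s s′ → c * (b + b′) + (s + s′) ≡ (c * b + s) + (c * b′ + s′)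
  regroup = solve-∀ ring

newton-0 : ∀ k cs → newton (suc k) cs 0ℚ ≡ 0ℚ
newton-0 k []       = refl
newton-0 k (c ∷ cs) = cong₂ _+_ (trans (cong (c *_) (binomial-0 k)) (*-zeroʳ c)) (newton-0 (suc k) cs)

-- Shifting the coefficients up one index sums them by Pascal's rule, and the initial value becomes
-- the constant term since the higher binomials vanish at 0.
summation : ∀ (a : ℕ → ℚ) cs → (∀ n → a (suc n) ≡ a n + newton 0 cs (fromℕ n)) →
  ∀ n → a n ≡ newton 0 (a 0 ∷ cs) (fromℕ n)
summation a cs step zero    = sym (trans (cong (a 0 * 1ℚ +_) (newton-0 0 cs)) (simplify (a 0)))
  where
  simplify : ∀ a → a * 1ℚ + 0ℚ ≡ a
  simplify = solve-∀ ring
summation a cs step (suc n) = begin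
  a (suc n)                                                       ≡⟨ step n ⟩
  a n + newton 0 cs x                                             ≡⟨ cong (_+ newton 0 cs x) (summation a cs step n) ⟩
  a 0 * 1ℚ + newton 1 cs x + newton 0 cs x                        ≡⟨ +-assoc (a 0 * 1ℚ) (newton 1 cs x) (newton 0 cs x) ⟩
  a 0 * 1ℚ + (newton 1 cs x + newton 0 cs x)                      ≡⟨ cong (a 0 * 1ℚ +_) (newton-shift 0 cs x) ⟨
  a 0 * 1ℚ + newton 1 cs (x + 1ℚ)                                 ≡⟨ cong (λ y → a 0 * 1ℚ + newton 1 cs y) (fromℕ-suc n) ⟨
  a 0 * 1ℚ + newton 1 cs (fromℕ (suc n))                          ∎
  where
  open ≡-Reasoning
  x = fromℕ n

-- Induction on the order: the difference in n is the weighted sum of a function of lower order,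
-- already expanded. Order d yields d + 1 coefficients.
weighted-newton : ∀ d {g mu} → Order d g → Decreasing mu →
  ∃[ cs ] (∀ n → weighted g n mu ≡ newton 0 cs (fromℕ n))
weighted-newton zero {g} {mu} G dec = weighted g 0 mu ∷ [] ,
  summation (λ n → weighted g n mu) [] (λ n → trans
    (weighted-difference {g} {λ _ → 0ℚ} (λ {mu} dec → trans (average-order-0 G dec) (sym (+-identityʳ (g mu)))) n dec)
    (cong (weighted g n mu +_) (∑-zero (extensions mu n) (λ {lam} _ → *-zeroʳ (density lam * fromℕ (f lam mu))))))
weighted-newton (suc d) {g} {mu} G dec = helper (average-order-suc G)
  where
  combine : ∀ {h} → (∀ {mu} → Decreasing mu → average mu (g ∘ addBox mu) ≡ g mu + h mu) →
    ∃[ cs ] (∀ n → weighted h n mu ≡ newton 0 cs (fromℕ n)) → ∃[ cs ] (∀ n → weighted g n mu ≡ newton 0 cs (fromℕ n))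
  combine {h} eq (cs , eq′) = weighted g 0 mu ∷ cs , summation (λ n → weighted g n mu) cs
    (λ n → trans (weighted-difference {g} {h} eq n dec) (cong (weighted g n mu +_) (eq′ n)))
  helper : Difference d g → ∃[ cs ] (∀ n → weighted g n mu ≡ newton 0 cs (fromℕ n))
  helper (h , H , eq) = combine {h} eq (weighted-newton d {h} H dec)

-- From Newton expansions to coefficient lists.

IsPolynomial : (ℚ → ℚ) → Set
IsPolynomial φ = ∃[ p ] (∀ x → φ x ≡ evalPoly p x)

scalePoly : ℚ → List ℚ → List ℚ
scalePoly a = map (a *_)

evalPoly-scale : ∀ a p x → evalPoly (scalePoly a p) x ≡ a * evalPoly p x
evalPoly-scale a []      x = sym (*-zeroʳ a)
evalPoly-scale a (c ∷ p) x = trans (cong (λ e → a * c + x * e) (evalPoly-scale a p x)) (factor a c x (evalPoly p x))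
  where
  factor : ∀ a c x e → a * c + x * (a * e) ≡ a * (c + x * e)
  factor = solve-∀ ring

addPoly : List ℚ → List ℚ → List ℚ
addPoly []      q       = q
addPoly (c ∷ p) []      = c ∷ p
addPoly (c ∷ p) (e ∷ q) = c + e ∷ addPoly p q

evalPoly-add : ∀ p q x → evalPoly (addPoly p q) x ≡ evalPoly p x + evalPoly q x
evalPoly-add []      q       x = sym (+-identityˡ (evalPoly q x))
evalPoly-add (c ∷ p) []      x = sym (+-identityʳ (c + x * evalPoly p x))
evalPoly-add (c ∷ p) (e ∷ q) x = trans (cong (λ s → c + e + x * s) (evalPoly-add p q x))
  (regroup c e x (evalPoly p x) (evalPoly q x))
  where
  regroup : ∀ c e x p q → c + e + x * (p + q) ≡ (c + x * p) + (e + x * q)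
  regroup = solve-∀ ring

polynomial-scale : ∀ a {φ} → IsPolynomial φ → IsPolynomial (λ x → a * φ x)
polynomial-scale a (p , eq) = scalePoly a p , λ x → trans (cong (a *_) (eq x)) (sym (evalPoly-scale a p x))

polynomial-+ : ∀ {φ ψ} → IsPolynomial φ → IsPolynomial ψ → IsPolynomial (λ x → φ x + ψ x)
polynomial-+ (p , eq) (q , eq′) = addPoly p q , λ x → trans (cong₂ _+_ (eq x) (eq′ x)) (sym (evalPoly-add p q x))

polynomial-binomial : ∀ k → IsPolynomial (binomial k)
polynomial-binomial zero    = 1ℚ ∷ [] , λ x → sym (trans (cong (1ℚ +_) (*-zeroʳ x)) (+-identityʳ 1ℚ))
polynomial-binomial (suc k) = multiply-linear (polynomial-binomial k)
  where
  i = inv (fromℕ (suc k))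
  regroup : ∀ x a i e → e * (x - a) * i ≡ i * (0ℚ + x * e) + (- (a * i)) * e
  regroup = solve-∀ ring
  multiply-linear : IsPolynomial (binomial k) → IsPolynomial (binomial (suc k))
  -- The list `0ℚ ∷ p` stands for x times p.
  multiply-linear (p , eq) = addPoly (scalePoly i (0ℚ ∷ p)) (scalePoly (- (fromℕ k * i)) p) , λ x → begin
    binomial k x * (x - fromℕ k) * i
      ≡⟨ cong (λ b → b * (x - fromℕ k) * i) (eq x) ⟩
    evalPoly p x * (x - fromℕ k) * i
      ≡⟨ regroup x (fromℕ k) i (evalPoly p x) ⟩
    i * evalPoly (0ℚ ∷ p) x + (- (fromℕ k * i)) * evalPoly p x
      ≡⟨ cong₂ _+_ (evalPoly-scale i (0ℚ ∷ p) x) (evalPoly-scale (- (fromℕ k * i)) p x) ⟨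
    evalPoly (scalePoly i (0ℚ ∷ p)) x + evalPoly (scalePoly (- (fromℕ k * i)) p) x
      ≡⟨ evalPoly-add (scalePoly i (0ℚ ∷ p)) (scalePoly (- (fromℕ k * i)) p) x ⟨
    evalPoly (addPoly (scalePoly i (0ℚ ∷ p)) (scalePoly (- (fromℕ k * i)) p)) x ∎
    where open ≡-Reasoning

polynomial-newton : ∀ k cs → IsPolynomial (newton k cs)
polynomial-newton k []       = [] , λ _ → refl
polynomial-newton k (c ∷ cs) = polynomial-+ {λ x → c * binomial k x} {newton (suc k) cs}
  (polynomial-scale c {binomial k} (polynomial-binomial k)) (polynomial-newton (suc k) cs)

twoPower-≢0 : ∀ mu → twoPower mu ≢ 0ℚ
twoPower-≢0 mu = fromℕ-≢0 (ℕ.≢-nonZero⁻¹ (2 ℕ.^ excess mu) ⦃ ℕₚ.m^n≢0 2 (excess mu) ⦄)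

-- The powers of 2 in `weight` are relative to μ, those in `density` are absolute; `twoPower mu` is
-- the constant between them.
P-weighted : ∀ Q {mu} → IsStrict mu → ∀ n →
  P Q mu n ≡ inv (twoPower mu) * weighted (λ lam → evaluate Q (contentValues lam)) n mu
P-weighted Q {mu} strict n = *-cancelˡ (twoPower-≢0 mu) (begin
  twoPower mu * P Q mu n
    ≡⟨ ∑-*ˡ (extensions mu n) (twoPower mu) (λ lam → weight lam mu * q lam) ⟨
  ∑ (extensions mu n) (λ lam → twoPower mu * (weight lam mu * q lam))
    ≡⟨ ∑-cong-∈ (extensions mu n) (λ {lam} lam∈ → let (_ , lam>0) , _ , sub = ∈-extensions⁻ mu n lam∈ in
         trans (sym (*-assoc (twoPower mu) (weight lam mu) (q lam)))
               (cong (_* q lam) (weight-density {lam} {mu} lam>0 (proj₂ strict) sub))) ⟩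
  weighted q n mu
    ≡⟨ *-identityˡ (weighted q n mu) ⟨
  1ℚ * weighted q n mu
    ≡⟨ cong (_* weighted q n mu) (*-inv (twoPower-≢0 mu)) ⟨
  twoPower mu * inv (twoPower mu) * weighted q n mu
    ≡⟨ *-assoc (twoPower mu) (inv (twoPower mu)) (weighted q n mu) ⟩
  twoPower mu * (inv (twoPower mu) * weighted q n mu) ∎)
  where
  open ≡-Reasoning
  q : List ℕ → ℚ
  q lam = evaluate Q (contentValues lam)

theorem1p1 : (Q : SymmetricFunction) (mu : List ℕ) → IsStrict mu →
    ∃[ p ] (∀ (n : ℕ) → P Q mu n ≡ evalPoly p (fromℕ n))
theorem1p1 Q mu strict = combine (weighted-newton _ (symm Q) (strict⇒decreasing strict))
  where
  q : List ℕ → ℚ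
  q lam = evaluate Q (contentValues lam)
  c = inv (twoPower mu)
  conclude : ∀ cs → (∀ n → weighted q n mu ≡ newton 0 cs (fromℕ n)) → IsPolynomial (λ x → c * newton 0 cs x) →
    ∃[ p ] (∀ (n : ℕ) → P Q mu n ≡ evalPoly p (fromℕ n))
  conclude cs eq (p , eq′) = p , λ n → trans (P-weighted Q strict n) (trans (cong (c *_) (eq n)) (eq′ (fromℕ n)))
  combine : ∃[ cs ] (∀ n → weighted q n mu ≡ newton 0 cs (fromℕ n)) →
    ∃[ p ] (∀ (n : ℕ) → P Q mu n ≡ evalPoly p (fromℕ n))
  combine (cs , eq) = conclude cs eq (polynomial-scale c {newton 0 cs} (polynomial-newton 0 cs))
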